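{- Let $(A_i)_{i\in I}$ be the collection of all infinite arithmetic progressions $\{mh+b : h=0,1,2,\dots\}$ (with $m,b$ positive integers) consisting of positive odd integers and contained in $\mathcal{U}$. Let $a\in\mathcal{U}$. Then $a\in\bigcup_{i\in I}A_i$ if and only if there is an integer $m>1$ such that $\gcd(a-2^k,m)>1$ for every positive integer $k$.
   Context: $\mathcal{U}$ denotes the set of positive odd integers $n$ that cannot be written as $n=p+2^k$ with $p$ a prime and $k$ a positive integer. -}

module Defs where

open import Data.Nat using (ℕ; zero; suc; _+_; _*_; _^_; _≤_; _<_)
open import Data.Nat.Primality using (Prime)
open import Data.Nat.GCD using (gcd)
open import Data.Integer using (ℤ; +_; _-_; ∣_∣)
open import Data.Product using (∃-syntax; _×_)
open import Relation.Nullary using (¬_)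
open import Relation.Binary.PropositionalEquality using (_≡_)

Odd : ℕ → Set
Odd n = ∃[ j ] n ≡ suc (2 * j)

Representable : ℕ → Set
Representable n = ∃[ p ] ∃[ k ] (Prime p × 1 ≤ k × n ≡ p + 2 ^ k)

InU : ℕ → Set
InU n = 1 ≤ n × Odd n × ¬ Representable n

GoodAP : ℕ → ℕ → Set
GoodAP m b = 1 ≤ m × 1 ≤ b × (∀ (h : ℕ) → 1 ≤ m * h + b × Odd (m * h + b) × InU (m * h + b))

InUnionOfAPs : ℕ → Set
InUnionOfAPs a = ∃[ m ] ∃[ b ] (GoodAP m b × ∃[ h ] a ≡ m * h + b)

-- gcd(a - 2^k, m) for integers (a - 2^k may be negative); gcd of absolute values
gcdℤ : ℤ → ℕ → ℕ
gcdℤ x m = gcd ∣ x ∣ m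

CoveringModulus : ℕ → Set
CoveringModulus a = ∃[ m ] (1 < m × (∀ (k : ℕ) → 1 ≤ k → 1 < gcdℤ (+ a - + (2 ^ k)) m))

{-# OPTIONS --safe #-}
-- If p = n - 2^k is prime for some n ≡ a mod m, then gcd(a - 2^k, m) > 1 forces p to divide m, and finitely many p are
-- avoided by enlarging m. Conversely, if gcd(a - 2^k, m) = 1, Dirichlet's theorem gives a large prime in the class of
-- a - 2^k modulo m, so a + m ℕ is not contained in U.
--
-- Dirichlet's theorem is proved without complex characters and without real numbers. For a unit g modulo m let
-- S_g(x) = Σ Λ(d)/d over d ≤ x, d ≡ g, with the logarithm replaced by a rational-valued additive function that is
-- accurate up to a bound X ≫ x. Let u be m-periodic with sum 0 on the units. Writing Λ * 1 = log and
-- μ * 1 = δ, partial summation gives Σ Λ(d)/d L(1, u(d ·)) = O(1), and log x u(1) + Σ Λ(n)/n u(n) equals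
-- Σ μ(d) log(x/d)/d L(1, u(d ·)) + O(1). Composing the two eliminates L(1, u) and leaves, for x' much larger than x,
-- a Selberg formula  log x S_g(x') + Σ_{hk = g} S_h(x) S_k(x') ≈ 2 log x log x' / φ(m).
-- For P_g(x) = 1 - φ(m) S_g(x) / log x it reads P(x) * P(x') ≈ φ(m) P(x'), with |P| ≤ 1 up to a small error. If no
-- prime lies in the class c then P_c ≈ 1, so all terms of the convolutions agree in sign and P is close to
-- a real character χ. Hence Σ Λ(d) χ(d)/d ≈ - log x, which together with Σ Λ(d) χ(d)/d L(1, χ) = O(1) contradicts the
-- lower bound for L(1, χ) obtained from 1 * χ ≥ 0 and (1 * χ)(k²) ≥ 1.
module Submission where

open import Defs
open import Relation.Nullary.Decidable using (from-yes)
open import Data.Nat as ℕ using (ℕ; zero; suc; z≤n; s≤s)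
import Data.Nat.Properties as ℕₚ
open import Data.Nat.Divisibility using (_∣_; _∣?_; divides)
import Data.Nat.Divisibility as ∣ₚ
import Data.Nat.DivMod as DM
import Data.Nat.Coprimality as Cop
open import Data.Nat.Coprimality using (Coprime; coprime?)
import Data.Nat.GCD as GCD
open import Data.Nat.Primality using (Prime; prime?; prime[2]; ¬prime[0]; ¬prime[1]; prime⇒nonZero; prime⇒irreducible; euclidsLemma)
open import Data.Nat.Primality.Factorisation using (PrimeFactorisation; factorise; factorisationUnique; primeFactorisation[p]; primeFactorisation[1])
import Data.Nat.Tactic.RingSolver as ℕ-Solver
open import Data.Nat.ListAction using (sum; product)
open import Data.Nat.ListAction.Properties using (sum-++; product-++; sum-↭)
open import Data.List using (List; []; _∷_; _++_; map; length)
import Data.List.Properties as Listₚ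
open import Data.List.Relation.Unary.All using (All; []; _∷_)
import Data.List.Relation.Unary.All.Properties as Allₚ
import Data.List.Relation.Binary.Permutation.Propositional.Properties as Permₚ
import Data.Integer as ℤ
import Data.Integer.Properties as ℤₚ
open import Data.Rational using (ℚ; mkℚ; 0ℚ; 1ℚ; ½; _+_; _*_; -_; _-_; _≤_; *≤*; ∣_∣; nonNegative; positive)
import Data.Rational.Properties as ℚₚ
open import Data.Product using (∃-syntax; _×_; _,_; proj₁; proj₂)
open import Data.Sum using (_⊎_; inj₁; inj₂; [_,_]′)
open import Data.Empty using (⊥; ⊥-elim)
open import Function using (_∘_)
open import Relation.Nullary using (¬_; Dec; yes; no; contradiction)
open import Relation.Binary.PropositionalEquality using (_≡_; _≢_; refl; sym; trans; cong; cong₂; subst; subst₂; module ≡-Reasoning)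
open import Tactic.RingSolver using (solve-∀)
open import Data.Integer using (-[1+_])
open import Data.Maybe.Base using (Maybe; just; nothing)
open import Tactic.RingSolver.Core.AlmostCommutativeRing using (AlmostCommutativeRing; fromCommutativeRing)

-- The two cut-offs are forced by the error of the Selberg formula: it is quadratic in log x but
-- only linear in log x', against main terms of size log x log x'. At x' = x the error would be as
-- large as the main terms; with log x' = (log x)² it is smaller by a factor of order log x. The
-- bound |P| ≤ 1 at a cut-off comes from the formula in which that cut-off is the second one, by
-- dropping the non-negative convolution. Having it for both P and P' therefore takes three cut-offs
-- 2^T, 2^(T²), 2^(T⁴), of which P and P' use the last two. The logarithm has to be exactly
-- additive, since the convolution identities are used as equations. A non-zero additive function
-- with rational values cannot be monotone, so monotonicity is kept only up to an error 1/X, which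
-- stays harmless after summing X terms. All values of L(1, u) are partial sums up to the same X,
-- chosen last, so that no limits occur. The contradiction is a comparison of explicit constants.

ℚ-ring : AlmostCommutativeRing _ _
ℚ-ring = fromCommutativeRing ℚₚ.+-*-commutativeRing isZero
  where
  isZero : (x : ℚ) → Maybe (0ℚ ≡ x)
  isZero x with 0ℚ ℚₚ.≟ x
  ... | yes p = just p
  ... | no _  = nothing

-- Ordered-field arithmetic on the rationals, reciprocals, absolute values, indicators

infixr 6 _⊕_
_⊕_ : ∀ {a b c d} → a ≤ b → c ≤ d → a + c ≤ b + d
_⊕_ = ℚₚ.+-mono-≤

-- Linear arithmetic: the equation, left to the ring solver, certifies that the hypothesis implies the goal.
lin : ∀ {x y a b} → x ≤ y → b + x ≡ a + y → a ≤ b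
lin {x} {y} {a} {b} x≤y eq = subst₂ _≤_ (r a y) (r b y) (subst (_≤ b + y) eq (ℚₚ.≤-refl {b} ⊕ x≤y) ⊕ ℚₚ.≤-refl)
  where
  r : ∀ p q → (p + q) - q ≡ p
  r = solve-∀ ℚ-ring

0≤1 : 0ℚ ≤ 1ℚ
0≤1 = ℚₚ.nonNegative⁻¹ 1ℚ

1≰0 : ¬ (1ℚ ≤ 0ℚ)
1≰0 (*≤* (ℤ.+≤+ ()))

≤-refl : ∀ {p} → p ≤ p
≤-refl = ℚₚ.≤-refl

≤-trans : ∀ {p q r} → p ≤ q → q ≤ r → p ≤ r
≤-trans = ℚₚ.≤-trans

≤-eq : ∀ {p q} → p ≡ q → p ≤ q
≤-eq = ℚₚ.≤-reflexive

infixr 7 _⊙_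
_⊙_ : ∀ {c p q} → 0ℚ ≤ c → p ≤ q → c * p ≤ c * q
_⊙_ {c} 0≤c = ℚₚ.*-monoˡ-≤-nonNeg c {{nonNegative 0≤c}}

*-monoˡ : ∀ {c p q} → 0ℚ ≤ c → p ≤ q → p * c ≤ q * c
*-monoˡ {c} 0≤c = ℚₚ.*-monoʳ-≤-nonNeg c {{nonNegative 0≤c}}

*-mono : ∀ {a b c d} → 0ℚ ≤ a → 0ℚ ≤ d → a ≤ b → c ≤ d → a * c ≤ b * d
*-mono 0≤a 0≤d a≤b c≤d = ≤-trans (0≤a ⊙ c≤d) (*-monoˡ 0≤d a≤b)

0≤* : ∀ {p q} → 0ℚ ≤ p → 0ℚ ≤ q → 0ℚ ≤ p * q
0≤* {p} {q} 0≤p 0≤q = subst (_≤ p * q) (ℚₚ.*-zeroʳ p) (0≤p ⊙ 0≤q)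

0≤+ : ∀ {p q} → 0ℚ ≤ p → 0ℚ ≤ q → 0ℚ ≤ p + q
0≤+ {p} {q} 0≤p 0≤q = subst (_≤ p + q) (ℚₚ.+-identityˡ 0ℚ) (0≤p ⊕ 0≤q)

-- Recursive, so that `ι (suc n)` unfolds to `1ℚ + ι n` and inductive steps become ring identities.
ι : ℕ → ℚ
ι zero    = 0ℚ
ι (suc n) = 1ℚ + ι n

2ℚ 3ℚ 4ℚ 5ℚ 6ℚ 7ℚ 9ℚ 10ℚ 12ℚ 14ℚ 16ℚ 20ℚ 32ℚ : ℚ
2ℚ  = ι 2
3ℚ  = ι 3
4ℚ  = ι 4
5ℚ  = ι 5
6ℚ  = ι 6
7ℚ  = ι 7
9ℚ  = ι 9
10ℚ = ι 10
12ℚ = ι 12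
14ℚ = ι 14
16ℚ = ι 16
20ℚ = ι 20
32ℚ = ι 32

private
  ι-mkℚ : ∀ n → ι n ≡ mkℚ (ℤ.+ n) 0 (Cop.sym (Cop.1-coprimeTo n))
  ι-mkℚ zero    = refl
  ι-mkℚ (suc n) = trans (cong (1ℚ +_) (ι-mkℚ n))
    (trans (ℚₚ./-cong {(ℤ.+ 1) ℤ.* (ℤ.+ 1) ℤ.+ (ℤ.+ n) ℤ.* (ℤ.+ 1)} {1} (cong (λ z → ℤ.+ 1 ℤ.+ z) (ℤₚ.*-identityʳ (ℤ.+ n))) refl) (ℚₚ.normalize-coprime (Cop.sym (Cop.1-coprimeTo (suc n)))))

opaque
  -- inv 0 = 0, so that inv is multiplicative without side conditions.
  inv : ℕ → ℚ
  inv zero    = 0ℚ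
  inv (suc n) = mkℚ (ℤ.+ 1) n (Cop.1-coprimeTo (suc n))

  inv-zero : inv 0 ≡ 0ℚ
  inv-zero = refl

  ι*inv : ∀ {n} → 1 ℕ.≤ n → ι n * inv n ≡ 1ℚ
  ι*inv {suc n} _ = trans (cong (_* inv (suc n)) (ι-mkℚ (suc n))) (ℚₚ.*-inverseʳ (mkℚ (ℤ.+ suc n) 0 (Cop.sym (Cop.1-coprimeTo (suc n)))))

  0≤inv : ∀ n → 0ℚ ≤ inv n
  0≤inv zero    = ≤-refl
  0≤inv (suc n) = *≤* (ℤ.+≤+ z≤n)

archimedean : ∀ q → ∃[ n ] q ≤ ι n
archimedean q@(mkℚ (ℤ.+ n) d _) = n , subst (q ≤_) (sym (ι-mkℚ n)) (*≤* (ℤₚ.*-monoˡ-≤-nonNeg (ℤ.+ n) (ℤ.+≤+ (s≤s z≤n))))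
archimedean (mkℚ -[1+ n ] d _) = 0 , *≤* ℤ.-≤+

0≤ι : ∀ n → 0ℚ ≤ ι n
0≤ι zero    = ≤-refl
0≤ι (suc n) = 0≤+ 0≤1 (0≤ι n)

ι-+ : ∀ m n → ι (m ℕ.+ n) ≡ ι m + ι n
ι-+ zero    n = sym (ℚₚ.+-identityˡ (ι n))
ι-+ (suc m) n = trans (cong (1ℚ +_) (ι-+ m n)) (sym (ℚₚ.+-assoc 1ℚ (ι m) (ι n)))

ι-* : ∀ m n → ι (m ℕ.* n) ≡ ι m * ι n
ι-* zero    n = sym (ℚₚ.*-zeroˡ (ι n))
ι-* (suc m) n = trans (ι-+ n (m ℕ.* n)) (trans (cong (ι n +_) (ι-* m n)) (r (ι m) (ι n)))
  where
  r : ∀ m n → n + m * n ≡ (1ℚ + m) * n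
  r = solve-∀ ℚ-ring

ι-mono : ∀ {m n} → m ℕ.≤ n → ι m ≤ ι n
ι-mono {n = n} z≤n = 0≤ι n
ι-mono (s≤s m≤n)   = ≤-refl {1ℚ} ⊕ ι-mono m≤n

ι-cancel-≤ : ∀ {m n} → ι m ≤ ι n → m ℕ.≤ n
ι-cancel-≤ {m} {n} h with m ℕₚ.≤? n
... | yes p = p
... | no ¬p = ⊥-elim (1≰0 (lin (≤-trans (ι-mono (ℕₚ.≰⇒> ¬p)) h) (r (ι n))))
  where
  r : ∀ n → 0ℚ + (1ℚ + n) ≡ 1ℚ + n
  r = solve-∀ ℚ-ring

inv*ι : ∀ {n} → 1 ℕ.≤ n → inv n * ι n ≡ 1ℚ
inv*ι {n} h = trans (ℚₚ.*-comm (inv n) (ι n)) (ι*inv h)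

inv-unique : ∀ {n} q → 1 ℕ.≤ n → ι n * q ≡ 1ℚ → inv n ≡ q
inv-unique {n} q h e = begin
  inv n             ≡⟨ sym (ℚₚ.*-identityʳ _) ⟩
  inv n * 1ℚ        ≡⟨ cong (inv n *_) (sym e) ⟩
  inv n * (ι n * q) ≡⟨ sym (ℚₚ.*-assoc (inv n) (ι n) q) ⟩
  inv n * ι n * q   ≡⟨ cong (_* q) (inv*ι h) ⟩
  1ℚ * q            ≡⟨ ℚₚ.*-identityˡ q ⟩
  q                 ∎
  where open ≡-Reasoning

inv-* : ∀ m n → inv (m ℕ.* n) ≡ inv m * inv n
inv-* zero n = trans inv-zero (sym (trans (cong (_* inv n) inv-zero) (ℚₚ.*-zeroˡ (inv n))))
inv-* (suc m) zero = trans (cong inv (ℕₚ.*-zeroʳ m)) (trans inv-zero (sym (trans (cong (inv (suc m) *_) inv-zero) (ℚₚ.*-zeroʳ (inv (suc m))))))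
inv-* (suc m) (suc n) = inv-unique _ (s≤s z≤n)
  (trans (cong (_* (inv (suc m) * inv (suc n))) (ι-* (suc m) (suc n)))
  (trans (r (ι (suc m)) (ι (suc n)) (inv (suc m)) (inv (suc n))) (cong₂ _*_ (ι*inv {suc m} (s≤s z≤n)) (ι*inv {suc n} (s≤s z≤n)))))
  where
  r : ∀ a b c d → (a * b) * (c * d) ≡ (a * c) * (b * d)
  r = solve-∀ ℚ-ring

inv-1 : inv 1 ≡ 1ℚ
inv-1 = inv-unique 1ℚ (s≤s z≤n) refl

*-cancelˡ-ι : ∀ {n p q} → 1 ℕ.≤ n → ι n * p ≤ ι n * q → p ≤ q
*-cancelˡ-ι {n} {p} {q} h le = subst₂ _≤_ (e p) (e q) (0≤inv n ⊙ le)
  where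
  e : ∀ p → inv n * (ι n * p) ≡ p
  e p = trans (sym (ℚₚ.*-assoc (inv n) (ι n) p)) (trans (cong (_* p) (inv*ι h)) (ℚₚ.*-identityˡ p))

inv-anti : ∀ {m n} → 1 ℕ.≤ m → m ℕ.≤ n → inv n ≤ inv m
inv-anti {m} {n} h m≤n = *-cancelˡ-ι {n} (ℕₚ.≤-trans h m≤n)
  (subst (_≤ ι n * inv m) (trans (ι*inv h) (sym (ι*inv (ℕₚ.≤-trans h m≤n)))) (*-monoˡ (0≤inv m) (ι-mono m≤n)))

inv≤1 : ∀ n → inv n ≤ 1ℚ
inv≤1 zero    = subst (_≤ 1ℚ) (sym inv-zero) 0≤1
inv≤1 (suc n) = subst (inv (suc n) ≤_) inv-1 (inv-anti (s≤s z≤n) (s≤s z≤n))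

∣∣≤ : ∀ {p c} → p ≤ c → - p ≤ c → ∣ p ∣ ≤ c
∣∣≤ {p} h₁ h₂ with ℚₚ.∣p∣≡p∨∣p∣≡-p p
... | inj₁ e = subst (_≤ _) (sym e) h₁
... | inj₂ e = subst (_≤ _) (sym e) h₂

p≤∣p∣ : ∀ p → p ≤ ∣ p ∣
p≤∣p∣ p with ℚₚ.≤-total 0ℚ p
... | inj₁ h = ≤-eq (sym (ℚₚ.0≤p⇒∣p∣≡p h))
... | inj₂ h = ≤-trans h (ℚₚ.0≤∣p∣ p)

-p≤∣p∣ : ∀ p → - p ≤ ∣ p ∣
-p≤∣p∣ p = subst (- p ≤_) (ℚₚ.∣-p∣≡∣p∣ p) (p≤∣p∣ (- p))

∣∣≥0 : ∀ {p} → 0ℚ ≤ p → ∣ p ∣ ≡ p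
∣∣≥0 = ℚₚ.0≤p⇒∣p∣≡p

∣*∣≤ : ∀ {p q a b} → ∣ p ∣ ≤ a → ∣ q ∣ ≤ b → ∣ p * q ∣ ≤ a * b
∣*∣≤ {p} {q} h₁ h₂ = subst (_≤ _) (sym (ℚₚ.∣p*q∣≡∣p∣*∣q∣ p q)) (*-mono (ℚₚ.0≤∣p∣ p) (≤-trans (ℚₚ.0≤∣p∣ q) h₂) h₁ h₂)

∣+∣≤ : ∀ {p q a b} → ∣ p ∣ ≤ a → ∣ q ∣ ≤ b → ∣ p + q ∣ ≤ a + b
∣+∣≤ {p} {q} h₁ h₂ = ≤-trans (ℚₚ.∣p+q∣≤∣p∣+∣q∣ p q) (h₁ ⊕ h₂)

∣-∣≤ : ∀ {p q a b} → ∣ p ∣ ≤ a → ∣ q ∣ ≤ b → ∣ p - q ∣ ≤ a + b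
∣-∣≤ {p} {q} h₁ h₂ = ≤-trans (ℚₚ.∣p-q∣≤∣p∣+∣q∣ p q) (h₁ ⊕ h₂)

𝟙 : ∀ {P : Set} → Dec P → ℚ
𝟙 (yes _) = 1ℚ
𝟙 (no _)  = 0ℚ

𝟙-yes : ∀ {P : Set} (d : Dec P) → P → 𝟙 d ≡ 1ℚ
𝟙-yes (yes _) _ = refl
𝟙-yes (no ¬p) p = contradiction p ¬p

𝟙-no : ∀ {P : Set} (d : Dec P) → ¬ P → 𝟙 d ≡ 0ℚ
𝟙-no (yes p) ¬p = contradiction p ¬p
𝟙-no (no _)  _  = refl

𝟙-⇔ : ∀ {P Q : Set} (d : Dec P) (e : Dec Q) → (P → Q) → (Q → P) → 𝟙 d ≡ 𝟙 e
𝟙-⇔ (yes p) e f g = sym (𝟙-yes e (f p))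
𝟙-⇔ (no ¬p) e f g = sym (𝟙-no e (¬p ∘ g))

0≤𝟙 : ∀ {P : Set} (d : Dec P) → 0ℚ ≤ 𝟙 d
0≤𝟙 (yes _) = 0≤1
0≤𝟙 (no _)  = ≤-refl

𝟙≤1 : ∀ {P : Set} (d : Dec P) → 𝟙 d ≤ 1ℚ
𝟙≤1 (yes _) = ≤-refl
𝟙≤1 (no _)  = 0≤1

𝟙*-cong : ∀ {P : Set} (d : Dec P) {a b} → (P → a ≡ b) → 𝟙 d * a ≡ 𝟙 d * b
𝟙*-cong (yes p) h = cong (1ℚ *_) (h p)
𝟙*-cong (no _) {a} {b} h = trans (ℚₚ.*-zeroˡ a) (sym (ℚₚ.*-zeroˡ b))

𝟙*-no : ∀ {P : Set} (d : Dec P) {a} → ¬ P → 𝟙 d * a ≡ 0ℚ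
𝟙*-no d {a} ¬p = trans (cong (_* a) (𝟙-no d ¬p)) (ℚₚ.*-zeroˡ a)

𝟙*-yes : ∀ {P : Set} (d : Dec P) {a} → P → 𝟙 d * a ≡ a
𝟙*-yes d {a} p = trans (cong (_* a) (𝟙-yes d p)) (ℚₚ.*-identityˡ a)

𝟙*-mono : ∀ {P : Set} (d : Dec P) {a b} → (P → a ≤ b) → 𝟙 d * a ≤ 𝟙 d * b
𝟙*-mono (yes p) h = 0≤1 ⊙ h p
𝟙*-mono (no _) {a} {b} h = ≤-eq (trans (ℚₚ.*-zeroˡ a) (sym (ℚₚ.*-zeroˡ b)))

-- Finite sums

-- Sums run over 1 … n.
∑ : ℕ → (ℕ → ℚ) → ℚ
∑ zero    f = 0ℚ
∑ (suc n) f = ∑ n f + f (suc n)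

∑-cong : ∀ n {f g : ℕ → ℚ} → (∀ i → 1 ℕ.≤ i → i ℕ.≤ n → f i ≡ g i) → ∑ n f ≡ ∑ n g
∑-cong zero    h = refl
∑-cong (suc n) h = cong₂ _+_ (∑-cong n (λ i 1≤i i≤n → h i 1≤i (ℕₚ.m≤n⇒m≤1+n i≤n))) (h (suc n) (s≤s z≤n) ℕₚ.≤-refl)

∑-cong' : ∀ n {f g : ℕ → ℚ} → (∀ i → f i ≡ g i) → ∑ n f ≡ ∑ n g
∑-cong' n h = ∑-cong n (λ i _ _ → h i)

∑-mono : ∀ n {f g : ℕ → ℚ} → (∀ i → 1 ℕ.≤ i → i ℕ.≤ n → f i ≤ g i) → ∑ n f ≤ ∑ n g
∑-mono zero    h = ≤-refl
∑-mono (suc n) h = ∑-mono n (λ i 1≤i i≤n → h i 1≤i (ℕₚ.m≤n⇒m≤1+n i≤n)) ⊕ h (suc n) (s≤s z≤n) ℕₚ.≤-refl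

∑-zero : ∀ n → ∑ n (λ _ → 0ℚ) ≡ 0ℚ
∑-zero zero    = refl
∑-zero (suc n) = trans (ℚₚ.+-identityʳ _) (∑-zero n)

∑-≡0 : ∀ n {f : ℕ → ℚ} → (∀ i → 1 ℕ.≤ i → i ℕ.≤ n → f i ≡ 0ℚ) → ∑ n f ≡ 0ℚ
∑-≡0 n h = trans (∑-cong n h) (∑-zero n)

0≤∑ : ∀ n {f : ℕ → ℚ} → (∀ i → 1 ℕ.≤ i → i ℕ.≤ n → 0ℚ ≤ f i) → 0ℚ ≤ ∑ n f
0≤∑ n {f} h = subst (_≤ ∑ n f) (∑-zero n) (∑-mono n h)

∑-+ : ∀ n (f g : ℕ → ℚ) → ∑ n (λ i → f i + g i) ≡ ∑ n f + ∑ n g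
∑-+ zero    f g = refl
∑-+ (suc n) f g = trans (cong (_+ (f (suc n) + g (suc n))) (∑-+ n f g)) (r (∑ n f) (∑ n g) (f (suc n)) (g (suc n)))
  where
  r : ∀ a b c d → a + b + (c + d) ≡ a + c + (b + d)
  r = solve-∀ ℚ-ring

∑-*ˡ : ∀ n c (f : ℕ → ℚ) → ∑ n (λ i → c * f i) ≡ c * ∑ n f
∑-*ˡ zero    c f = sym (ℚₚ.*-zeroʳ c)
∑-*ˡ (suc n) c f = trans (cong (_+ c * f (suc n)) (∑-*ˡ n c f)) (sym (ℚₚ.*-distribˡ-+ c (∑ n f) (f (suc n))))

∑-*ʳ : ∀ n c (f : ℕ → ℚ) → ∑ n (λ i → f i * c) ≡ ∑ n f * c
∑-*ʳ n c f = trans (∑-cong' n (λ i → ℚₚ.*-comm (f i) c)) (trans (∑-*ˡ n c f) (ℚₚ.*-comm c (∑ n f)))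

∑-neg : ∀ n (f : ℕ → ℚ) → ∑ n (λ i → - f i) ≡ - ∑ n f
∑-neg zero    f = refl
∑-neg (suc n) f = trans (cong (_+ - f (suc n)) (∑-neg n f)) (sym (ℚₚ.neg-distrib-+ (∑ n f) (f (suc n))))

∑-- : ∀ n (f g : ℕ → ℚ) → ∑ n (λ i → f i - g i) ≡ ∑ n f - ∑ n g
∑-- n f g = trans (∑-+ n f (λ i → - g i)) (cong (∑ n f +_) (∑-neg n g))

∑-const : ∀ n c → ∑ n (λ _ → c) ≡ ι n * c
∑-const zero    c = sym (ℚₚ.*-zeroˡ c)
∑-const (suc n) c = trans (cong (_+ c) (∑-const n c)) (r (ι n) c)
  where
  r : ∀ n c → n * c + c ≡ (1ℚ + n) * c
  r = solve-∀ ℚ-ring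

∑-swap : ∀ m n (f : ℕ → ℕ → ℚ) → ∑ m (λ i → ∑ n (f i)) ≡ ∑ n (λ j → ∑ m (λ i → f i j))
∑-swap zero    n f = sym (∑-zero n)
∑-swap (suc m) n f = trans (cong (_+ ∑ n (f (suc m))) (∑-swap m n f)) (sym (∑-+ n (λ j → ∑ m (λ i → f i j)) (f (suc m))))

∑-abs : ∀ n (f : ℕ → ℚ) → ∣ ∑ n f ∣ ≤ ∑ n (λ i → ∣ f i ∣)
∑-abs zero    f = ≤-refl
∑-abs (suc n) f = ∣+∣≤ {∑ n f} (∑-abs n f) ≤-refl

∑-abs-mono : ∀ n {f g : ℕ → ℚ} → (∀ i → 1 ℕ.≤ i → i ℕ.≤ n → ∣ f i ∣ ≤ g i) → ∣ ∑ n f ∣ ≤ ∑ n g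
∑-abs-mono n h = ≤-trans (∑-abs n _) (∑-mono n h)

∑-split : ∀ m n (f : ℕ → ℚ) → ∑ (m ℕ.+ n) f ≡ ∑ m f + ∑ n (λ i → f (m ℕ.+ i))
∑-split m zero    f = trans (cong (λ k → ∑ k f) (ℕₚ.+-identityʳ m)) (sym (ℚₚ.+-identityʳ _))
∑-split m (suc n) f = trans (cong (λ k → ∑ k f) (ℕₚ.+-suc m n))
  (trans (cong₂ _+_ (∑-split m n f) (cong f (sym (ℕₚ.+-suc m n)))) (ℚₚ.+-assoc (∑ m f) _ _))

∑-extend : ∀ {m n} {f : ℕ → ℚ} → m ℕ.≤ n → (∀ i → m ℕ.< i → i ℕ.≤ n → f i ≡ 0ℚ) → ∑ n f ≡ ∑ m f
∑-extend {m} {n} {f} m≤n h with ℕₚ.m≤n⇒∃[o]m+o≡n m≤n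
... | k , refl = trans (∑-split m k f) (trans (cong (∑ m f +_) (∑-≡0 k (λ i 1≤i i≤k → h (m ℕ.+ i) (ℕₚ.≤-trans (ℕₚ.≤-reflexive (sym (ℕₚ.+-comm m 1))) (ℕₚ.+-monoʳ-≤ m 1≤i)) (ℕₚ.+-monoʳ-≤ m i≤k)))) (ℚₚ.+-identityʳ _))

∑-mono-len : ∀ {m n} {f : ℕ → ℚ} → m ℕ.≤ n → (∀ i → 1 ℕ.≤ i → i ℕ.≤ n → 0ℚ ≤ f i) → ∑ m f ≤ ∑ n f
∑-mono-len {m} {n} {f} m≤n h with ℕₚ.m≤n⇒∃[o]m+o≡n m≤n
... | k , refl = subst₂ _≤_ (ℚₚ.+-identityʳ _) (sym (∑-split m k f))
  (≤-refl {∑ m f} ⊕ 0≤∑ k (λ i 1≤i i≤k → h (m ℕ.+ i) (ℕₚ.≤-trans 1≤i (ℕₚ.m≤n+m i m)) (ℕₚ.+-monoʳ-≤ m i≤k)))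

∑-pick : ∀ n {f : ℕ → ℚ} j → 1 ℕ.≤ j → j ℕ.≤ n → (∀ i → 1 ℕ.≤ i → i ℕ.≤ n → i ≢ j → f i ≡ 0ℚ) → ∑ n f ≡ f j
∑-pick zero j 1≤j j≤0 h = contradiction (ℕₚ.≤-trans 1≤j j≤0) λ ()
∑-pick (suc n) {f} j 1≤j j≤n h with j ℕₚ.≟ suc n
... | yes refl = trans (cong (_+ f (suc n)) (∑-≡0 n (λ i 1≤i i≤n → h i 1≤i (ℕₚ.m≤n⇒m≤1+n i≤n) (ℕₚ.<⇒≢ (s≤s i≤n))))) (ℚₚ.+-identityˡ _)
... | no j≢ = trans (cong₂ _+_ (∑-pick n j 1≤j (ℕₚ.≤-pred (ℕₚ.≤∧≢⇒< j≤n j≢)) (λ i 1≤i i≤n → h i 1≤i (ℕₚ.m≤n⇒m≤1+n i≤n)))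
      (h (suc n) (s≤s z≤n) ℕₚ.≤-refl (j≢ ∘ sym))) (ℚₚ.+-identityʳ _)

∑-𝟙≟ : ∀ n (f : ℕ → ℚ) j → 1 ℕ.≤ j → j ℕ.≤ n → ∑ n (λ i → 𝟙 (j ℕₚ.≟ i) * f i) ≡ f j
∑-𝟙≟ n f j 1≤j j≤n = trans (∑-pick n j 1≤j j≤n (λ i _ _ i≢j → 𝟙*-no (j ℕₚ.≟ i) (i≢j ∘ sym))) (𝟙*-yes (j ℕₚ.≟ j) refl)

≤-∑ : ∀ n {f : ℕ → ℚ} j → 1 ℕ.≤ j → j ℕ.≤ n → (∀ i → 1 ℕ.≤ i → i ℕ.≤ n → 0ℚ ≤ f i) → f j ≤ ∑ n f
≤-∑ n {f} j 1≤j j≤n h = subst (_≤ ∑ n f) (∑-𝟙≟ n f j 1≤j j≤n)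
  (∑-mono n (λ i 1≤i i≤n → ≤-trans (*-monoˡ (h i 1≤i i≤n) (𝟙≤1 (j ℕₚ.≟ i))) (≤-eq (ℚₚ.*-identityˡ (f i)))))

-- ⌊n / d⌋, with quo n 0 = 0.
quo : ℕ → ℕ → ℕ
quo n zero    = 0
quo n (suc d) = n DM./ suc d

quo-≤ : ∀ n {d k} → 1 ℕ.≤ d → k ℕ.≤ quo n d → d ℕ.* k ℕ.≤ n
quo-≤ n {suc d} {k} _ h = ℕₚ.≤-trans (ℕₚ.≤-reflexive (ℕₚ.*-comm (suc d) k)) (ℕₚ.≤-trans (ℕₚ.*-monoˡ-≤ (suc d) h) (DM.m/n*n≤m n (suc d)))

≤-quo : ∀ n {d k} → 1 ℕ.≤ d → d ℕ.* k ℕ.≤ n → k ℕ.≤ quo n d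
≤-quo n {suc d} {k} _ h = subst (ℕ._≤ n DM./ suc d) (trans (cong (DM._/ suc d) (ℕₚ.*-comm (suc d) k)) (DM.m*n/n≡m k (suc d))) (DM./-monoˡ-≤ (suc d) h)

quo≤ : ∀ n d → quo n d ℕ.≤ n
quo≤ n zero    = z≤n
quo≤ n (suc d) = DM.m/n≤m n (suc d)

<-quo : ∀ n {d} → 1 ℕ.≤ d → n ℕ.< d ℕ.* suc (quo n d)
<-quo n {d} 1≤d with d ℕ.* suc (quo n d) ℕₚ.≤? n
... | yes h = contradiction (≤-quo n 1≤d h) ℕₚ.1+n≰n
... | no h  = ℕₚ.≰⇒> h

-- The indicator of divisibility is the sum over k of the indicators of d k = i; then the sums are
-- exchanged.
∑-multiples : ∀ n d (f : ℕ → ℚ) → 1 ℕ.≤ d → ∑ n (λ i → 𝟙 (d ∣? i) * f i) ≡ ∑ (quo n d) (λ k → f (d ℕ.* k))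
∑-multiples n d f 1≤d = begin
  ∑ n (λ i → 𝟙 (d ∣? i) * f i)
    ≡⟨ ∑-cong n (λ i 1≤i i≤n → sym (inner i 1≤i i≤n)) ⟩
  ∑ n (λ i → ∑ (quo n d) (λ k → 𝟙 (d ℕ.* k ℕₚ.≟ i) * f i))
    ≡⟨ ∑-swap n (quo n d) _ ⟩
  ∑ (quo n d) (λ k → ∑ n (λ i → 𝟙 (d ℕ.* k ℕₚ.≟ i) * f i))
    ≡⟨ ∑-cong (quo n d) (λ k 1≤k k≤ → ∑-𝟙≟ n f (d ℕ.* k) (ℕₚ.*-mono-≤ 1≤d 1≤k) (quo-≤ n 1≤d k≤)) ⟩
  ∑ (quo n d) (λ k → f (d ℕ.* k)) ∎
  where
  open ≡-Reasoning
  inner : ∀ i → 1 ℕ.≤ i → i ℕ.≤ n → ∑ (quo n d) (λ k → 𝟙 (d ℕ.* k ℕₚ.≟ i) * f i) ≡ 𝟙 (d ∣? i) * f i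
  inner i 1≤i i≤n with d ∣? i
  ... | no ¬d = trans (∑-≡0 (quo n d) (λ k _ _ → 𝟙*-no (d ℕ.* k ℕₚ.≟ i) (λ e → ¬d (divides k (trans (sym e) (ℕₚ.*-comm d k)))))) (sym (ℚₚ.*-zeroˡ (f i)))
  ... | yes (divides k e) = trans (∑-pick (quo n d) k 1≤k (≤-quo n 1≤d (subst (ℕ._≤ n) (trans e (ℕₚ.*-comm k d)) i≤n))
           (λ j _ _ j≢k → 𝟙*-no (d ℕ.* j ℕₚ.≟ i) (λ e' → j≢k (ℕₚ.*-cancelˡ-≡ j k d {{ℕ.>-nonZero 1≤d}} (trans e' (trans e (ℕₚ.*-comm k d)))))))
         (cong (_* f i) (𝟙-yes (d ℕ.* k ℕₚ.≟ i) (trans (ℕₚ.*-comm d k) (sym e))))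
    where
    1≤k : 1 ℕ.≤ k
    1≤k = ℕₚ.n≢0⇒n>0 λ { refl → contradiction (subst (1 ℕ.≤_) e 1≤i) λ () }

-- Partial summation and oscillating sequences

abel : ∀ x (u f : ℕ → ℚ) → ∑ x (λ n → u n * f n) ≡ ∑ x u * f (suc x) + ∑ x (λ n → ∑ n u * (f n - f (suc n)))
abel zero    u f = sym (trans (ℚₚ.+-identityʳ _) (ℚₚ.*-zeroˡ (f 1)))
abel (suc x) u f = trans (cong (_+ u (suc x) * f (suc x)) (abel x u f)) (r (∑ x u) (u (suc x)) (f (suc x)) (f (suc (suc x))) _)
  where
  r : ∀ U v a b s → U * a + s + v * a ≡ (U + v) * b + (s + (U + v) * (a - b))
  r = solve-∀ ℚ-ring

abel-bound : ∀ {M} x (u f : ℕ → ℚ) → (∀ n → ∣ ∑ n u ∣ ≤ M) →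
  ∣ ∑ x (λ n → u n * f n) ∣ ≤ M * (∣ f (suc x) ∣ + ∑ x (λ n → ∣ f n - f (suc n) ∣))
abel-bound {M} x u f h = subst₂ _≤_ (cong ∣_∣ (sym (abel x u f)))
  (trans (cong (M * ∣ f (suc x) ∣ +_) (∑-*ˡ x M _)) (sym (ℚₚ.*-distribˡ-+ M _ _)))
  (∣+∣≤ {∑ x u * f (suc x)} (∣*∣≤ {∑ x u} (h x) ≤-refl) (∑-abs-mono x (λ n _ _ → ∣*∣≤ {∑ n u} (h n) ≤-refl)))

∑-telescope : ∀ x (f : ℕ → ℚ) → ∑ x (λ n → f n - f (suc n)) ≡ f 1 - f (suc x)
∑-telescope zero    f = sym (ℚₚ.+-inverseʳ (f 1))
∑-telescope (suc x) f = trans (cong (_+ (f (suc x) - f (suc (suc x)))) (∑-telescope x f)) (r (f 1) (f (suc x)) (f (suc (suc x))))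
  where
  r : ∀ a b c → a - b + (b - c) ≡ a - c
  r = solve-∀ ℚ-ring

-- For a decreasing f the variation telescopes, and the boundary term completes it to `f 1`.
abel-mono : ∀ {M} x (u f : ℕ → ℚ) → (∀ n → ∣ ∑ n u ∣ ≤ M) → (∀ n → 1 ℕ.≤ n → f (suc n) ≤ f n) → (∀ n → 0ℚ ≤ f (suc n)) →
  ∣ ∑ x (λ n → u n * f n) ∣ ≤ M * f 1
abel-mono {M} x u f h dec pos = subst (∣ ∑ x (λ n → u n * f n) ∣ ≤_) (cong (M *_) eq) (abel-bound x u f h)
  where
  r : ∀ a b → b + (a - b) ≡ a
  r = solve-∀ ℚ-ring
  s : ∀ a b → (a - b) + b ≡ 0ℚ + a
  s = solve-∀ ℚ-ring
  eq : ∣ f (suc x) ∣ + ∑ x (λ n → ∣ f n - f (suc n) ∣) ≡ f 1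
  eq = trans (cong₂ _+_ (∣∣≥0 (pos x)) (trans (∑-cong x (λ n 1≤n _ → ∣∣≥0 (lin (dec n 1≤n) (s (f n) (f (suc n)))))) (∑-telescope x f))) (r (f 1) (f (suc x)))

dil : ℕ → (ℕ → ℚ) → ℕ → ℚ
dil d u k = u (d ℕ.* k)

-- Uniformity in the dilation d is part of the notion, because the hyperbola method produces sums of
-- u over the multiples of every d.
Osc : ℚ → (ℕ → ℚ) → Set
Osc M u = ∀ d n → 1 ℕ.≤ d → ∣ ∑ n (dil d u) ∣ ≤ M

Osc-dil : ∀ {M u} d → 1 ℕ.≤ d → Osc M u → Osc M (dil d u)
Osc-dil {M} {u} d 1≤d h e n 1≤e = subst (λ s → ∣ s ∣ ≤ M) (∑-cong' n (λ k → cong u (ℕₚ.*-assoc d e k))) (h (d ℕ.* e) n (ℕₚ.*-mono-≤ 1≤d 1≤e))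

Osc⇒bounded : ∀ {M u} → Osc M u → ∀ n → ∣ ∑ n u ∣ ≤ M
Osc⇒bounded {M} {u} h n = subst (λ s → ∣ s ∣ ≤ M) (∑-cong' n (λ k → cong u (ℕₚ.*-identityˡ k))) (h 1 n (s≤s z≤n))

-- For X large, A u X stands for L(1, u).
A : (ℕ → ℚ) → ℕ → ℚ
A u y = ∑ y (λ k → u k * inv k)

-- Partial summation starting after y. The partial sums from there on are differences of two partial
-- sums of u, hence the factor 2.
A-tail : ∀ {M u y X} → Osc M u → y ℕ.≤ X → ∣ A u X - A u y ∣ ≤ 2ℚ * M * inv (suc y)
A-tail {M} {u} {y} {X} osc y≤X with ℕₚ.m≤n⇒∃[o]m+o≡n y≤X
... | j , refl = subst₂ (λ a b → ∣ a ∣ ≤ 2ℚ * M * inv b) eq (ℕₚ.+-comm y 1)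
    (abel-mono j (λ i → u (y ℕ.+ i)) (λ i → inv (y ℕ.+ i)) bd
      (λ n 1≤n → inv-anti (ℕₚ.≤-trans 1≤n (ℕₚ.m≤n+m n y)) (ℕₚ.+-monoʳ-≤ y (ℕₚ.n≤1+n n)))
      (λ n → 0≤inv (y ℕ.+ suc n)))
  where
  r : ∀ a b → b ≡ (a + b) - a
  r = solve-∀ ℚ-ring
  s : ∀ M → M + M ≡ (1ℚ + (1ℚ + 0ℚ)) * M
  s = solve-∀ ℚ-ring
  eq : ∑ j (λ i → u (y ℕ.+ i) * inv (y ℕ.+ i)) ≡ A u (y ℕ.+ j) - A u y
  eq = trans (r (A u y) _) (cong (_- A u y) (sym (∑-split y j (λ k → u k * inv k))))
  bd : ∀ n → ∣ ∑ n (λ i → u (y ℕ.+ i)) ∣ ≤ 2ℚ * M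
  bd n = subst₂ (λ a b → ∣ a ∣ ≤ b) (trans (cong (_- ∑ y u) (∑-split y n u)) (sym (r (∑ y u) _))) (s M)
    (∣-∣≤ {∑ (y ℕ.+ n) u} (Osc⇒bounded osc (y ℕ.+ n)) (Osc⇒bounded osc y))

Osc-∑ : ∀ {M} n (c : ℕ → ℚ) (u : ℕ → ℕ → ℚ) → (∀ i → 1 ℕ.≤ i → i ℕ.≤ n → ∣ c i ∣ ≤ 1ℚ × Osc M (u i)) → Osc (ι n * M) (λ k → ∑ n (λ i → c i * u i k))
Osc-∑ {M} n c u h d k 1≤d = subst₂ (λ a b → ∣ a ∣ ≤ b)
  (trans (∑-cong' n (λ i → sym (∑-*ˡ k (c i) (dil d (u i))))) (∑-swap n k (λ i j → c i * u i (d ℕ.* j)))) (∑-const n M)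
  (∑-abs-mono n (λ i 1≤i i≤n → subst (∣ c i * ∑ k (dil d (u i)) ∣ ≤_) (ℚₚ.*-identityˡ M) (∣*∣≤ {c i} (proj₁ (h i 1≤i i≤n)) (proj₂ (h i 1≤i i≤n) d k 1≤d))))

Osc-cong : ∀ {M u v} → (∀ n → u n ≡ v n) → Osc M u → Osc M v
Osc-cong {M} e h d n 1≤d = subst (λ s → ∣ s ∣ ≤ M) (∑-cong' n (λ k → e (d ℕ.* k))) (h d n 1≤d)

-- Residue classes

module Residues (m : ℕ) {{m≢0 : ℕ.NonZero m}} where

  infix 4 _≋_ _≋?_
  _≋_ : ℕ → ℕ → Set
  a ≋ b = a DM.% m ≡ b DM.% m

  _≋?_ : ∀ a b → Dec (a ≋ b)
  a ≋? b = a DM.% m ℕₚ.≟ b DM.% m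

  1≤m : 1 ℕ.≤ m
  1≤m = ℕ.>-nonZero⁻¹ m

  %-≋ : ∀ a → a DM.% m ≋ a
  %-≋ a = DM.m%n%n≡m%n a m

  *-cong-≋ : ∀ {a b c d} → a ≋ b → c ≋ d → a ℕ.* c ≋ b ℕ.* d
  *-cong-≋ {a} {b} {c} {d} p q = trans (DM.%-distribˡ-* a c m) (trans (cong₂ (λ x y → (x ℕ.* y) DM.% m) p q) (sym (DM.%-distribˡ-* b d m)))

  Unit : ℕ → Set
  Unit a = Coprime a m

  unit? : ∀ a → Dec (Unit a)
  unit? a = coprime? a m

  ∣-resp-≋ : ∀ {a b d} → d ∣ m → a ≋ b → d ∣ a → d ∣ b
  ∣-resp-≋ {a} {b} {d} d∣m a≋b d∣a = ∣ₚ.∣n∣m%n⇒∣m d∣m (subst (d ∣_) a≋b (∣ₚ.%-presˡ-∣ d∣a d∣m))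

  unit-resp-≋ : ∀ {a b} → a ≋ b → Unit a → Unit b
  unit-resp-≋ a≋b ua (d∣b , d∣m) = ua (∣-resp-≋ d∣m (sym a≋b) d∣b , d∣m)

  unit-*ˡ : ∀ {a b} → Unit (a ℕ.* b) → Unit a
  unit-*ˡ {a} {b} u (d∣a , d∣m) = u (∣ₚ.∣m⇒∣m*n b d∣a , d∣m)

  unit-*ʳ : ∀ {a b} → Unit (a ℕ.* b) → Unit b
  unit-*ʳ {a} {b} u (d∣b , d∣m) = u (∣ₚ.∣n⇒∣m*n a d∣b , d∣m)

  unit-* : ∀ {a b} → Unit a → Unit b → Unit (a ℕ.* b)
  unit-* {a} {b} ua ub {d} (d∣ab , d∣m) = ub (Cop.coprime-divisor d⊥a d∣ab , d∣m)
    where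
    d⊥a : Coprime d a
    d⊥a (e∣d , e∣a) = ua (e∣a , ∣ₚ.∣-trans e∣d d∣m)

  unit-1 : Unit 1
  unit-1 = Cop.1-coprimeTo m

  inverse : ∀ a → Unit a → ∃[ b ] a ℕ.* b ≋ 1
  inverse a ua with Cop.coprime-Bézout ua
  ... | GCD.Bézout.+- x y eq = x , trans (cong (DM._% m) (trans (ℕₚ.*-comm a x) (sym eq))) (DM.[m+kn]%n≡m%n 1 y m)
  -- The relation is 1 + x a = y m, so the inverse is -x, represented by x (m - 1).
  ... | GCD.Bézout.-+ x y eq = x ℕ.* ℕ.pred m , trans (sym (DM.[m+n]%n≡m%n (a ℕ.* (x ℕ.* ℕ.pred m)) m)) (trans (cong (DM._% m) key) (DM.[m+kn]%n≡m%n 1 (y ℕ.* ℕ.pred m) m))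
    where
    open ≡-Reasoning
    key : a ℕ.* (x ℕ.* ℕ.pred m) ℕ.+ m ≡ 1 ℕ.+ (y ℕ.* ℕ.pred m) ℕ.* m
    key = begin
      a ℕ.* (x ℕ.* ℕ.pred m) ℕ.+ m                  ≡⟨ cong₂ ℕ._+_ (trans (sym (ℕₚ.*-assoc a x _)) (cong (ℕ._* ℕ.pred m) (ℕₚ.*-comm a x))) (sym (ℕₚ.suc-pred m)) ⟩
      x ℕ.* a ℕ.* ℕ.pred m ℕ.+ (1 ℕ.+ ℕ.pred m)     ≡⟨ trans (sym (ℕₚ.+-assoc _ 1 _)) (trans (cong (ℕ._+ ℕ.pred m) (ℕₚ.+-comm _ 1)) (cong suc (ℕₚ.+-comm (x ℕ.* a ℕ.* ℕ.pred m) _))) ⟩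
      1 ℕ.+ ((1 ℕ.+ x ℕ.* a) ℕ.* ℕ.pred m)          ≡⟨ cong (λ z → 1 ℕ.+ z ℕ.* ℕ.pred m) eq ⟩
      1 ℕ.+ (y ℕ.* m ℕ.* ℕ.pred m)                  ≡⟨ cong suc (trans (ℕₚ.*-assoc y m _) (trans (cong (y ℕ.*_) (ℕₚ.*-comm m _)) (sym (ℕₚ.*-assoc y _ m)))) ⟩
      1 ℕ.+ (y ℕ.* ℕ.pred m) ℕ.* m                  ∎

  *-cancelˡ-≋ : ∀ a {b c} → Unit a → a ℕ.* b ≋ a ℕ.* c → b ≋ c
  *-cancelˡ-≋ a {b} {c} ua h with inverse a ua
  ... | a' , aa'≋1 = trans (sym (e b)) (trans (*-cong-≋ {a'} refl h) (e c))
    where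
    e : ∀ b → a' ℕ.* (a ℕ.* b) ≋ b
    e b = trans (cong (DM._% m) (trans (sym (ℕₚ.*-assoc a' a b)) (cong (ℕ._* b) (ℕₚ.*-comm a' a)))) (trans (*-cong-≋ aa'≋1 refl) (cong (DM._% m) (ℕₚ.*-identityˡ b)))

  -- The class of 0 is represented by m, to fit sums over 1 … m.
  rep : ℕ → ℕ
  rep a with a DM.% m
  ... | zero  = m
  ... | suc r = suc r

  rep-≋ : ∀ a → rep a ≋ a
  rep-≋ a with a DM.% m in eq
  ... | zero  = DM.n%n≡0 m
  ... | suc r = trans (cong (DM._% m) (sym eq)) (trans (%-≋ a) eq)

  1≤rep : ∀ a → 1 ℕ.≤ rep a
  1≤rep a with a DM.% m
  ... | zero  = 1≤m
  ... | suc r = s≤s z≤n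

  rep≤m : ∀ a → rep a ℕ.≤ m
  rep≤m a with a DM.% m in eq
  ... | zero  = ℕₚ.≤-refl
  ... | suc r = ℕₚ.<⇒≤ (subst (ℕ._< m) eq (DM.m%n<n a m))

  rep-unique : ∀ {a i} → 1 ℕ.≤ i → i ℕ.≤ m → i ≋ a → i ≡ rep a
  rep-unique {a} {i} 1≤i i≤m i≋a with ℕₚ.m≤n⇒m<n∨m≡n i≤m
  ... | inj₁ i<m rewrite sym i≋a | DM.m<n⇒m%n≡m i<m with i | 1≤i
  ...   | suc i' | _ = refl
  rep-unique {a} {i} 1≤i i≤m i≋a | inj₂ refl rewrite sym i≋a | DM.n%n≡0 m {{m≢0}} = refl

  ∑-class : ∀ (f : ℕ → ℚ) a → ∑ m (λ i → 𝟙 (i ≋? a) * f i) ≡ f (rep a)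
  ∑-class f a = trans (∑-pick m (rep a) (1≤rep a) (rep≤m a) (λ i 1≤i i≤m i≢ → 𝟙*-no (i ≋? a) (λ i≋a → i≢ (rep-unique 1≤i i≤m i≋a))))
    (𝟙*-yes (rep a ≋? a) (rep-≋ a))

  cls : ℕ → ℕ → ℚ
  cls g n = 𝟙 (n ≋? g)

  count : ℕ → ℕ → ℚ
  count g n = ∑ n (cls g)

  count-m : ∀ g → count g m ≡ 1ℚ
  count-m g = trans (∑-cong' m (λ i → sym (ℚₚ.*-identityʳ _))) (∑-class (λ _ → 1ℚ) g)

  cls-periodic : ∀ g n → cls g (m ℕ.+ n) ≡ cls g n
  cls-periodic g n = 𝟙-⇔ (m ℕ.+ n ≋? g) (n ≋? g) (trans (sym e)) (trans e)
    where
    e : m ℕ.+ n ≋ n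
    e = trans (cong (DM._% m) (ℕₚ.+-comm m n)) (DM.[m+n]%n≡m%n n m)

  count-periodic : ∀ g n → count g (m ℕ.+ n) ≡ 1ℚ + count g n
  count-periodic g n = trans (∑-split m n (cls g)) (cong₂ _+_ (count-m g) (∑-cong' n (cls-periodic g)))

  -- Within one period a class is met at most once, and every full period adds 1 to both counts. The
  -- argument k only bounds the recursion.
  count-diff : ∀ g g' k n → n ℕ.≤ k → count g n - count g' n ≤ 1ℚ
  count-diff g g' k n n≤k with n ℕₚ.≤? m
  ... | yes n≤m = lin (subst (count g n ≤_) (count-m g) (∑-mono-len n≤m (λ i _ _ → 0≤𝟙 (i ≋? g))) ⊕ 0≤∑ n (λ i _ _ → 0≤𝟙 (i ≋? g'))) (r (count g n) (count g' n))
    where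
    r : ∀ a b → 1ℚ + (a + 0ℚ) ≡ (a - b) + (1ℚ + b)
    r = solve-∀ ℚ-ring
  ... | no n≰m with ℕₚ.m≤n⇒∃[o]m+o≡n (ℕₚ.<⇒≤ (ℕₚ.≰⇒> n≰m)) | k
  ...   | j , refl | zero = contradiction (ℕₚ.≤-trans (ℕₚ.<⇒≤ (ℕₚ.≰⇒> n≰m)) (ℕₚ.≤-trans n≤k z≤n)) (ℕₚ.<⇒≱ 1≤m)
  ...   | j , refl | suc k' = subst (_≤ 1ℚ) (sym (trans (cong₂ _-_ (count-periodic g j) (count-periodic g' j)) (r (count g j) (count g' j))))
           (count-diff g g' k' j (ℕₚ.≤-pred (ℕₚ.≤-trans (ℕₚ.+-monoˡ-≤ j 1≤m) n≤k)))
    where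
    r : ∀ a b → (1ℚ + a) - (1ℚ + b) ≡ a - b
    r = solve-∀ ℚ-ring

  cls-diff : ℕ → ℕ → ℕ → ℚ
  cls-diff g g' n = cls g n - cls g' n

  cls-dil-unit : ∀ {d d'} g k → d ℕ.* d' ≋ 1 → Unit d → cls g (d ℕ.* k) ≡ cls (d' ℕ.* g) k
  cls-dil-unit {d} {d'} g k dd' ud = 𝟙-⇔ (d ℕ.* k ≋? g) (k ≋? d' ℕ.* g)
      (λ h → *-cancelˡ-≋ d ud (trans h (sym e))) (λ h → trans (*-cong-≋ {d} refl h) e)
    where
    e : d ℕ.* (d' ℕ.* g) ≋ g
    e = trans (cong (DM._% m) (sym (ℕₚ.*-assoc d d' g))) (trans (*-cong-≋ dd' refl) (cong (DM._% m) (ℕₚ.*-identityˡ g)))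

  -- Dilation by a unit d permutes the unit classes; the multiples of a non-unit d avoid them
  -- altogether. So the bound 1 is the same for every d.
  Osc-cls-diff : ∀ {g g'} → Unit g → Unit g' → Osc 1ℚ (cls-diff g g')
  Osc-cls-diff {g} {g'} ug ug' d n 1≤d with unit? d
  ... | yes ud with inverse d ud
  ...   | d' , dd' = subst (λ s → ∣ s ∣ ≤ 1ℚ) eq
          (∣∣≤ {count (d' ℕ.* g) n - count (d' ℕ.* g') n} (count-diff _ _ n n ℕₚ.≤-refl) (subst (_≤ 1ℚ) (r (count (d' ℕ.* g') n) (count (d' ℕ.* g) n)) (count-diff (d' ℕ.* g') (d' ℕ.* g) n n ℕₚ.≤-refl)))
    where
    r : ∀ a b → a - b ≡ - (b - a)
    r = solve-∀ ℚ-ring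
    eq : count (d' ℕ.* g) n - count (d' ℕ.* g') n ≡ ∑ n (dil d (cls-diff g g'))
    eq = trans (sym (∑-- n _ _)) (∑-cong' n (λ k → cong₂ _-_ (sym (cls-dil-unit g k dd' ud)) (sym (cls-dil-unit g' k dd' ud))))
  Osc-cls-diff {g} {g'} ug ug' d n 1≤d | no ¬ud = subst (λ s → ∣ s ∣ ≤ 1ℚ) (sym (∑-≡0 n (λ k _ _ → cong₂ _-_ (z g ug k) (z g' ug' k)))) 0≤1
    where
    z : ∀ g → Unit g → ∀ k → cls g (d ℕ.* k) ≡ 0ℚ
    z g ug k = 𝟙-no (d ℕ.* k ≋? g) (λ h → ¬ud (λ {i} → unit-*ˡ {d} {k} (unit-resp-≋ (sym h) ug) {i}))

  ∑ᵤ : (ℕ → ℚ) → ℚ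
  ∑ᵤ f = ∑ m (λ h → 𝟙 (unit? h) * f h)

  ∑ᵤ-mono : ∀ {f g : ℕ → ℚ} → (∀ h → Unit h → f h ≤ g h) → ∑ᵤ f ≤ ∑ᵤ g
  ∑ᵤ-mono h = ∑-mono m (λ i _ _ → 𝟙*-mono (unit? i) (h i))

  ∑ᵤ-cong : ∀ {f g : ℕ → ℚ} → (∀ h → Unit h → f h ≡ g h) → ∑ᵤ f ≡ ∑ᵤ g
  ∑ᵤ-cong h = ∑-cong m (λ i _ _ → 𝟙*-cong (unit? i) (h i))

  ∑ᵤ-cls : ∀ d (f : ℕ → ℚ) → (∀ {a b} → a ≋ b → f a ≡ f b) → ∑ᵤ (λ h → cls h d * f h) ≡ 𝟙 (unit? d) * f d
  ∑ᵤ-cls d f fc = trans (∑-cong' m (λ h → trans (r (𝟙 (unit? h)) (cls h d) (f h)) (cong (_* (𝟙 (unit? h) * f h)) (𝟙-⇔ (d ≋? h) (h ≋? d) sym sym))))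
    (trans (∑-class (λ h → 𝟙 (unit? h) * f h) d) (cong₂ _*_ (𝟙-⇔ (unit? (rep d)) (unit? d) (λ u {i} → unit-resp-≋ (rep-≋ d) u {i}) (λ u {i} → unit-resp-≋ (sym (rep-≋ d)) u {i})) (fc (rep-≋ d))))
    where
    r : ∀ a b c → a * (b * c) ≡ b * (a * c)
    r = solve-∀ ℚ-ring

  ∑ᵤ-cls-1 : ∀ d → ∑ᵤ (λ h → cls h d) ≡ 𝟙 (unit? d)
  ∑ᵤ-cls-1 d = trans (∑ᵤ-cong (λ h _ → sym (ℚₚ.*-identityʳ (cls h d)))) (trans (∑ᵤ-cls d (λ _ → 1ℚ) (λ _ → refl)) (ℚₚ.*-identityʳ _))

  ∑ᵤ-∑ : ∀ n (f : ℕ → ℕ → ℚ) → ∑ᵤ (λ h → ∑ n (f h)) ≡ ∑ n (λ d → ∑ᵤ (λ h → f h d))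
  ∑ᵤ-∑ n f = trans (∑-cong' m (λ h → sym (∑-*ˡ n (𝟙 (unit? h)) (f h)))) (∑-swap m n _)

  ∑ᵤ-*ˡ : ∀ c (f : ℕ → ℚ) → ∑ᵤ (λ h → c * f h) ≡ c * ∑ᵤ f
  ∑ᵤ-*ˡ c f = trans (∑-cong' m (λ h → r (𝟙 (unit? h)) c (f h))) (∑-*ˡ m c _)
    where
    r : ∀ a b c → a * (b * c) ≡ b * (a * c)
    r = solve-∀ ℚ-ring

  ∑ᵤ-+ : ∀ (f g : ℕ → ℚ) → ∑ᵤ (λ h → f h + g h) ≡ ∑ᵤ f + ∑ᵤ g
  ∑ᵤ-+ f g = trans (∑-cong' m (λ h → ℚₚ.*-distribˡ-+ (𝟙 (unit? h)) (f h) (g h))) (∑-+ m _ _)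

  φ : ℚ
  φ = ∑ᵤ (λ _ → 1ℚ)

  ∑ᵤ-const : ∀ c → ∑ᵤ (λ _ → c) ≡ φ * c
  ∑ᵤ-const c = trans (∑ᵤ-cong (λ _ _ → sym (ℚₚ.*-identityʳ c))) (trans (∑ᵤ-*ˡ c (λ _ → 1ℚ)) (ℚₚ.*-comm c φ))

  -- Total, so that it can be written under `∑ᵤ`; the value 0 at non-units is multiplied by a
  -- vanishing indicator there.
  hinv : ℕ → ℕ
  hinv h with unit? h
  ... | yes u = proj₁ (inverse h u)
  ... | no _  = 0

  hinv-≋ : ∀ {h} → Unit h → h ℕ.* hinv h ≋ 1
  hinv-≋ {h} u with unit? h
  ... | yes u' = proj₂ (inverse h u')
  ... | no ¬u  = contradiction (λ {i} → u {i}) ¬u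

  hinv-* : ∀ {h} g → Unit h → h ℕ.* (hinv h ℕ.* g) ≋ g
  hinv-* {h} g u = trans (cong (DM._% m) (sym (ℕₚ.*-assoc h (hinv h) g))) (trans (*-cong-≋ {h ℕ.* hinv h} {1} (hinv-≋ u) refl) (cong (DM._% m) (ℕₚ.*-identityˡ g)))

  hinv-unit : ∀ {h} g → Unit h → Unit g → Unit (hinv h ℕ.* g)
  hinv-unit {h} g u ug = unit-*ʳ {h} (unit-resp-≋ (sym (hinv-* g u)) ug)

  cls-* : ∀ {h} d g → Unit h → cls g (d ℕ.* h) ≡ cls (hinv h ℕ.* g) d
  cls-* {h} d g u = 𝟙-⇔ (d ℕ.* h ≋? g) (d ≋? hinv h ℕ.* g)
    (λ e → *-cancelˡ-≋ h u (trans (cong (DM._% m) (ℕₚ.*-comm h d)) (trans e (sym (hinv-* g u)))))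
    (λ e → trans (cong (DM._% m) (ℕₚ.*-comm d h)) (trans (*-cong-≋ {h} refl e) (hinv-* g u)))

  cls-resp : ∀ {g a b} → a ≋ b → cls g a ≡ cls g b
  cls-resp {g} {a} {b} e = 𝟙-⇔ (a ≋? g) (b ≋? g) (trans (sym e)) (trans e)

  -- If d n lies in a unit class, then n is a unit; h is its class, and h determines the class of d.
  -- This turns sums over products into convolutions on the unit group.
  cls-expand : ∀ d n g → Unit g → cls g (d ℕ.* n) ≡ ∑ᵤ (λ h → cls h n * cls (hinv h ℕ.* g) d)
  cls-expand d n g ug = sym (trans (∑ᵤ-cong (λ h uh → cong (cls h n *_) (sym (cls-* d g uh)))) (trans (∑ᵤ-cls n (λ h → cls g (d ℕ.* h)) (λ e → cls-resp {g} (*-cong-≋ {d} refl e))) kill))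
    where
    kill : 𝟙 (unit? n) * cls g (d ℕ.* n) ≡ cls g (d ℕ.* n)
    kill with unit? n
    ... | yes _ = ℚₚ.*-identityˡ _
    ... | no ¬u = trans (ℚₚ.*-zeroˡ (cls g (d ℕ.* n))) (sym (𝟙-no (d ℕ.* n ≋? g) (λ e → ¬u (λ {i} → unit-*ʳ {d} (unit-resp-≋ (sym e) ug) {i}))))

-- An additive approximation to the logarithm

lin-ℕ : ∀ {x y a b} → x ℕ.≤ y → b ℕ.+ x ≡ a ℕ.+ y → a ℕ.≤ b
lin-ℕ {x} {y} {a} {b} x≤y eq = ℕₚ.+-cancelʳ-≤ y a b (subst (ℕ._≤ b ℕ.+ y) eq (ℕₚ.+-monoʳ-≤ b x≤y))

lg-spec : ∀ n → 1 ℕ.≤ n → ∃[ e ] (2 ℕ.^ e ℕ.≤ n × n ℕ.< 2 ℕ.^ suc e)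
lg-spec (suc zero)    _ = 0 , s≤s z≤n , s≤s (s≤s z≤n)
lg-spec (suc (suc n)) _ with lg-spec (suc n) (s≤s z≤n)
... | e , lo , hi with suc (suc n) ℕₚ.<? 2 ℕ.^ suc e
...   | yes h = e , ℕₚ.m≤n⇒m≤1+n lo , h
...   | no h  = suc e , ℕₚ.≮⇒≥ h , ℕₚ.≤-<-trans hi (ℕₚ.^-monoʳ-< 2 (s≤s (s≤s z≤n)) (ℕₚ.n<1+n (suc e)))

lg : ℕ → ℕ
lg zero    = 0
lg (suc n) = proj₁ (lg-spec (suc n) (s≤s z≤n))

lg-lower : ∀ {n} → 1 ℕ.≤ n → 2 ℕ.^ lg n ℕ.≤ n
lg-lower {suc n} _ = proj₁ (proj₂ (lg-spec (suc n) (s≤s z≤n)))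

lg-upper : ∀ {n} → 1 ℕ.≤ n → n ℕ.< 2 ℕ.^ suc (lg n)
lg-upper {suc n} _ = proj₂ (proj₂ (lg-spec (suc n) (s≤s z≤n)))

2^-cancel-< : ∀ {e f} → 2 ℕ.^ e ℕ.< 2 ℕ.^ f → e ℕ.< f
2^-cancel-< {e} {f} h with e ℕₚ.<? f
... | yes p = p
... | no ¬p = contradiction (ℕₚ.^-monoʳ-≤ 2 (ℕₚ.≮⇒≥ ¬p)) (ℕₚ.<⇒≱ h)

lg-greatest : ∀ {n e} → 2 ℕ.^ e ℕ.≤ n → e ℕ.≤ lg n
lg-greatest {n} {e} h = ℕₚ.≤-pred (2^-cancel-< (ℕₚ.≤-<-trans h (lg-upper (ℕₚ.≤-trans (ℕₚ.m^n>0 2 e) h))))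

lg-mono : ∀ {a b} → 1 ℕ.≤ a → a ℕ.≤ b → lg a ℕ.≤ lg b
lg-mono 1≤a a≤b = lg-greatest (ℕₚ.≤-trans (lg-lower 1≤a) a≤b)

lg-2^ : ∀ e → lg (2 ℕ.^ e) ≡ e
lg-2^ e = ℕₚ.≤-antisym (ℕₚ.≤-pred (2^-cancel-< {f = suc e} (ℕₚ.≤-<-trans (lg-lower (ℕₚ.m^n>0 2 e)) (ℕₚ.^-monoʳ-< 2 (s≤s (s≤s z≤n)) (ℕₚ.n<1+n e))))) (lg-greatest {2 ℕ.^ e} ℕₚ.≤-refl)

lg-*-lower : ∀ {a b} → 1 ℕ.≤ a → 1 ℕ.≤ b → lg a ℕ.+ lg b ℕ.≤ lg (a ℕ.* b)
lg-*-lower {a} {b} 1≤a 1≤b = lg-greatest (subst (ℕ._≤ a ℕ.* b) (sym (ℕₚ.^-distribˡ-+-* 2 (lg a) (lg b))) (ℕₚ.*-mono-≤ (lg-lower 1≤a) (lg-lower 1≤b)))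

lg-*-upper : ∀ {a b} → 1 ℕ.≤ a → 1 ℕ.≤ b → lg (a ℕ.* b) ℕ.≤ suc (lg a ℕ.+ lg b)
lg-*-upper {a} {b} 1≤a 1≤b = ℕₚ.≤-pred (2^-cancel-< (ℕₚ.≤-<-trans (lg-lower (ℕₚ.*-mono-≤ 1≤a 1≤b))
  (subst (a ℕ.* b ℕ.<_) (trans (sym (ℕₚ.^-distribˡ-+-* 2 (suc (lg a)) (suc (lg b)))) (cong (λ k → 2 ℕ.^ suc k) (ℕₚ.+-suc (lg a) (lg b))))
    (ℕₚ.*-mono-< (lg-upper 1≤a) (lg-upper 1≤b)))))

n<2^n : ∀ n → n ℕ.< 2 ℕ.^ n
n<2^n zero    = s≤s z≤n
n<2^n (suc n) = ℕₚ.≤-trans (ℕₚ.+-mono-≤ (ℕₚ.m^n>0 2 n) (n<2^n n)) (ℕₚ.≤-reflexive (cong (2 ℕ.^ n ℕ.+_) (sym (ℕₚ.+-identityʳ _))))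

prime≥2 : ∀ {p} → Prime p → 2 ℕ.≤ p
prime≥2 {zero}        pp = contradiction pp ¬prime[0]
prime≥2 {suc zero}    pp = contradiction pp ¬prime[1]
prime≥2 {suc (suc p)} pp = s≤s (s≤s z≤n)

prime≥1 : ∀ {p} → Prime p → 1 ℕ.≤ p
prime≥1 pp = ℕₚ.≤-trans (s≤s z≤n) (prime≥2 pp)

1≤^ : ∀ {n} k → 1 ℕ.≤ n → 1 ℕ.≤ n ℕ.^ k
1≤^ {suc n} k _ = ℕₚ.m^n>0 (suc n) k

product≥1 : ∀ {ps} → All Prime ps → 1 ℕ.≤ product ps
product≥1 []         = s≤s z≤n
product≥1 (pp ∷ pps) = ℕₚ.*-mono-≤ (prime≥1 pp) (product≥1 pps)

length<product : ∀ {ps} → All Prime ps → length ps ℕ.< product ps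
length<product [] = s≤s z≤n
length<product {p ∷ ps} (pp ∷ pps) = ℕₚ.≤-trans (s≤s (length<product pps))
  (ℕₚ.≤-trans (ℕₚ.+-monoˡ-≤ (product ps) (product≥1 pps)) (ℕₚ.≤-trans (ℕₚ.≤-reflexive (cong (product ps ℕ.+_) (sym (ℕₚ.+-identityʳ (product ps))))) (ℕₚ.*-monoˡ-≤ (product ps) (prime≥2 pp))))

factorise⁺ : ∀ {n} → 1 ℕ.≤ n → PrimeFactorisation n
factorise⁺ {suc n} _ = factorise (suc n)

-- L is exactly additive, and L n = N log₂ n up to an error n that does not grow with N.
module IntegerLog (N : ℕ) where

  lgN : ℕ → ℕ
  lgN n = lg (n ℕ.^ N)

  ^-distrib-* : ∀ a b k → (a ℕ.* b) ℕ.^ k ≡ a ℕ.^ k ℕ.* b ℕ.^ k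
  ^-distrib-* a b zero    = refl
  ^-distrib-* a b (suc k) = trans (cong (a ℕ.* b ℕ.*_) (^-distrib-* a b k)) (r a b (a ℕ.^ k) (b ℕ.^ k))
    where
    r : ∀ a b c d → a ℕ.* b ℕ.* (c ℕ.* d) ≡ a ℕ.* c ℕ.* (b ℕ.* d)
    r = ℕ-Solver.solve-∀

  sumLog : List ℕ → ℕ
  sumLog ps = sum (map lgN ps)

  lgN-1 : lgN 1 ≡ 0
  lgN-1 = cong lg (ℕₚ.^-zeroˡ N)

  sumLog-lower : ∀ {ps} → All Prime ps → sumLog ps ℕ.≤ lgN (product ps)
  sumLog-lower [] = z≤n
  sumLog-lower {p ∷ ps} (pp ∷ pps) = ℕₚ.≤-trans (ℕₚ.+-monoʳ-≤ (lgN p) (sumLog-lower pps))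
    (subst (lgN p ℕ.+ lgN (product ps) ℕ.≤_) (cong lg (sym (^-distrib-* p (product ps) N))) (lg-*-lower (1≤^ N (prime≥1 pp)) (1≤^ N (product≥1 pps))))

  -- Each multiplication loses at most 1 to the rounding of log₂, so the total loss is at most the
  -- number of prime factors, whatever N is.
  sumLog-upper : ∀ {ps} → All Prime ps → lgN (product ps) ℕ.≤ sumLog ps ℕ.+ length ps
  sumLog-upper [] = ℕₚ.≤-reflexive lgN-1
  sumLog-upper {p ∷ ps} (pp ∷ pps) = ℕₚ.≤-trans (subst (ℕ._≤ suc (lgN p ℕ.+ lgN (product ps))) (cong lg (sym (^-distrib-* p (product ps) N))) (lg-*-upper (1≤^ N (prime≥1 pp)) (1≤^ N (product≥1 pps))))
    (lin-ℕ (sumLog-upper pps) (r (lgN p) (lgN (product ps)) (sumLog ps) (length ps)))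
    where
    r : ∀ a b s l → a ℕ.+ s ℕ.+ suc l ℕ.+ b ≡ suc (a ℕ.+ b) ℕ.+ (s ℕ.+ l)
    r = ℕ-Solver.solve-∀

  L : ℕ → ℕ
  L zero    = 0
  L (suc n) = sumLog (PrimeFactorisation.factors (factorise (suc n)))

  L-factorisation : ∀ {n} → 1 ℕ.≤ n → (f : PrimeFactorisation n) → L n ≡ sumLog (PrimeFactorisation.factors f)
  L-factorisation {suc n} _ f = sum-↭ (Permₚ.map⁺ lgN (factorisationUnique (factorise (suc n)) f))

  L-* : ∀ {a b} → 1 ℕ.≤ a → 1 ℕ.≤ b → L (a ℕ.* b) ≡ L a ℕ.+ L b
  L-* {a} {b} 1≤a 1≤b = trans (L-factorisation (ℕₚ.*-mono-≤ 1≤a 1≤b) f)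
    (trans (cong sum (Listₚ.map-++ lgN fa fb)) (trans (sum-++ (map lgN fa) (map lgN fb)) (sym (cong₂ ℕ._+_ (L-factorisation 1≤a (factorise⁺ 1≤a)) (L-factorisation 1≤b (factorise⁺ 1≤b))))))
    where
    module Fa = PrimeFactorisation (factorise⁺ 1≤a)
    module Fb = PrimeFactorisation (factorise⁺ 1≤b)
    fa = Fa.factors
    fb = Fb.factors
    f : PrimeFactorisation (a ℕ.* b)
    f = record { factors = fa ++ fb
               ; isFactorisation = trans (cong₂ ℕ._*_ Fa.isFactorisation Fb.isFactorisation) (sym (product-++ fa fb))
               ; factorsPrime = Allₚ.++⁺ Fa.factorsPrime Fb.factorsPrime }

  L-1 : L 1 ≡ 0
  L-1 = L-factorisation (s≤s z≤n) primeFactorisation[1]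

  L-2 : L 2 ≡ N
  L-2 = trans (L-factorisation (s≤s z≤n) (primeFactorisation[p] prime[2])) (trans (ℕₚ.+-identityʳ _) (lg-2^ N))

  L-^ : ∀ {a} k → 1 ℕ.≤ a → L (a ℕ.^ k) ≡ k ℕ.* L a
  L-^ zero    1≤a = L-1
  L-^ {a} (suc k) 1≤a = trans (L-* 1≤a (1≤^ k 1≤a)) (cong (L a ℕ.+_) (L-^ k 1≤a))

  L-lower : ∀ {n} → 1 ℕ.≤ n → L n ℕ.≤ lgN n
  L-lower {n} 1≤n = subst₂ ℕ._≤_ (sym (L-factorisation 1≤n (factorise⁺ 1≤n))) (cong lgN (sym F.isFactorisation)) (sumLog-lower F.factorsPrime)
    where module F = PrimeFactorisation (factorise⁺ 1≤n)

  L-upper : ∀ {n} → 1 ℕ.≤ n → lgN n ℕ.≤ L n ℕ.+ n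
  L-upper {n} 1≤n = ℕₚ.≤-trans (subst₂ ℕ._≤_ (cong lgN (sym F.isFactorisation)) (cong (ℕ._+ length F.factors) (sym (L-factorisation 1≤n (factorise⁺ 1≤n)))) (sumLog-upper F.factorsPrime))
    (ℕₚ.+-monoʳ-≤ (L n) (ℕₚ.<⇒≤ (subst (length F.factors ℕ.<_) (sym F.isFactorisation) (length<product F.factorsPrime))))
    where module F = PrimeFactorisation (factorise⁺ 1≤n)

  L-mono : ∀ {a b} → 1 ℕ.≤ a → a ℕ.≤ b → L a ℕ.≤ L b ℕ.+ b
  L-mono 1≤a a≤b = ℕₚ.≤-trans (L-lower 1≤a) (ℕₚ.≤-trans (lg-mono (1≤^ N 1≤a) (ℕₚ.^-monoˡ-≤ N a≤b)) (L-upper (ℕₚ.≤-trans 1≤a a≤b)))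

  -- Bernoulli's inequality (1 - 1/(n + 1))^j ≥ 1 - j/(n + 1), cleared of denominators.
  bernoulli : ∀ n j → suc n ℕ.^ j ℕ.* suc n ℕ.≤ n ℕ.^ j ℕ.* suc n ℕ.+ j ℕ.* suc n ℕ.^ j
  bernoulli n zero    = ℕₚ.≤-reflexive (sym (ℕₚ.+-identityʳ _))
  bernoulli n (suc j) = ℕₚ.≤-trans (ℕₚ.≤-trans (ℕₚ.≤-reflexive (ℕₚ.*-assoc (suc n) (suc n ℕ.^ j) (suc n))) (ℕₚ.*-monoʳ-≤ (suc n) (bernoulli n j)))
    (lin-ℕ (ℕₚ.*-monoʳ-≤ (suc n) (ℕₚ.^-monoˡ-≤ j (ℕₚ.n≤1+n n))) (r n j (n ℕ.^ j) (suc n ℕ.^ j)))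
    where
    r : ∀ n j x y → (n ℕ.* x) ℕ.* suc n ℕ.+ suc j ℕ.* (suc n ℕ.* y) ℕ.+ suc n ℕ.* x ≡ suc n ℕ.* (x ℕ.* suc n ℕ.+ j ℕ.* y) ℕ.+ suc n ℕ.* y
    r = ℕ-Solver.solve-∀

  half-power : ∀ n j → j ℕ.+ j ℕ.≤ suc n → suc n ℕ.^ j ℕ.≤ 2 ℕ.* n ℕ.^ j
  half-power n j h = ℕₚ.*-cancelʳ-≤ _ _ (suc n)
    (lin-ℕ (ℕₚ.+-mono-≤ (ℕₚ.*-monoʳ-≤ 2 (bernoulli n j)) (ℕₚ.*-monoʳ-≤ (suc n ℕ.^ j) h)) (r n j (n ℕ.^ j) (suc n ℕ.^ j)))
    where
    r : ∀ n j x y → 2 ℕ.* x ℕ.* suc n ℕ.+ (2 ℕ.* (y ℕ.* suc n) ℕ.+ y ℕ.* (j ℕ.+ j)) ≡ y ℕ.* suc n ℕ.+ (2 ℕ.* (x ℕ.* suc n ℕ.+ j ℕ.* y) ℕ.+ y ℕ.* suc n)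
    r = ℕ-Solver.solve-∀

  halve : ∀ n → ∃[ j ] ∃[ e ] (j ℕ.+ j ≡ n ℕ.+ e × e ℕ.≤ 1)
  halve zero = 0 , 0 , refl , z≤n
  halve (suc n) with halve n
  ... | j , zero  , eq , _ = suc j , 1 , cong suc (trans (ℕₚ.+-suc j j) (trans (cong suc eq) (sym (ℕₚ.+-suc n 0)))) , s≤s z≤n
  ... | j , suc zero , eq , _ = j , 0 , trans eq (ℕₚ.+-suc n 0) , z≤n
  ... | j , suc (suc _) , eq , s≤s ()

  -- For j equal to n/2 rounded up, (n + 1)^j ≤ 2 n^j. Applying `L` gives j (L(n + 1) - L(n)) ≤ N up
  -- to rounding. Doubling yields 2 N, and the third N absorbs the rounding and parity errors; for
  -- this N has to exceed them.
  L-slope : ∀ {n X} → 1 ℕ.≤ n → n ℕ.≤ X → 4 ℕ.* X ℕ.^ X ℕ.+ suc X ℕ.≤ N → n ℕ.* L (suc n) ℕ.≤ n ℕ.* L n ℕ.+ 3 ℕ.* N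
  L-slope {n} {X} 1≤n n≤X big with halve n
  ... | j , e , jj , e≤1 = lin-ℕ (ℕₚ.+-mono-≤ (ℕₚ.*-monoʳ-≤ 2 step) (ℕₚ.+-mono-≤ emono big')) (r n e j (L (suc n)) (L n) N (n ℕ.^ j) jj)
    where
    step : j ℕ.* L (suc n) ℕ.≤ (N ℕ.+ j ℕ.* L n) ℕ.+ 2 ℕ.* n ℕ.^ j
    step = subst₂ (λ x y → x ℕ.≤ y ℕ.+ 2 ℕ.* n ℕ.^ j) (L-^ j (s≤s z≤n)) (trans (L-* {2} {n ℕ.^ j} (s≤s z≤n) (1≤^ j 1≤n)) (cong₂ ℕ._+_ L-2 (L-^ j 1≤n)))
      (L-mono (1≤^ j (s≤s z≤n)) (half-power n j (ℕₚ.≤-trans (ℕₚ.≤-reflexive jj) (ℕₚ.≤-trans (ℕₚ.+-monoʳ-≤ n e≤1) (ℕₚ.≤-reflexive (ℕₚ.+-comm n 1))))))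
    emono : e ℕ.* L n ℕ.≤ e ℕ.* L (suc n) ℕ.+ suc n
    emono = ℕₚ.≤-trans (ℕₚ.*-monoʳ-≤ e (L-mono 1≤n (ℕₚ.n≤1+n n))) (ℕₚ.≤-trans (ℕₚ.≤-reflexive (ℕₚ.*-distribˡ-+ e (L (suc n)) (suc n)))
      (ℕₚ.+-monoʳ-≤ (e ℕ.* L (suc n)) (ℕₚ.≤-trans (ℕₚ.*-monoˡ-≤ (suc n) e≤1) (ℕₚ.≤-reflexive (ℕₚ.*-identityˡ (suc n))))))
    j≤n : j ℕ.≤ n
    j≤n with j ℕₚ.≤? n
    ... | yes p = p
    ... | no ¬p with ℕₚ.+-cancelˡ-≤ n (suc (suc n)) 1 (ℕₚ.≤-trans (ℕₚ.≤-reflexive (ℕₚ.+-suc n (suc n))) (ℕₚ.≤-trans (ℕₚ.+-mono-≤ (ℕₚ.≰⇒> ¬p) (ℕₚ.≰⇒> ¬p)) (ℕₚ.≤-trans (ℕₚ.≤-reflexive jj) (ℕₚ.+-monoʳ-≤ n e≤1))))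
    ...   | s≤s ()
    big' : 4 ℕ.* n ℕ.^ j ℕ.+ suc n ℕ.≤ N
    big' = ℕₚ.≤-trans (ℕₚ.+-mono-≤ (ℕₚ.*-monoʳ-≤ 4 (ℕₚ.≤-trans (ℕₚ.^-monoˡ-≤ j n≤X) (ℕₚ.^-monoʳ-≤ X {{ℕ.>-nonZero (ℕₚ.≤-trans 1≤n n≤X)}} (ℕₚ.≤-trans j≤n n≤X)))) (s≤s n≤X)) big
    r : ∀ n e j l' l N x → j ℕ.+ j ≡ n ℕ.+ e →
        n ℕ.* l ℕ.+ 3 ℕ.* N ℕ.+ (2 ℕ.* (j ℕ.* l') ℕ.+ (e ℕ.* l ℕ.+ (4 ℕ.* x ℕ.+ suc n))) ≡
        n ℕ.* l' ℕ.+ (2 ℕ.* ((N ℕ.+ j ℕ.* l) ℕ.+ 2 ℕ.* x) ℕ.+ ((e ℕ.* l' ℕ.+ suc n) ℕ.+ N))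
    r n e j l' l N x eq = trans (r₁ n e j l' l N x) (trans (cong (λ z → n ℕ.* l ℕ.+ e ℕ.* l ℕ.+ 3 ℕ.* N ℕ.+ z ℕ.* l' ℕ.+ 4 ℕ.* x ℕ.+ suc n) eq)
        (trans (r₂ n e l' l N x) (trans (cong (λ z → n ℕ.* l' ℕ.+ e ℕ.* l' ℕ.+ 3 ℕ.* N ℕ.+ z ℕ.* l ℕ.+ 4 ℕ.* x ℕ.+ suc n) (sym eq)) (r₃ n e j l' l N x))))
      where
      r₁ : ∀ n e j l' l N x → n ℕ.* l ℕ.+ 3 ℕ.* N ℕ.+ (2 ℕ.* (j ℕ.* l') ℕ.+ (e ℕ.* l ℕ.+ (4 ℕ.* x ℕ.+ suc n))) ≡ n ℕ.* l ℕ.+ e ℕ.* l ℕ.+ 3 ℕ.* N ℕ.+ (j ℕ.+ j) ℕ.* l' ℕ.+ 4 ℕ.* x ℕ.+ suc n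
      r₁ = ℕ-Solver.solve-∀
      r₂ : ∀ n e l' l N x → n ℕ.* l ℕ.+ e ℕ.* l ℕ.+ 3 ℕ.* N ℕ.+ (n ℕ.+ e) ℕ.* l' ℕ.+ 4 ℕ.* x ℕ.+ suc n ≡ n ℕ.* l' ℕ.+ e ℕ.* l' ℕ.+ 3 ℕ.* N ℕ.+ (n ℕ.+ e) ℕ.* l ℕ.+ 4 ℕ.* x ℕ.+ suc n
      r₂ = ℕ-Solver.solve-∀
      r₃ : ∀ n e j l' l N x → n ℕ.* l' ℕ.+ e ℕ.* l' ℕ.+ 3 ℕ.* N ℕ.+ (j ℕ.+ j) ℕ.* l ℕ.+ 4 ℕ.* x ℕ.+ suc n ≡ n ℕ.* l' ℕ.+ (2 ℕ.* ((N ℕ.+ j ℕ.* l) ℕ.+ 2 ℕ.* x) ℕ.+ ((e ℕ.* l' ℕ.+ suc n) ℕ.+ N))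
      r₃ = ℕ-Solver.solve-∀

-- Only values up to X matter, where log₂ is monotone up to the error inv X.
record LogUpTo (X : ℕ) : Set where
  field
    ℓ       : ℕ → ℚ
    ℓ-*     : ∀ {a b} → 1 ℕ.≤ a → 1 ℕ.≤ b → ℓ (a ℕ.* b) ≡ ℓ a + ℓ b
    ℓ-2     : ℓ 2 ≡ 1ℚ
    0≤ℓ     : ∀ n → 0ℚ ≤ ℓ n
    ℓ-mono  : ∀ {a b} → 1 ℕ.≤ a → a ℕ.≤ b → b ℕ.≤ X → ℓ a ≤ ℓ b + inv X
    ℓ-slope : ∀ {n} → 1 ℕ.≤ n → n ℕ.≤ X → ι n * (ℓ (suc n) - ℓ n) ≤ 3ℚ

logUpTo : ∀ X → 1 ℕ.≤ X → LogUpTo X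
logUpTo X 1≤X = record
  { ℓ       = λ n → ι (L n) * inv N
  ; ℓ-*     = λ {a} {b} 1≤a 1≤b → trans (cong (_* inv N) (trans (cong ι (L-* 1≤a 1≤b)) (ι-+ (L a) (L b)))) (ℚₚ.*-distribʳ-+ (inv N) (ι (L a)) (ι (L b)))
  ; ℓ-2     = trans (cong (λ k → ι k * inv N) L-2) (ι*inv 1≤N)
  ; 0≤ℓ     = λ n → 0≤* (0≤ι (L n)) (0≤inv N)
  ; ℓ-mono  = λ {a} {b} 1≤a a≤b b≤X → ≤-trans (*-monoˡ (0≤inv N) (ι-mono (L-mono 1≤a a≤b)))
      (lin (≤-refl {ι (L b) * inv N} ⊕ err b b≤X) (mono-eq b))
  ; ℓ-slope = λ {n} 1≤n n≤X → *-cancelˡ-ι 1≤N (subst₂ _≤_ (sym (lhs n)) (r₃ (ι N))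
      (lin (subst₂ _≤_ (ι-* n (L (suc n))) (trans (ι-+ (n ℕ.* L n) (3 ℕ.* N)) (cong₂ _+_ (ι-* n (L n)) (ι-* 3 N))) (ι-mono (L-slope 1≤n n≤X big))) (r₂ (ι n) (ι (L (suc n))) (ι (L n)) (ι N))))
  }
  where
  -- The first factor is what `L-slope` asks for; the second makes N at least X², so that the
  -- monotonicity error b/N is at most 1/X.
  N = (4 ℕ.* X ℕ.^ X ℕ.+ suc X) ℕ.* X
  open IntegerLog N
  big : 4 ℕ.* X ℕ.^ X ℕ.+ suc X ℕ.≤ N
  big = ℕₚ.≤-trans (ℕₚ.≤-reflexive (sym (ℕₚ.*-identityʳ _))) (ℕₚ.*-monoʳ-≤ (4 ℕ.* X ℕ.^ X ℕ.+ suc X) 1≤X)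
  1≤N : 1 ℕ.≤ N
  1≤N = ℕₚ.≤-trans (s≤s z≤n) (ℕₚ.≤-trans (ℕₚ.m≤n+m (suc X) (4 ℕ.* X ℕ.^ X)) big)
  err : ∀ b → b ℕ.≤ X → ι b * inv N ≤ inv X
  err b b≤X = subst (ι b * inv N ≤_) (trans (cong (ι X *_) (inv-* X X)) (e X 1≤X))
    (*-mono (0≤ι b) (0≤inv (X ℕ.* X)) (ι-mono b≤X) (inv-anti (ℕₚ.*-mono-≤ 1≤X 1≤X) (ℕₚ.*-monoˡ-≤ X (ℕₚ.≤-trans (ℕₚ.n≤1+n X) (ℕₚ.m≤n+m (suc X) (4 ℕ.* X ℕ.^ X))))))
    where
    e : ∀ X → 1 ℕ.≤ X → ι X * (inv X * inv X) ≡ inv X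
    e X h = trans (sym (ℚₚ.*-assoc (ι X) (inv X) (inv X))) (trans (cong (_* inv X) (ι*inv h)) (ℚₚ.*-identityˡ (inv X)))
  mono-eq : ∀ b → ι (L b) * inv N + inv X + (ι (L b) * inv N + ι b * inv N) ≡ ι (L b ℕ.+ b) * inv N + (ι (L b) * inv N + inv X)
  mono-eq b = trans (r (ι (L b)) (ι b) (inv N) (inv X)) (cong (λ z → z * inv N + (ι (L b) * inv N + inv X)) (sym (ι-+ (L b) b)))
    where
    r : ∀ l b i x → l * i + x + (l * i + b * i) ≡ (l + b) * i + (l * i + x)
    r = solve-∀ ℚ-ring
  lhs : ∀ n → ι N * (ι n * (ι (L (suc n)) * inv N - ι (L n) * inv N)) ≡ ι n * ι (L (suc n)) - ι n * ι (L n)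
  lhs n = trans (r (ι N) (inv N) (ι n) (ι (L (suc n))) (ι (L n))) (trans (cong (_* (ι n * ι (L (suc n)) - ι n * ι (L n))) (ι*inv 1≤N)) (ℚₚ.*-identityˡ _))
    where
    r : ∀ N i n a b → N * (n * (a * i - b * i)) ≡ N * i * (n * a - n * b)
    r = solve-∀ ℚ-ring
  r₂ : ∀ n a b N → 3ℚ * N + n * a ≡ n * a - n * b + (n * b + 3ℚ * N)
  r₂ = solve-∀ ℚ-ring
  r₃ : ∀ N → 3ℚ * N ≡ N * 3ℚ
  r₃ = solve-∀ ℚ-ring

-- Prime powers and the von Mangoldt function

coprime-prime : ∀ {p a} → Prime p → ¬ p ∣ a → Coprime a p
coprime-prime {p} pp ¬p∣a {d} (d∣a , d∣p) with prime⇒irreducible pp d∣p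
... | inj₁ d≡1 = d≡1
... | inj₂ d≡p = contradiction (subst (_∣ _) d≡p d∣a) ¬p∣a

prime∣^⇒≡ : ∀ {p q} k → Prime p → Prime q → p ∣ q ℕ.^ k → p ≡ q
prime∣^⇒≡ zero    pp pq h = contradiction (subst (2 ℕ.≤_) (∣ₚ.∣1⇒≡1 h) (prime≥2 pp)) λ { (s≤s ()) }
prime∣^⇒≡ {p} {q} (suc k) pp pq h with euclidsLemma q (q ℕ.^ k) pp h
... | inj₂ h' = prime∣^⇒≡ k pp pq h'
... | inj₁ p∣q with prime⇒irreducible pq p∣q
...   | inj₁ p≡1 = contradiction (subst (2 ℕ.≤_) p≡1 (prime≥2 pp)) λ { (s≤s ()) }
...   | inj₂ p≡q = p≡q

<-pow : ∀ {p} n → 2 ℕ.≤ p → n ℕ.< p ℕ.^ n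
<-pow n 2≤p = ℕₚ.<-≤-trans (n<2^n n) (ℕₚ.^-monoˡ-≤ n 2≤p)

∣⇒≤' : ∀ {d n} → 1 ℕ.≤ n → d ∣ n → d ℕ.≤ n
∣⇒≤' {d} {suc n} _ h = ∣ₚ.∣⇒≤ h

∑-shift : ∀ n (g : ℕ → ℚ) → ∑ n (λ k → g (ℕ.pred k)) ≡ g 0 + ∑ n g - g n
∑-shift zero    g = sym (trans (cong (_- g 0) (ℚₚ.+-identityʳ (g 0))) (ℚₚ.+-inverseʳ (g 0)))
∑-shift (suc n) g = trans (cong (_+ g n) (∑-shift n g)) (r (g 0) (∑ n g) (g n) (g (suc n)))
  where
  r : ∀ a b c d → a + b - c + c ≡ a + (b + d) - d
  r = solve-∀ ℚ-ring

module VonMangoldt {X : ℕ} (1≤X : 1 ℕ.≤ X) (log : LogUpTo X) where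
  open LogUpTo log public

  ℓ-1 : ℓ 1 ≡ 0ℚ
  ℓ-1 = trans (r (ℓ 1)) (trans (cong (_- ℓ 1) (sym (ℓ-* {1} {1} (s≤s z≤n) (s≤s z≤n)))) (ℚₚ.+-inverseʳ (ℓ 1)))
    where
    r : ∀ a → a ≡ (a + a) - a
    r = solve-∀ ℚ-ring

  ℓ-2^ : ∀ k → ℓ (2 ℕ.^ k) ≡ ι k
  ℓ-2^ zero    = ℓ-1
  ℓ-2^ (suc k) = trans (ℓ-* (s≤s z≤n) (ℕₚ.m^n>0 2 k)) (cong₂ _+_ ℓ-2 (ℓ-2^ k))

  pw : ℕ → ℚ
  pw q = 𝟙 (prime? q) * ℓ q

  0≤pw : ∀ q → 0ℚ ≤ pw q
  0≤pw q = 0≤* (0≤𝟙 (prime? q)) (0≤ℓ q)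

  -- A sum over prime powers instead of a case distinction on d, so that `∑-Λ` is an exchange of
  -- sums. Bases and exponents up to X reach every prime power up to X.
  Λ : ℕ → ℚ
  Λ d = ∑ X (λ q → pw q * ∑ X (λ k → 𝟙 (q ℕ.^ k ℕₚ.≟ d)))

  0≤Λ : ∀ d → 0ℚ ≤ Λ d
  0≤Λ d = 0≤∑ X (λ q _ _ → 0≤* (0≤pw q) (0≤∑ X (λ k _ _ → 0≤𝟙 (q ℕ.^ k ℕₚ.≟ d))))

  ∑-Λ : ∀ x (G : ℕ → ℚ) → ∑ x (λ d → Λ d * G d) ≡ ∑ X (λ q → pw q * ∑ X (λ k → 𝟙 (q ℕ.^ k ℕₚ.≤? x) * G (q ℕ.^ k)))
  ∑-Λ x G = begin
    ∑ x (λ d → Λ d * G d)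
      ≡⟨ ∑-cong' x (λ d → trans (sym (∑-*ʳ X (G d) _)) (∑-cong' X (λ q → trans (ℚₚ.*-assoc (pw q) _ (G d)) (cong (pw q *_) (sym (∑-*ʳ X (G d) _)))))) ⟩
    ∑ x (λ d → ∑ X (λ q → pw q * ∑ X (λ k → 𝟙 (q ℕ.^ k ℕₚ.≟ d) * G d)))
      ≡⟨ ∑-swap x X _ ⟩
    ∑ X (λ q → ∑ x (λ d → pw q * ∑ X (λ k → 𝟙 (q ℕ.^ k ℕₚ.≟ d) * G d)))
      ≡⟨ ∑-cong X (λ q 1≤q _ → trans (∑-*ˡ x (pw q) _) (cong (pw q *_) (trans (∑-swap x X _) (∑-cong' X (inner q 1≤q))))) ⟩
    ∑ X (λ q → pw q * ∑ X (λ k → 𝟙 (q ℕ.^ k ℕₚ.≤? x) * G (q ℕ.^ k))) ∎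
    where
    open ≡-Reasoning
    inner : ∀ q → 1 ℕ.≤ q → ∀ k → ∑ x (λ d → 𝟙 (q ℕ.^ k ℕₚ.≟ d) * G d) ≡ 𝟙 (q ℕ.^ k ℕₚ.≤? x) * G (q ℕ.^ k)
    inner q 1≤q k with q ℕ.^ k ℕₚ.≤? x
    ... | yes h = trans (∑-𝟙≟ x G (q ℕ.^ k) (1≤^ k 1≤q) h) (sym (ℚₚ.*-identityˡ _))
    ... | no ¬h = trans (∑-≡0 x (λ i _ i≤x → 𝟙*-no (q ℕ.^ k ℕₚ.≟ i) (λ e → ¬h (subst (ℕ._≤ x) (sym e) i≤x)))) (sym (ℚₚ.*-zeroˡ (G (q ℕ.^ k))))

  valuation : ℕ → ℕ → ℚ
  valuation q n = ∑ X (λ k → 𝟙 (q ℕ.^ k ∣? n))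

  valuation-1 : ∀ {q} → Prime q → valuation q 1 ≡ 0ℚ
  valuation-1 {q} pq = ∑-≡0 X z
    where
    z : ∀ k → 1 ℕ.≤ k → k ℕ.≤ X → 𝟙 (q ℕ.^ k ∣? 1) ≡ 0ℚ
    z k 1≤k _ = 𝟙-no (q ℕ.^ k ∣? 1) (λ h → ℕₚ.<⇒≱ (<-pow k (prime≥2 pq)) (subst (ℕ._≤ k) (sym (∣ₚ.∣1⇒≡1 h)) 1≤k))

  -- For p = q the indicators shift by one place: the new first one is 1, and the one pushed out is
  -- 0 because q^X exceeds n.
  valuation-* : ∀ {p q n} → Prime p → Prime q → 1 ℕ.≤ n → n ℕ.≤ X → valuation q (p ℕ.* n) ≡ valuation q n + 𝟙 (p ℕₚ.≟ q)
  valuation-* {p} {q} {n} pp pq 1≤n n≤X with p ℕₚ.≟ q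
  ... | no p≢q = trans (∑-cong' X (λ k → 𝟙-⇔ (q ℕ.^ k ∣? p ℕ.* n) (q ℕ.^ k ∣? n)
          (Cop.coprime-divisor (coprime-prime pp (λ h → p≢q (prime∣^⇒≡ k pp pq h)))) (∣ₚ.∣n⇒∣m*n p))) (sym (ℚₚ.+-identityʳ _))
  ... | yes refl = trans (∑-cong X e) (trans (∑-shift X g) (trans (cong₂ (λ a b → a + ∑ X g - b) (𝟙-yes (1 ∣? n) (∣ₚ.1∣ n)) (𝟙-no (p ℕ.^ X ∣? n) top)) (r (∑ X g))))
    where
    g : ℕ → ℚ
    g k = 𝟙 (p ℕ.^ k ∣? n)
    e : ∀ k → 1 ℕ.≤ k → k ℕ.≤ X → 𝟙 (p ℕ.^ k ∣? p ℕ.* n) ≡ g (ℕ.pred k)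
    e (suc k) _ _ = 𝟙-⇔ (p ℕ.^ suc k ∣? p ℕ.* n) (p ℕ.^ k ∣? n) (∣ₚ.*-cancelˡ-∣ p {{prime⇒nonZero pp}}) (∣ₚ.*-monoʳ-∣ p)
    top : ¬ p ℕ.^ X ∣ n
    top h = ℕₚ.<⇒≱ (<-pow X (prime≥2 pp)) (ℕₚ.≤-trans (∣⇒≤' 1≤n h) n≤X)
    r : ∀ s → 1ℚ + s - 0ℚ ≡ s + 1ℚ
    r = solve-∀ ℚ-ring

  ∑-valuation : ∀ {ps} → All Prime ps → product ps ℕ.≤ X → ∑ X (λ q → pw q * valuation q (product ps)) ≡ ℓ (product ps)
  ∑-valuation [] _ = trans (∑-≡0 X z) (sym ℓ-1)
    where
    z : ∀ q → 1 ℕ.≤ q → q ℕ.≤ X → pw q * valuation q 1 ≡ 0ℚ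
    z q _ _ with prime? q
    ... | yes pq = trans (cong (1ℚ * ℓ q *_) (valuation-1 pq)) (ℚₚ.*-zeroʳ (1ℚ * ℓ q))
    ... | no _   = trans (cong (_* valuation q 1) (ℚₚ.*-zeroˡ (ℓ q))) (ℚₚ.*-zeroˡ (valuation q 1))
  ∑-valuation {p ∷ ps} (pp ∷ pps) h = begin
    ∑ X (λ q → pw q * valuation q (p ℕ.* n))
      ≡⟨ ∑-cong' X step ⟩
    ∑ X (λ q → pw q * valuation q n + 𝟙 (p ℕₚ.≟ q) * pw q)
      ≡⟨ ∑-+ X _ _ ⟩
    ∑ X (λ q → pw q * valuation q n) + ∑ X (λ q → 𝟙 (p ℕₚ.≟ q) * pw q)
      ≡⟨ cong₂ _+_ (∑-valuation pps n≤X) (trans (∑-𝟙≟ X pw p (prime≥1 pp) p≤X) (𝟙*-yes (prime? p) pp)) ⟩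
    ℓ n + ℓ p
      ≡⟨ trans (ℚₚ.+-comm (ℓ n) (ℓ p)) (sym (ℓ-* (prime≥1 pp) (product≥1 pps))) ⟩
    ℓ (p ℕ.* n) ∎
    where
    open ≡-Reasoning
    n = product ps
    n≤X : n ℕ.≤ X
    n≤X = ℕₚ.≤-trans (ℕₚ.m≤n*m n p {{prime⇒nonZero pp}}) h
    p≤X : p ℕ.≤ X
    p≤X = ℕₚ.≤-trans (ℕₚ.m≤m*n p n {{ℕ.>-nonZero (product≥1 pps)}}) h
    step : ∀ q → pw q * valuation q (p ℕ.* n) ≡ pw q * valuation q n + 𝟙 (p ℕₚ.≟ q) * pw q
    step q with prime? q
    ... | yes pq = trans (cong (1ℚ * ℓ q *_) (valuation-* pp pq (product≥1 pps) n≤X)) (trans (ℚₚ.*-distribˡ-+ (1ℚ * ℓ q) _ _) (cong (1ℚ * ℓ q * valuation q n +_) (ℚₚ.*-comm _ (𝟙 (p ℕₚ.≟ q)))))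
    ... | no _   = r (ℓ q) (valuation q (p ℕ.* n)) (valuation q n) (𝟙 (p ℕₚ.≟ q))
      where
      r : ∀ l a b c → 0ℚ * l * a ≡ 0ℚ * l * b + c * (0ℚ * l)
      r = solve-∀ ℚ-ring

  Λ*1 : ∀ {n} x → 1 ℕ.≤ n → n ℕ.≤ x → n ℕ.≤ X → ∑ x (λ d → 𝟙 (d ∣? n) * Λ d) ≡ ℓ n
  Λ*1 {n} x 1≤n n≤x n≤X = begin
    ∑ x (λ d → 𝟙 (d ∣? n) * Λ d)
      ≡⟨ ∑-cong' x (λ d → ℚₚ.*-comm (𝟙 (d ∣? n)) (Λ d)) ⟩
    ∑ x (λ d → Λ d * 𝟙 (d ∣? n))
      ≡⟨ ∑-Λ x (λ d → 𝟙 (d ∣? n)) ⟩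
    ∑ X (λ q → pw q * ∑ X (λ k → 𝟙 (q ℕ.^ k ℕₚ.≤? x) * 𝟙 (q ℕ.^ k ∣? n)))
      ≡⟨ ∑-cong' X (λ q → cong (pw q *_) (∑-cong' X (λ k → drop (q ℕ.^ k)))) ⟩
    ∑ X (λ q → pw q * valuation q n)
      ≡⟨ cong (λ z → ∑ X (λ q → pw q * valuation q z)) F.isFactorisation ⟩
    ∑ X (λ q → pw q * valuation q (product F.factors))
      ≡⟨ ∑-valuation F.factorsPrime (subst (ℕ._≤ X) F.isFactorisation n≤X) ⟩
    ℓ (product F.factors)
      ≡⟨ cong ℓ (sym F.isFactorisation) ⟩
    ℓ n ∎
    where
    open ≡-Reasoning
    module F = PrimeFactorisation (factorise⁺ 1≤n)
    drop : ∀ d → 𝟙 (d ℕₚ.≤? x) * 𝟙 (d ∣? n) ≡ 𝟙 (d ∣? n)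
    drop d with d ∣? n
    ... | yes h = trans (ℚₚ.*-identityʳ _) (𝟙-yes (d ℕₚ.≤? x) (ℕₚ.≤-trans (∣⇒≤' 1≤n h) n≤x))
    ... | no _  = ℚₚ.*-zeroʳ (𝟙 (d ℕₚ.≤? x))

-- The Möbius function

∤𝟙 : ℕ → ℕ → ℚ
∤𝟙 p d = 1ℚ - 𝟙 (p ∣? d)

-- The divisors of p n not divisible by p are those of n; the remaining ones are p d with d dividing
-- n.
∑-divisors-*p : ∀ {p n} Y (F : ℕ → ℚ) → Prime p → 1 ℕ.≤ n → p ℕ.* n ℕ.≤ Y →
  ∑ Y (λ d → 𝟙 (d ∣? p ℕ.* n) * F d) ≡ ∑ Y (λ d → 𝟙 (d ∣? n) * (∤𝟙 p d * F d)) + ∑ Y (λ d → 𝟙 (d ∣? n) * F (p ℕ.* d))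
∑-divisors-*p {p} {n} Y F pp 1≤n pn≤Y = begin
  ∑ Y (λ d → 𝟙 (d ∣? p ℕ.* n) * F d)
    ≡⟨ ∑-cong' Y (λ d → trans (r (𝟙 (d ∣? p ℕ.* n)) (𝟙 (p ∣? d)) (F d)) (cong (_+ 𝟙 (p ∣? d) * (𝟙 (d ∣? p ℕ.* n) * F d)) (away d))) ⟩
  ∑ Y (λ d → 𝟙 (d ∣? n) * (∤𝟙 p d * F d) + 𝟙 (p ∣? d) * (𝟙 (d ∣? p ℕ.* n) * F d))
    ≡⟨ ∑-+ Y _ _ ⟩
  ∑ Y (λ d → 𝟙 (d ∣? n) * (∤𝟙 p d * F d)) + ∑ Y (λ d → 𝟙 (p ∣? d) * (𝟙 (d ∣? p ℕ.* n) * F d))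
    ≡⟨ cong (∑ Y (λ d → 𝟙 (d ∣? n) * (∤𝟙 p d * F d)) +_) at ⟩
  ∑ Y (λ d → 𝟙 (d ∣? n) * (∤𝟙 p d * F d)) + ∑ Y (λ d → 𝟙 (d ∣? n) * F (p ℕ.* d)) ∎
  where
  open ≡-Reasoning
  r : ∀ a b c → a * c ≡ a * ((1ℚ - b) * c) + b * (a * c)
  r = solve-∀ ℚ-ring
  away : ∀ d → 𝟙 (d ∣? p ℕ.* n) * (∤𝟙 p d * F d) ≡ 𝟙 (d ∣? n) * (∤𝟙 p d * F d)
  away d with p ∣? d
  ... | yes _ = r₀ (𝟙 (d ∣? p ℕ.* n)) (𝟙 (d ∣? n)) (F d)
    where
    r₀ : ∀ a b c → a * ((1ℚ - 1ℚ) * c) ≡ b * ((1ℚ - 1ℚ) * c)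
    r₀ = solve-∀ ℚ-ring
  ... | no ¬h = cong (_* ((1ℚ - 0ℚ) * F d)) (𝟙-⇔ (d ∣? p ℕ.* n) (d ∣? n) (Cop.coprime-divisor (coprime-prime pp ¬h)) (∣ₚ.∣n⇒∣m*n p))
  1≤p = prime≥1 pp
  at : ∑ Y (λ d → 𝟙 (p ∣? d) * (𝟙 (d ∣? p ℕ.* n) * F d)) ≡ ∑ Y (λ d → 𝟙 (d ∣? n) * F (p ℕ.* d))
  at = trans (∑-multiples Y p _ 1≤p) (trans (∑-cong' (quo Y p) (λ k → cong (_* F (p ℕ.* k)) (𝟙-⇔ (p ℕ.* k ∣? p ℕ.* n) (k ∣? n) (∣ₚ.*-cancelˡ-∣ p {{prime⇒nonZero pp}}) (∣ₚ.*-monoʳ-∣ p))))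
    (sym (∑-extend (quo≤ Y p) (λ i i> _ → 𝟙*-no (i ∣? n) (λ i∣n → ℕₚ.<⇒≱ i> (ℕₚ.≤-trans (∣⇒≤' 1≤n i∣n) (≤-quo Y 1≤p pn≤Y)))))))

∏ : ℕ → (ℕ → ℚ) → ℚ
∏ zero    f = 1ℚ
∏ (suc n) f = ∏ n f * f (suc n)

∏-cong : ∀ n {f g : ℕ → ℚ} → (∀ i → 1 ℕ.≤ i → i ℕ.≤ n → f i ≡ g i) → ∏ n f ≡ ∏ n g
∏-cong zero    h = refl
∏-cong (suc n) h = cong₂ _*_ (∏-cong n (λ i 1≤i i≤n → h i 1≤i (ℕₚ.m≤n⇒m≤1+n i≤n))) (h (suc n) (s≤s z≤n) ℕₚ.≤-refl)

∏-one : ∀ n {f : ℕ → ℚ} → (∀ i → f i ≡ 1ℚ) → ∏ n f ≡ 1ℚ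
∏-one zero    h = refl
∏-one (suc n) h = cong₂ _*_ (∏-one n h) (h (suc n))

∏-∣∣≤1 : ∀ n {f : ℕ → ℚ} → (∀ i → ∣ f i ∣ ≤ 1ℚ) → ∣ ∏ n f ∣ ≤ 1ℚ
∏-∣∣≤1 zero    h = ≤-refl
∏-∣∣≤1 (suc n) {f} h = ∣*∣≤ {∏ n f} (∏-∣∣≤1 n h) (h (suc n))

∏-change : ∀ n {f g : ℕ → ℚ} c j → 1 ℕ.≤ j → j ℕ.≤ n → (∀ i → i ≢ j → f i ≡ g i) → f j ≡ c * g j → ∏ n f ≡ c * ∏ n g
∏-change zero c j 1≤j j≤0 _ _ = contradiction (ℕₚ.≤-trans 1≤j j≤0) λ ()
∏-change (suc n) {f} {g} c j 1≤j j≤n h e with j ℕₚ.≟ suc n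
... | yes refl = trans (cong₂ _*_ (∏-cong n (λ i _ i≤n → h i (ℕₚ.<⇒≢ (s≤s i≤n)))) e) (r (∏ n g) c (g (suc n)))
  where
  r : ∀ a b c → a * (b * c) ≡ b * (a * c)
  r = solve-∀ ℚ-ring
... | no j≢ = trans (cong₂ _*_ (∏-change n c j 1≤j (ℕₚ.≤-pred (ℕₚ.≤∧≢⇒< j≤n j≢)) h e) (h (suc n) (j≢ ∘ sym))) (ℚₚ.*-assoc c (∏ n g) (g (suc n)))

prime-factor : ∀ {n} → 2 ℕ.≤ n → ∃[ p ] ∃[ k ] (Prime p × 1 ℕ.≤ k × n ≡ p ℕ.* k)
prime-factor {n} 2≤n with factorise⁺ (ℕₚ.≤-trans (s≤s z≤n) 2≤n)
... | record { factors = [] ; isFactorisation = refl ; factorsPrime = _ } = contradiction 2≤n λ { (s≤s ()) }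
... | record { factors = p ∷ ps ; isFactorisation = e ; factorsPrime = pp ∷ pps } = p , product ps , pp , product≥1 pps , e

module Möbius (X : ℕ) where

  -- 1, -1 or 0 according as q divides d to the order 0, 1 or more.
  localμ : ℕ → ℕ → ℚ
  localμ q d with prime? q
  ... | no _  = 1ℚ
  ... | yes _ with q ∣? d
  ...   | no _  = 1ℚ
  ...   | yes _ with q ℕ.* q ∣? d
  ...     | no _  = - 1ℚ
  ...     | yes _ = 0ℚ

  ∣localμ∣≤1 : ∀ q d → ∣ localμ q d ∣ ≤ 1ℚ
  ∣localμ∣≤1 q d with prime? q
  ... | no _  = ≤-refl
  ... | yes _ with q ∣? d
  ...   | no _  = ≤-refl
  ...   | yes _ with q ℕ.* q ∣? d
  ...     | no _  = ≤-refl
  ...     | yes _ = 0≤1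

  localμ-1 : ∀ q → localμ q 1 ≡ 1ℚ
  localμ-1 q with prime? q in eq
  ... | no _  = refl
  ... | yes pq with q ∣? 1
  ...   | no _  = refl
  ...   | yes h = contradiction (subst (2 ℕ.≤_) (∣ₚ.∣1⇒≡1 h) (prime≥2 pq)) λ { (s≤s ()) }

  localμ-⇔ : ∀ {q d e} → (Prime q → (q ∣ d → q ∣ e) × (q ∣ e → q ∣ d) × (q ℕ.* q ∣ d → q ℕ.* q ∣ e) × (q ℕ.* q ∣ e → q ℕ.* q ∣ d)) → localμ q d ≡ localμ q e
  localμ-⇔ {q} {d} {e} h with prime? q
  ... | no _  = refl
  ... | yes pq with h pq | q ∣? d | q ∣? e
  ...   | a , b , c , f | yes y | no ¬y = contradiction (a y) ¬y
  ...   | a , b , c , f | no ¬y | yes y = contradiction (b y) ¬y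
  ...   | a , b , c , f | no _ | no _ = refl
  ...   | a , b , c , f | yes _ | yes _ with q ℕ.* q ∣? d | q ℕ.* q ∣? e
  ...     | yes _ | yes _ = refl
  ...     | no _  | no _  = refl
  ...     | yes y | no ¬y = contradiction (c y) ¬y
  ...     | no ¬y | yes y = contradiction (f y) ¬y

  localμ-p : ∀ {p} d → Prime p → localμ p (p ℕ.* d) ≡ - ∤𝟙 p d * localμ p d
  localμ-p {p} d pp with prime? p
  ... | no ¬pp = contradiction pp ¬pp
  ... | yes _ with p ∣? p ℕ.* d
  ...   | no ¬h = contradiction (∣ₚ.m∣m*n d) ¬h
  ...   | yes _ with p ∣? d
  ...     | no ¬h with p ℕ.* p ∣? p ℕ.* d
  ...       | yes h' = contradiction (∣ₚ.*-cancelˡ-∣ p {{prime⇒nonZero pp}} h') ¬h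
  ...       | no _   = refl
  localμ-p {p} d pp | yes _ | yes _ | yes h with p ℕ.* p ∣? p ℕ.* d
  ...       | no ¬h' = contradiction (∣ₚ.*-monoʳ-∣ p h) ¬h'
  ...       | yes _ with p ℕ.* p ∣? d
  ...         | yes _ = refl
  ...         | no _  = refl

  opaque
    -- The primes up to X suffice for the Möbius function at every d ≤ X.
    μ : ℕ → ℚ
    μ d = ∏ X (λ q → localμ q d)

    ∣μ∣≤1 : ∀ d → ∣ μ d ∣ ≤ 1ℚ
    ∣μ∣≤1 d = ∏-∣∣≤1 X (λ q → ∣localμ∣≤1 q d)

    μ-1 : μ 1 ≡ 1ℚ
    μ-1 = ∏-one X localμ-1

    μ-p : ∀ {p} d → Prime p → p ℕ.≤ X → μ (p ℕ.* d) ≡ - ∤𝟙 p d * μ d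
    μ-p {p} d pp p≤X = ∏-change X (- ∤𝟙 p d) p (prime≥1 pp) p≤X other (localμ-p d pp)
      where
      other : ∀ q → q ≢ p → localμ q (p ℕ.* d) ≡ localμ q d
      other q q≢p = localμ-⇔ {q} {p ℕ.* d} {d} (λ pq → let ¬d = λ k (h : p ∣ q ℕ.^ k) → q≢p (sym (prime∣^⇒≡ k pp pq h)) in
          Cop.coprime-divisor (coprime-prime pp (λ h → ¬d 1 (subst (p ∣_) (sym (ℕₚ.*-identityʳ q)) h))) , ∣ₚ.∣n⇒∣m*n p
        , Cop.coprime-divisor (coprime-prime pp (λ h → ¬d 2 (subst (p ∣_) (cong (q ℕ.*_) (sym (ℕₚ.*-identityʳ q))) h))) , ∣ₚ.∣n⇒∣m*n p)

  -- For a prime p dividing n, each divisor d prime to p cancels against p d, and p d contributes 0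
  -- when p already divides d.
  μ*1 : ∀ {n} Y → 1 ℕ.≤ n → n ℕ.≤ Y → n ℕ.≤ X → ∑ Y (λ d → 𝟙 (d ∣? n) * μ d) ≡ 𝟙 (n ℕₚ.≟ 1)
  μ*1 {suc zero} Y _ n≤Y _ = trans (∑-pick Y 1 (s≤s z≤n) n≤Y (λ i _ _ i≢1 → 𝟙*-no (i ∣? 1) (i≢1 ∘ ∣ₚ.∣1⇒≡1))) (trans (𝟙*-yes (1 ∣? 1) (∣ₚ.1∣ 1)) μ-1)
  μ*1 {suc (suc n)} Y _ n≤Y n≤X with prime-factor {suc (suc n)} (s≤s (s≤s z≤n))
  ... | p , k , pp , 1≤k , e = begin
    ∑ Y (λ d → 𝟙 (d ∣? suc (suc n)) * μ d)
      ≡⟨ cong (λ z → ∑ Y (λ d → 𝟙 (d ∣? z) * μ d)) e ⟩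
    ∑ Y (λ d → 𝟙 (d ∣? p ℕ.* k) * μ d)
      ≡⟨ ∑-divisors-*p Y μ pp 1≤k (subst (ℕ._≤ Y) e n≤Y) ⟩
    ∑ Y (λ d → 𝟙 (d ∣? k) * (∤𝟙 p d * μ d)) + ∑ Y (λ d → 𝟙 (d ∣? k) * μ (p ℕ.* d))
      ≡⟨ sym (∑-+ Y _ _) ⟩
    ∑ Y (λ d → 𝟙 (d ∣? k) * (∤𝟙 p d * μ d) + 𝟙 (d ∣? k) * μ (p ℕ.* d))
      ≡⟨ ∑-≡0 Y (λ d _ _ → trans (cong (λ z → 𝟙 (d ∣? k) * (∤𝟙 p d * μ d) + 𝟙 (d ∣? k) * z) (μ-p d pp p≤X)) (r (𝟙 (d ∣? k)) (∤𝟙 p d) (μ d))) ⟩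
    0ℚ ∎
    where
    open ≡-Reasoning
    r : ∀ a b c → a * (b * c) + a * (- b * c) ≡ 0ℚ
    r = solve-∀ ℚ-ring
    p≤X : p ℕ.≤ X
    p≤X = ℕₚ.≤-trans (ℕₚ.m≤m*n p k {{ℕ.>-nonZero 1≤k}}) (subst (ℕ._≤ X) e n≤X)

module MöbiusLog {X : ℕ} (1≤X : 1 ℕ.≤ X) (log : LogUpTo X) where
  open VonMangoldt 1≤X log
  open Möbius X

  -- Replace log d by log n - log(n/d), and log(n/d) by the sum of Λ(e) over e dividing n/d. The
  -- first part is log n times δ(n), which is 0; in the second, μ * 1 = δ leaves only e = n.
  μℓ*1 : ∀ {n} x → 1 ℕ.≤ n → n ℕ.≤ x → n ℕ.≤ X → ∑ x (λ d → 𝟙 (d ∣? n) * (μ d * ℓ d)) ≡ - Λ n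
  μℓ*1 {n} x 1≤n n≤x n≤X = begin
    ∑ x (λ d → 𝟙 (d ∣? n) * (μ d * ℓ d))
      ≡⟨ ∑-cong x pointwise ⟩
    ∑ x (λ d → ℓ n * (𝟙 (d ∣? n) * μ d) - ∑ x (λ e → Λ e * (𝟙 (d ℕ.* e ∣? n) * μ d)))
      ≡⟨ ∑-- x _ _ ⟩
    ∑ x (λ d → ℓ n * (𝟙 (d ∣? n) * μ d)) - ∑ x (λ d → ∑ x (λ e → Λ e * (𝟙 (d ℕ.* e ∣? n) * μ d)))
      ≡⟨ cong₂ _-_ (trans (∑-*ˡ x (ℓ n) _) (trans (cong (ℓ n *_) (μ*1 x 1≤n n≤x n≤X)) ℓδ)) (trans (∑-swap x x _) (∑-cong x inner)) ⟩
    0ℚ - ∑ x (λ e → 𝟙 (n ℕₚ.≟ e) * Λ e)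
      ≡⟨ trans (cong (λ z → 0ℚ - z) (∑-𝟙≟ x Λ n 1≤n n≤x)) (ℚₚ.+-identityˡ (- Λ n)) ⟩
    - Λ n ∎
    where
    open ≡-Reasoning
    ℓδ : ℓ n * 𝟙 (n ℕₚ.≟ 1) ≡ 0ℚ
    ℓδ with n ℕₚ.≟ 1
    ... | yes refl = trans (ℚₚ.*-identityʳ (ℓ 1)) ℓ-1
    ... | no _     = ℚₚ.*-zeroʳ (ℓ n)
    pointwise : ∀ d → 1 ℕ.≤ d → d ℕ.≤ x → 𝟙 (d ∣? n) * (μ d * ℓ d) ≡ ℓ n * (𝟙 (d ∣? n) * μ d) - ∑ x (λ e → Λ e * (𝟙 (d ℕ.* e ∣? n) * μ d))
    pointwise d 1≤d _ with d ∣? n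
    ... | no ¬h = trans (r₀ (μ d * ℓ d) (ℓ n) (μ d)) (cong (λ z → ℓ n * (0ℚ * μ d) - z) (sym (∑-≡0 x (λ e _ _ → trans (cong (Λ e *_) (𝟙*-no (d ℕ.* e ∣? n) (λ h → ¬h (∣ₚ.m*n∣⇒m∣ d e h)))) (ℚₚ.*-zeroʳ (Λ e))))))
      where
      r₀ : ∀ a b c → 0ℚ * a ≡ b * (0ℚ * c) - 0ℚ
      r₀ = solve-∀ ℚ-ring
    ... | yes (divides k e) = trans (r (μ d) (ℓ d) (ℓ k)) (cong₂ (λ a b → a * (1ℚ * μ d) - b) (sym ℓn) (sym sumk))
      where
      n≡dk : n ≡ d ℕ.* k
      n≡dk = trans e (ℕₚ.*-comm k d)
      1≤k : 1 ℕ.≤ k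
      1≤k = ℕₚ.n≢0⇒n>0 λ { refl → contradiction (subst (1 ℕ.≤_) e 1≤n) λ () }
      k≤n : k ℕ.≤ n
      k≤n = ℕₚ.≤-trans (ℕₚ.m≤m*n k d {{ℕ.>-nonZero 1≤d}}) (ℕₚ.≤-reflexive (sym e))
      ℓn : ℓ n ≡ ℓ d + ℓ k
      ℓn = trans (cong ℓ n≡dk) (ℓ-* 1≤d 1≤k)
      sumk : ∑ x (λ e → Λ e * (𝟙 (d ℕ.* e ∣? n) * μ d)) ≡ ℓ k * μ d
      sumk = trans (∑-cong' x (λ i → trans (cong (λ z → Λ i * (z * μ d)) (𝟙-⇔ (d ℕ.* i ∣? n) (i ∣? k)
               (λ h → ∣ₚ.*-cancelˡ-∣ d {{ℕ.>-nonZero 1≤d}} (subst (d ℕ.* i ∣_) n≡dk h)) (λ h → subst (d ℕ.* i ∣_) (sym n≡dk) (∣ₚ.*-monoʳ-∣ d h)))) (r₁ (Λ i) (𝟙 (i ∣? k)) (μ d))))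
             (trans (∑-*ʳ x (μ d) _) (cong (_* μ d) (Λ*1 x 1≤k (ℕₚ.≤-trans k≤n n≤x) (ℕₚ.≤-trans k≤n n≤X))))
        where
        r₁ : ∀ a b c → a * (b * c) ≡ (b * a) * c
        r₁ = solve-∀ ℚ-ring
      r : ∀ m a b → 1ℚ * (m * a) ≡ (a + b) * (1ℚ * m) - b * m
      r = solve-∀ ℚ-ring
    inner : ∀ e → 1 ℕ.≤ e → e ℕ.≤ x → ∑ x (λ d → Λ e * (𝟙 (d ℕ.* e ∣? n) * μ d)) ≡ 𝟙 (n ℕₚ.≟ e) * Λ e
    inner e 1≤e _ = trans (∑-*ˡ x (Λ e) _) (trans (cong (Λ e *_) δ) (ℚₚ.*-comm (Λ e) _))
      where
      δ : ∑ x (λ d → 𝟙 (d ℕ.* e ∣? n) * μ d) ≡ 𝟙 (n ℕₚ.≟ e)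
      δ with e ∣? n
      ... | no ¬h = trans (∑-≡0 x (λ d _ _ → 𝟙*-no (d ℕ.* e ∣? n) (λ h → ¬h (∣ₚ.m*n∣⇒n∣ d e h)))) (sym (𝟙-no (n ℕₚ.≟ e) (λ { refl → ¬h ∣ₚ.∣-refl })))
      ... | yes (divides k eq) = trans (∑-cong' x (λ d → cong (_* μ d) (𝟙-⇔ (d ℕ.* e ∣? n) (d ∣? k)
              (λ h → ∣ₚ.*-cancelʳ-∣ e {{ℕ.>-nonZero 1≤e}} (subst (d ℕ.* e ∣_) eq h)) (λ h → subst (d ℕ.* e ∣_) (sym eq) (∣ₚ.*-monoˡ-∣ e h)))))
            (trans (μ*1 x 1≤k (ℕₚ.≤-trans k≤n n≤x) (ℕₚ.≤-trans k≤n n≤X))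
              (𝟙-⇔ (k ℕₚ.≟ 1) (n ℕₚ.≟ e) (λ { refl → trans eq (ℕₚ.*-identityˡ e) }) (λ { refl → ℕₚ.*-cancelʳ-≡ k 1 e {{ℕ.>-nonZero 1≤e}} (trans (sym eq) (sym (ℕₚ.*-identityˡ e))) })))
        where
        1≤k : 1 ℕ.≤ k
        1≤k = ℕₚ.n≢0⇒n>0 λ { refl → contradiction (subst (1 ℕ.≤_) eq 1≤n) λ () }
        k≤n : k ℕ.≤ n
        k≤n = ℕₚ.≤-trans (ℕₚ.m≤m*n k e {{ℕ.>-nonZero 1≤e}}) (ℕₚ.≤-reflexive (sym eq))

-- Chebyshev and Mertens estimates

∑-double : ∀ n (f : ℕ → ℚ) → ∑ (n ℕ.+ n) f ≡ ∑ n (λ k → f (ℕ.pred (k ℕ.+ k)) + f (k ℕ.+ k))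
∑-double zero    f = refl
∑-double (suc n) f = trans (cong (λ k → ∑ k f) (cong suc (ℕₚ.+-suc n n)))
  (trans (ℚₚ.+-assoc (∑ (n ℕ.+ n) f) _ _) (cong₂ _+_ (∑-double n f) (cong₂ _+_ (cong f (sym (ℕₚ.+-suc n n))) (cong f (cong suc (sym (ℕₚ.+-suc n n)))))))

inv-telescope : ∀ n → 1 ℕ.≤ n → inv n * inv (suc n) ≡ inv n - inv (suc n)
inv-telescope n 1≤n = trans (r₁ (inv n) (inv (suc n)) (ι n)) (trans (cong₂ (λ y z → inv n * y - z * inv (suc n)) (inv*ι {suc n} (s≤s z≤n)) (inv*ι 1≤n)) (r₂ (inv n) (inv (suc n))))
  where
  r₁ : ∀ a b n → a * b ≡ a * (b * (1ℚ + n)) - (a * n) * b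
  r₁ = solve-∀ ℚ-ring
  r₂ : ∀ a b → a * 1ℚ - 1ℚ * b ≡ a - b
  r₂ = solve-∀ ℚ-ring

harmonic : ℕ → ℚ
harmonic n = ∑ n inv

2^-suc : ∀ j → 2 ℕ.^ suc j ≡ 2 ℕ.^ j ℕ.+ 2 ℕ.^ j
2^-suc j = cong (2 ℕ.^ j ℕ.+_) (ℕₚ.+-identityʳ _)

-- Dyadic blocks: the terms from 2^j + 1 to 2^(j + 1) add up to at most 1.
harmonic-2^ : ∀ j → harmonic (2 ℕ.^ j) ≤ 1ℚ + ι j
harmonic-2^ zero    = ≤-eq (cong (0ℚ +_) inv-1)
harmonic-2^ (suc j) = subst (_≤ 1ℚ + ι (suc j)) (sym (trans (cong harmonic (2^-suc j)) (∑-split n n inv)))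
  (≤-trans (harmonic-2^ j ⊕ ≤-trans (∑-mono n (λ i _ _ → inv-anti 1≤n (ℕₚ.m≤m+n n i))) (≤-eq (trans (∑-const n (inv n)) (ι*inv 1≤n)))) (≤-eq (r (ι j))))
  where
  n = 2 ℕ.^ j
  1≤n : 1 ℕ.≤ n
  1≤n = ℕₚ.m^n>0 2 j
  r : ∀ j → 1ℚ + j + 1ℚ ≡ 1ℚ + (1ℚ + j)
  r = solve-∀ ℚ-ring

ι*inv≤1 : ∀ {x X} → x ℕ.≤ X → ι x * inv X ≤ 1ℚ
ι*inv≤1 {x} {zero}  z≤n = ≤-trans (≤-eq (ℚₚ.*-zeroˡ (inv 0))) 0≤1
ι*inv≤1 {x} {suc X} h = subst (ι x * inv (suc X) ≤_) (ι*inv {suc X} (s≤s z≤n)) (*-monoˡ (0≤inv (suc X)) (ι-mono h))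

ι*-inv : ∀ {d} q → 1 ℕ.≤ d → ι (d ℕ.* q) * inv d ≡ ι q
ι*-inv {d} q 1≤d = trans (cong (_* inv d) (ι-* d q)) (trans (r (ι d) (ι q) (inv d)) (trans (cong (ι q *_) (ι*inv 1≤d)) (ℚₚ.*-identityʳ (ι q))))
  where
  r : ∀ d q i → d * q * i ≡ q * (d * i)
  r = solve-∀ ℚ-ring

quo-lower : ∀ x {d} → 1 ℕ.≤ d → ι (quo x d) ≤ ι x * inv d
quo-lower x {d} 1≤d = subst (_≤ ι x * inv d) (ι*-inv (quo x d) 1≤d) (*-monoˡ (0≤inv d) (ι-mono (quo-≤ x 1≤d ℕₚ.≤-refl)))

quo-upper : ∀ x {d} → 1 ℕ.≤ d → ι x * inv d ≤ ι (suc (quo x d))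
quo-upper x {d} 1≤d = subst (ι x * inv d ≤_) (ι*-inv (suc (quo x d)) 1≤d) (*-monoˡ (0≤inv d) (ι-mono (ℕₚ.<⇒≤ (<-quo x 1≤d))))

module Estimates {X : ℕ} (1≤X : 1 ℕ.≤ X) (log : LogUpTo X) where
  open VonMangoldt 1≤X log

  -- Going from y to y + 1 raises the sum by y (log(y + 1) - log y), the very quantity bounded by
  -- `ℓ-slope`.
  log-mean : ∀ x → 1 ℕ.≤ x → x ℕ.≤ X → ∑ x (λ n → ℓ x - ℓ n) ≤ 3ℚ * ι x
  log-mean (suc zero) _ _ = subst (_≤ 3ℚ * ι 1) (sym (trans (ℚₚ.+-identityˡ _) (ℚₚ.+-inverseʳ (ℓ 1)))) (ℚₚ.nonNegative⁻¹ (3ℚ * ι 1))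
  log-mean (suc (suc x)) _ h = subst (_≤ 3ℚ * ι (suc (suc x))) (sym eq)
    (≤-trans (log-mean (suc x) (s≤s z≤n) (ℕₚ.<⇒≤ h) ⊕ ℓ-slope (s≤s z≤n) (ℕₚ.<⇒≤ h)) (≤-eq (r (ι (suc x)))))
    where
    y = suc x
    r : ∀ x → 3ℚ * x + 3ℚ ≡ 3ℚ * (1ℚ + x)
    r = solve-∀ ℚ-ring
    s : ∀ a b c → a - c ≡ b - c + (a - b)
    s = solve-∀ ℚ-ring
    z : ∀ a b → a + (b - b) ≡ a
    z = solve-∀ ℚ-ring
    eq : ∑ (suc y) (λ n → ℓ (suc y) - ℓ n) ≡ ∑ y (λ n → ℓ y - ℓ n) + ι y * (ℓ (suc y) - ℓ y)
    eq = trans (z _ (ℓ (suc y))) (trans (∑-cong' y (λ n → s (ℓ (suc y)) (ℓ y) (ℓ n))) (trans (∑-+ y _ _) (cong (∑ y (λ n → ℓ y - ℓ n) +_) (∑-const y _))))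

  ∣log-diff∣ : ∀ {n x} → 1 ℕ.≤ n → n ℕ.≤ x → x ℕ.≤ X → ∣ ℓ x - ℓ n ∣ ≤ ℓ x - ℓ n + 2ℚ * inv X
  ∣log-diff∣ {n} {x} 1≤n n≤x x≤X = ∣∣≤ (lin (0≤* {2ℚ} (0≤ι 2) (0≤inv X)) (r (ℓ x - ℓ n) (inv X)))
    (lin ((ℓ-mono 1≤n n≤x x≤X) ⊕ (ℓ-mono 1≤n n≤x x≤X)) (s (ℓ x) (ℓ n) (inv X)))
    where
    r : ∀ a i → a + 2ℚ * i + 0ℚ ≡ a + 2ℚ * i
    r = solve-∀ ℚ-ring
    s : ∀ a b i → a - b + 2ℚ * i + (b + b) ≡ - (a - b) + (a + i + (a + i))
    s = solve-∀ ℚ-ring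

  log-mean-abs : ∀ x → 1 ℕ.≤ x → x ℕ.≤ X → ∑ x (λ n → ∣ ℓ x - ℓ n ∣) ≤ 5ℚ * ι x
  log-mean-abs x 1≤x x≤X = ≤-trans (∑-mono x (λ n 1≤n n≤x → ∣log-diff∣ 1≤n n≤x x≤X))
    (≤-trans (≤-eq (trans (∑-+ x _ _) (cong (∑ x (λ n → ℓ x - ℓ n) +_) (∑-const x (2ℚ * inv X)))))
    (lin (log-mean x 1≤x x≤X ⊕ (0≤ι 2 ⊙ ≤-trans (ι*inv≤1 x≤X) (subst (_≤ ι x) (ℚₚ.+-identityʳ 1ℚ) (ι-mono 1≤x)))) (r (∑ x (λ n → ℓ x - ℓ n)) (ι x) (inv X))))
    where
    r : ∀ D x i → 5ℚ * x + (D + 2ℚ * (x * i)) ≡ D + x * (2ℚ * i) + (3ℚ * x + 2ℚ * x)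
    r = solve-∀ ℚ-ring

  log≤ : ∀ {n x} → 1 ℕ.≤ n → n ℕ.≤ x → x ℕ.≤ X → ℓ n ≤ ℓ x + 1ℚ
  log≤ 1≤n n≤x x≤X = ≤-trans (ℓ-mono 1≤n n≤x x≤X) (≤-refl {ℓ _} ⊕ inv≤1 X)

  -- Legendre's formula for log x!.
  ∑-log-floor : ∀ x Y → x ℕ.≤ Y → x ℕ.≤ X → ∑ Y (λ d → Λ d * ι (quo x d)) ≡ ∑ x ℓ
  ∑-log-floor x Y x≤Y x≤X = sym (begin
    ∑ x ℓ
      ≡⟨ ∑-cong x (λ n 1≤n n≤x → sym (Λ*1 Y 1≤n (ℕₚ.≤-trans n≤x x≤Y) (ℕₚ.≤-trans n≤x x≤X))) ⟩
    ∑ x (λ n → ∑ Y (λ d → 𝟙 (d ∣? n) * Λ d))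
      ≡⟨ ∑-swap x Y _ ⟩
    ∑ Y (λ d → ∑ x (λ n → 𝟙 (d ∣? n) * Λ d))
      ≡⟨ ∑-cong Y (λ d 1≤d _ → trans (∑-multiples x d (λ _ → Λ d) 1≤d) (trans (∑-const (quo x d) (Λ d)) (ℚₚ.*-comm _ (Λ d)))) ⟩
    ∑ Y (λ d → Λ d * ι (quo x d)) ∎)
    where open ≡-Reasoning

  θ : ℕ → ℚ
  θ x = ∑ x Λ

  -- d ↦ ⌊2n/d⌋ - 2⌊n/d⌋ is non-negative, and at least 1 for n < d ≤ 2n.
  θ-double : ∀ n → 1 ℕ.≤ n → n ℕ.+ n ℕ.≤ X → θ (n ℕ.+ n) ≤ θ n + 3ℚ * ι n
  θ-double n 1≤n 2n≤X = lin (lower ⊕ upper) (r (θ (n ℕ.+ n)) (θ n) (∑ (n ℕ.+ n) (λ d → Λ d * (ι (quo (n ℕ.+ n) d) - 2ℚ * ι (quo n d)))) (3ℚ * ι n))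
    where
    2n = n ℕ.+ n
    r : ∀ a b s c → b + c + ((a - b) + s) ≡ a + (s + c)
    r = solve-∀ ℚ-ring
    twice : ∀ d → 1 ℕ.≤ d → 2ℚ * ι (quo n d) ≤ ι (quo 2n d)
    twice d 1≤d = subst (_≤ ι (quo 2n d)) (trans (ι-+ q q) (rr (ι q))) (ι-mono (≤-quo 2n 1≤d (ℕₚ.≤-trans (ℕₚ.≤-reflexive (ℕₚ.*-distribˡ-+ d q q)) (ℕₚ.+-mono-≤ (quo-≤ n 1≤d ℕₚ.≤-refl) (quo-≤ n 1≤d ℕₚ.≤-refl)))))
      where
      q = quo n d
      rr : ∀ q → q + q ≡ 2ℚ * q
      rr = solve-∀ ℚ-ring
    term : ℕ → ℚ
    term d = ι (quo 2n d) - 2ℚ * ι (quo n d)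
    0≤term : ∀ d → 1 ℕ.≤ d → 0ℚ ≤ term d
    0≤term d 1≤d = lin (twice d 1≤d) (r0 (ι (quo 2n d)) (2ℚ * ι (quo n d)))
      where
      r0 : ∀ a b → a - b + b ≡ 0ℚ + a
      r0 = solve-∀ ℚ-ring
    1≤term : ∀ i → 1 ℕ.≤ i → i ℕ.≤ n → 1ℚ ≤ term (n ℕ.+ i)
    1≤term i 1≤i i≤n = lin (a ⊕ b) (r1 (ι (quo 2n d)) (ι (quo n d)))
      where
      d = n ℕ.+ i
      1≤d : 1 ℕ.≤ d
      1≤d = ℕₚ.≤-trans 1≤n (ℕₚ.m≤m+n n i)
      a : ι 1 ≤ ι (quo 2n d)
      a = ι-mono (≤-quo 2n 1≤d (ℕₚ.≤-trans (ℕₚ.≤-reflexive (ℕₚ.*-identityʳ d)) (ℕₚ.+-monoʳ-≤ n i≤n)))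
      b : 2ℚ * ι (quo n d) ≤ 2ℚ * ι 0
      b with quo n d in eq
      ... | zero  = ≤-refl
      ... | suc k = contradiction (quo-≤ n {d} {1} 1≤d (subst (1 ℕ.≤_) (sym eq) (s≤s z≤n))) (λ h → ℕₚ.<⇒≱ (ℕₚ.<-≤-trans (ℕₚ.m<m+n n 1≤i) (ℕₚ.≤-reflexive (sym (ℕₚ.*-identityʳ d)))) h)
      r1 : ∀ a b → a - 2ℚ * b + (ι 1 + 2ℚ * b) ≡ 1ℚ + (a + 2ℚ * ι 0)
      r1 = solve-∀ ℚ-ring
    lower : θ 2n - θ n ≤ ∑ 2n (λ d → Λ d * term d)
    lower = subst₂ _≤_ (sym (trans (cong (_- θ n) (∑-split n n Λ)) (r2 (θ n) _))) (sym (∑-split n n (λ d → Λ d * term d)))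
      (subst (_≤ ∑ n (λ d → Λ d * term d) + ∑ n (λ i → Λ (n ℕ.+ i) * term (n ℕ.+ i))) (ℚₚ.+-identityˡ _)
        (0≤∑ n (λ d 1≤d _ → 0≤* (0≤Λ d) (0≤term d 1≤d)) ⊕ ∑-mono n (λ i 1≤i i≤n → subst (_≤ Λ (n ℕ.+ i) * term (n ℕ.+ i)) (ℚₚ.*-identityʳ _) (0≤Λ (n ℕ.+ i) ⊙ 1≤term i 1≤i i≤n))))
      where
      r2 : ∀ a b → (a + b) - a ≡ b
      r2 = solve-∀ ℚ-ring
    -- Both sides are log((2n)!/n!²), with (2n)! grouped into (2k - 1)(2k) and compared with k².
    -- Such a factor has logarithm at most 3: two from log₂ 2 = 1, one from the defect in
    -- monotonicity.
    eq : ∑ 2n (λ d → Λ d * term d) ≡ ∑ n (λ k → (ℓ (ℕ.pred (k ℕ.+ k)) + ℓ (k ℕ.+ k)) - 2ℚ * ℓ k)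
    eq = trans (∑-cong' 2n (λ d → r3 (Λ d) (ι (quo 2n d)) (ι (quo n d)))) (trans (∑-- 2n _ _) (trans (cong₂ _-_ (trans (∑-log-floor 2n 2n ℕₚ.≤-refl 2n≤X) (∑-double n ℓ))
        (trans (∑-*ˡ 2n 2ℚ _) (trans (cong (2ℚ *_) (∑-log-floor n 2n (ℕₚ.m≤m+n n n) (ℕₚ.≤-trans (ℕₚ.m≤m+n n n) 2n≤X))) (sym (∑-*ˡ n 2ℚ ℓ))))) (sym (∑-- n _ _))))
      where
      r3 : ∀ l a b → l * (a - 2ℚ * b) ≡ l * a - 2ℚ * (l * b)
      r3 = solve-∀ ℚ-ring
    upper : ∑ 2n (λ d → Λ d * term d) ≤ 3ℚ * ι n
    upper = subst (_≤ 3ℚ * ι n) (sym eq) (≤-trans (∑-mono n bound) (≤-eq (trans (∑-const n 3ℚ) (ℚₚ.*-comm (ι n) 3ℚ))))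
      where
      bound : ∀ k → 1 ℕ.≤ k → k ℕ.≤ n → (ℓ (ℕ.pred (k ℕ.+ k)) + ℓ (k ℕ.+ k)) - 2ℚ * ℓ k ≤ 3ℚ
      bound (suc k) _ k≤n = lin (log≤ {k ℕ.+ suc k} {suc k ℕ.+ suc k} (ℕₚ.≤-trans (s≤s z≤n) (ℕₚ.m≤n+m (suc k) k)) (ℕₚ.n≤1+n _) (ℕₚ.≤-trans (ℕₚ.+-mono-≤ k≤n k≤n) 2n≤X))
        (trans (r4 (ℓ (k ℕ.+ suc k)) (ℓ (suc k))) (cong (λ z → (ℓ (k ℕ.+ suc k) + z) - 2ℚ * ℓ (suc k) + (z + 1ℚ)) (sym ℓ2k)))
        where
        ℓ2k : ℓ (suc k ℕ.+ suc k) ≡ 1ℚ + ℓ (suc k)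
        ℓ2k = trans (cong ℓ (cong (suc k ℕ.+_) (sym (ℕₚ.+-identityʳ (suc k))))) (trans (ℓ-* {2} {suc k} (s≤s z≤n) (s≤s z≤n)) (cong (_+ ℓ (suc k)) ℓ-2))
        r4 : ∀ a b → 3ℚ + a ≡ (a + (1ℚ + b)) - 2ℚ * b + ((1ℚ + b) + 1ℚ)
        r4 = solve-∀ ℚ-ring

  Λ-1 : Λ 1 ≤ 0ℚ
  Λ-1 = ≤-trans (≤-eq (sym (trans (ℚₚ.+-identityˡ _) (𝟙*-yes (1 ∣? 1) (∣ₚ.1∣ 1))))) (≤-eq (trans (Λ*1 1 (s≤s z≤n) (s≤s z≤n) 1≤X) ℓ-1))

  chebyshev : ∀ j → 2 ℕ.^ j ℕ.≤ X → θ (2 ℕ.^ j) ≤ 3ℚ * ι (2 ℕ.^ j)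
  chebyshev zero    _ = ≤-trans (≤-refl {0ℚ} ⊕ Λ-1) (ℚₚ.nonNegative⁻¹ (3ℚ * ι 1))
  chebyshev (suc j) h = subst (λ k → θ k ≤ 3ℚ * ι k) (sym (2^-suc j))
    (≤-trans (θ-double n (ℕₚ.m^n>0 2 j) 2n≤X) (≤-trans (chebyshev j (ℕₚ.≤-trans (ℕₚ.m≤m+n n n) 2n≤X) ⊕ ≤-refl) (≤-eq (trans (r (ι n)) (cong (3ℚ *_) (sym (ι-+ n n)))))))
    where
    n = 2 ℕ.^ j
    2n≤X : n ℕ.+ n ℕ.≤ X
    2n≤X = subst (ℕ._≤ X) (2^-suc j) h
    r : ∀ a → 3ℚ * a + 3ℚ * a ≡ 3ℚ * (a + a)
    r = solve-∀ ℚ-ring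

  Λ/ : ℕ → ℚ
  Λ/ d = Λ d * inv d

  0≤Λ/ : ∀ d → 0ℚ ≤ Λ/ d
  0≤Λ/ d = 0≤* (0≤Λ d) (0≤inv d)

  -- Compare x ∑ Λ(d)/d with log x! = ∑ Λ(d) ⌊x/d⌋: rounding costs at most θ(x) ≤ 3 x, and log x! ≤
  -- x (log x + 1).
  mertens-upper : ∀ j → 2 ℕ.^ j ℕ.≤ X → ∑ (2 ℕ.^ j) Λ/ ≤ ι j + 4ℚ
  mertens-upper j x≤X = *-cancelˡ-ι 1≤x (≤-trans (≤-eq (sym (∑-*ˡ x (ι x) Λ/)))
    (≤-trans (∑-mono x (λ d 1≤d _ → subst₂ _≤_ (r (ι x) (Λ d) (inv d)) (s (Λ d) (ι (quo x d))) (0≤Λ d ⊙ quo-upper x 1≤d)))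
    (≤-trans (≤-eq (∑-+ x _ _)) (≤-trans (≤-eq (∑-log-floor x x ℕₚ.≤-refl x≤X) ⊕ chebyshev j x≤X)
      (≤-trans (∑-mono x (λ n 1≤n n≤x → log≤ 1≤n n≤x x≤X) ⊕ ≤-refl) (≤-eq (trans (cong (_+ 3ℚ * ι x) (trans (∑-const x _) (cong (λ z → ι x * (z + 1ℚ)) (ℓ-2^ j)))) (u (ι x) (ι j)))))))))
    where
    x = 2 ℕ.^ j
    1≤x : 1 ℕ.≤ x
    1≤x = ℕₚ.m^n>0 2 j
    r : ∀ x l i → l * (x * i) ≡ x * (l * i)
    r = solve-∀ ℚ-ring
    s : ∀ l q → l * (1ℚ + q) ≡ l * q + l
    s = solve-∀ ℚ-ring
    u : ∀ x j → x * (j + 1ℚ) + 3ℚ * x ≡ x * (j + 4ℚ)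
    u = solve-∀ ℚ-ring

  -- Here rounding goes in the right direction; the 3 comes from log x! ≥ x log x - 3 x.
  mertens-lower : ∀ j → 2 ℕ.^ j ℕ.≤ X → ι j ≤ ∑ (2 ℕ.^ j) Λ/ + 3ℚ
  mertens-lower j x≤X = *-cancelˡ-ι 1≤x (lin (∑-mono x (λ d 1≤d _ → subst (Λ d * ι (quo x d) ≤_) (r (ι x) (Λ d) (inv d)) (0≤Λ d ⊙ quo-lower x 1≤d))
      ⊕ log-mean x 1≤x x≤X) (trans (cong₂ (λ a b → ι x * (∑ x Λ/ + 3ℚ) + (a + b)) (∑-log-floor x x ℕₚ.≤-refl x≤X)
        (trans (∑-- x _ _) (cong (_- ∑ x ℓ) (trans (∑-const x (ℓ x)) (cong (ι x *_) (ℓ-2^ j)))))) (trans (u (ι x) (∑ x Λ/) (∑ x ℓ) (ι j)) (cong (λ z → ι x * ι j + (z + 3ℚ * ι x)) (sym (∑-*ˡ x (ι x) Λ/))))))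
    where
    x = 2 ℕ.^ j
    1≤x : 1 ℕ.≤ x
    1≤x = ℕₚ.m^n>0 2 j
    r : ∀ x l i → l * (x * i) ≡ x * (l * i)
    r = solve-∀ ℚ-ring
    u : ∀ x s l j → x * (s + 3ℚ) + (l + (x * j - l)) ≡ x * j + (x * s + 3ℚ * x)
    u = solve-∀ ℚ-ring

  -- (ℓ n + 3) / n telescopes over ℓ n / (n (n + 1)).
  tele : ℕ → ℚ
  tele n = (ℓ n + 3ℚ) * inv n

  tele-step : ∀ n → 1 ℕ.≤ n → n ℕ.≤ X → ℓ n * (inv n * inv (suc n)) ≤ tele n - tele (suc n)
  tele-step n 1≤n n≤X = lin (0≤* (0≤inv n) (0≤inv (suc n)) ⊙ ℓ-slope 1≤n n≤X)
    (trans (cong (λ z → tele n - tele (suc n) + z) (trans (r₁ (inv n) (inv (suc n)) (ι n) (ℓ (suc n) - ℓ n)) (trans (cong (_* (inv (suc n) * (ℓ (suc n) - ℓ n))) (inv*ι 1≤n)) (ℚₚ.*-identityˡ _))))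
    (trans (r₂ (ℓ n) (ℓ (suc n)) (inv n) (inv (suc n))) (trans (cong ((ℓ n + 3ℚ) *_) (sym (inv-telescope n 1≤n))) (r₃ (ℓ n) (inv n * inv (suc n))))))
    where
    r₁ : ∀ a b n d → a * b * (n * d) ≡ a * n * (b * d)
    r₁ = solve-∀ ℚ-ring
    r₂ : ∀ l l' a b → (l + 3ℚ) * a - (l' + 3ℚ) * b + b * (l' - l) ≡ (l + 3ℚ) * (a - b)
    r₂ = solve-∀ ℚ-ring
    r₃ : ∀ l c → (l + 3ℚ) * c ≡ l * c + c * 3ℚ
    r₃ = solve-∀ ℚ-ring

  0≤tele : ∀ n → 0ℚ ≤ tele n
  0≤tele n = 0≤* (0≤+ (0≤ℓ n) (0≤ι 3)) (0≤inv n)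

  tele-1 : tele 1 ≡ 3ℚ
  tele-1 = trans (cong₂ (λ a b → (a + 3ℚ) * b) ℓ-1 inv-1) refl

  ∑-tele : ∀ x → x ℕ.≤ X → ∑ x (λ n → ℓ n * (inv n * inv (suc n))) + tele (suc x) ≤ 3ℚ
  ∑-tele x x≤X = lin (∑-mono x (λ n 1≤n n≤x → tele-step n 1≤n (ℕₚ.≤-trans n≤x x≤X))) (trans (cong (λ z → 3ℚ + ∑ x (λ n → ℓ n * (inv n * inv (suc n)))) tele-1)
    (trans (r (∑ x (λ n → ℓ n * (inv n * inv (suc n)))) 3ℚ (tele (suc x))) (cong (λ z → ∑ x (λ n → ℓ n * (inv n * inv (suc n))) + tele (suc x) + z) (sym (trans (∑-telescope x tele) (cong (_- tele (suc x)) tele-1))))))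
    where
    r : ∀ s c t → c + s ≡ s + t + (c - t)
    r = solve-∀ ℚ-ring

  ∑-log/n² : ∀ x → x ℕ.≤ X → ∑ x (λ n → ℓ n * (inv n * inv (suc n))) ≤ 3ℚ
  ∑-log/n² x x≤X = lin (∑-tele x x≤X ⊕ 0≤tele (suc x)) (r (∑ x (λ n → ℓ n * (inv n * inv (suc n)))) (tele (suc x)))
    where
    r : ∀ s t → 3ℚ + (s + t + 0ℚ) ≡ s + (3ℚ + t)
    r = solve-∀ ℚ-ring

  log/n : ℕ → ℚ
  log/n n = ℓ n * inv n

  -- Read off from the boundary term in `∑-tele`.
  log/n≤3 : ∀ x → x ℕ.≤ X → log/n (suc x) ≤ 3ℚ
  log/n≤3 x x≤X = lin (∑-tele x x≤X ⊕ 0≤∑ x (λ n _ _ → 0≤* (0≤ℓ n) (0≤* (0≤inv n) (0≤inv (suc n)))) ⊕ 0≤* (0≤ι 3) (0≤inv (suc x)))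
    (r (∑ x (λ n → ℓ n * (inv n * inv (suc n)))) (ℓ (suc x)) (inv (suc x)))
    where
    r : ∀ s l i → 3ℚ + (s + (l + 3ℚ) * i + (0ℚ + 0ℚ)) ≡ l * i + (3ℚ + (s + 3ℚ * i))
    r = solve-∀ ℚ-ring

  -- If y ≤ a and 0 ≤ a, then |y| ≤ 2 a - y. Here y is the decrement, whose negative telescopes, and
  -- a = log n/(n (n + 1)) has a bounded sum; 2/X pays for the defect in monotonicity.
  log/n-variation : ∀ n → 1 ℕ.≤ n → suc n ℕ.≤ X → ∣ log/n n - log/n (suc n) ∣ ≤ 2ℚ * (ℓ n * (inv n * inv (suc n))) - (log/n n - log/n (suc n)) + 2ℚ * inv X
  log/n-variation n 1≤n n<X = ∣∣≤
    (lin (0≤inv (suc n) ⊙ ℓ-mono 1≤n (ℕₚ.n≤1+n n) n<X ⊕ 0≤inv (suc n) ⊙ ℓ-mono 1≤n (ℕₚ.n≤1+n n) n<X ⊕ 0≤inv X ⊙ inv≤1 (suc n) ⊕ 0≤inv X ⊙ inv≤1 (suc n))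
      (trans (cong (λ z → 2ℚ * (ℓ n * z) - (ℓ n * inv n - ℓ (suc n) * inv (suc n)) + 2ℚ * inv X + rest) (inv-telescope n 1≤n)) (r (ℓ n) (ℓ (suc n)) (inv n) (inv (suc n)) (inv X))))
    (lin (0≤* (0≤ι 2) (0≤* (0≤ℓ n) (0≤* (0≤inv n) (0≤inv (suc n)))) ⊕ 0≤* (0≤ι 2) (0≤inv X)) (s (2ℚ * (ℓ n * (inv n * inv (suc n)))) (log/n n - log/n (suc n)) (2ℚ * inv X)))
    where
    rest = inv (suc n) * ℓ n + (inv (suc n) * ℓ n + (inv X * inv (suc n) + inv X * inv (suc n)))
    r : ∀ l l' a b i → 2ℚ * (l * (a - b)) - (l * a - l' * b) + 2ℚ * i + (b * l + (b * l + (i * b + i * b))) ≡ l * a - l' * b + (b * (l' + i) + (b * (l' + i) + (i * 1ℚ + i * 1ℚ)))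
    r = solve-∀ ℚ-ring
    s : ∀ a b c → a - b + c + (0ℚ + 0ℚ) ≡ - b + (a + c)
    s = solve-∀ ℚ-ring

  -- For f = log n/n, the end value plus the variation is at most 2 ∑ log n/(n (n + 1)) + 2 f(x + 1)
  -- + 2 x/X ≤ 6 + 6 + 2.
  oscillating-log : ∀ {M} x (u : ℕ → ℚ) → 0ℚ ≤ M → suc x ℕ.≤ X → (∀ n → ∣ ∑ n u ∣ ≤ M) → ∣ ∑ x (λ n → u n * log/n n) ∣ ≤ M * 14ℚ
  oscillating-log {M} x u 0≤M x<X h = ≤-trans (abel-bound x u log/n h) (0≤M ⊙ bound)
    where
    x≤X = ℕₚ.<⇒≤ x<X
    S = ∑ x (λ n → ℓ n * (inv n * inv (suc n)))
    f = log/n (suc x)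
    V : ∑ x (λ n → ∣ log/n n - log/n (suc n) ∣) ≤ 2ℚ * S - (log/n 1 - f) + ι x * (2ℚ * inv X)
    V = ≤-trans (∑-mono x (λ n 1≤n n≤x → log/n-variation n 1≤n (ℕₚ.≤-trans (s≤s n≤x) x<X)))
      (≤-eq (trans (∑-+ x _ _) (cong₂ _+_ (trans (∑-- x _ _) (cong₂ _-_ (∑-*ˡ x 2ℚ _) (∑-telescope x log/n))) (∑-const x _))))
    r : ∀ V S f g i x → 14ℚ + (V + (2ℚ * S + (2ℚ * f + (2ℚ * (x * i) + 0ℚ)))) ≡ f + V + ((2ℚ * S - (g - f) + x * (2ℚ * i)) + (2ℚ * 3ℚ + (2ℚ * 3ℚ + (2ℚ * 1ℚ + g))))
    r = solve-∀ ℚ-ring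
    bound : ∣ f ∣ + ∑ x (λ n → ∣ log/n n - log/n (suc n) ∣) ≤ 14ℚ
    bound = subst (λ z → z + ∑ x (λ n → ∣ log/n n - log/n (suc n) ∣) ≤ 14ℚ) (sym (∣∣≥0 (0≤* (0≤ℓ (suc x)) (0≤inv (suc x)))))
      (lin (V ⊕ 0≤ι 2 ⊙ ∑-log/n² x x≤X ⊕ 0≤ι 2 ⊙ log/n≤3 x x≤X ⊕ 0≤ι 2 ⊙ ι*inv≤1 x≤X ⊕ 0≤* (0≤ℓ 1) (0≤inv 1)) (r _ S f (log/n 1) (inv X) (ι x)))

-- Twisted sums over primes

module Twisted {X : ℕ} (1≤X : 1 ℕ.≤ X) (log : LogUpTo X) where
  open VonMangoldt 1≤X log public
  open Möbius X public
  open MöbiusLog 1≤X log public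
  open Estimates 1≤X log public

  hyperbola : ∀ x (u a : ℕ → ℚ) → ∑ x (λ n → u n * inv n * ∑ x (λ d → 𝟙 (d ∣? n) * a d)) ≡ ∑ x (λ d → a d * inv d * A (dil d u) (quo x d))
  hyperbola x u a = begin
    ∑ x (λ n → u n * inv n * ∑ x (λ d → 𝟙 (d ∣? n) * a d))
      ≡⟨ ∑-cong' x (λ n → trans (sym (∑-*ˡ x (u n * inv n) _)) (∑-cong' x (λ d → r₁ (u n * inv n) (𝟙 (d ∣? n)) (a d)))) ⟩
    ∑ x (λ n → ∑ x (λ d → a d * (𝟙 (d ∣? n) * (u n * inv n))))
      ≡⟨ ∑-swap x x _ ⟩
    ∑ x (λ d → ∑ x (λ n → a d * (𝟙 (d ∣? n) * (u n * inv n))))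
      ≡⟨ ∑-cong x inner ⟩
    ∑ x (λ d → a d * inv d * A (dil d u) (quo x d)) ∎
    where
    open ≡-Reasoning
    r₁ : ∀ a b c → a * (b * c) ≡ c * (b * a)
    r₁ = solve-∀ ℚ-ring
    r₂ : ∀ u i j → u * (i * j) ≡ i * (u * j)
    r₂ = solve-∀ ℚ-ring
    inner : ∀ d → 1 ℕ.≤ d → d ℕ.≤ x → ∑ x (λ n → a d * (𝟙 (d ∣? n) * (u n * inv n))) ≡ a d * inv d * A (dil d u) (quo x d)
    inner d 1≤d _ = trans (∑-*ˡ x (a d) _) (trans (cong (a d *_) (trans (∑-multiples x d (λ n → u n * inv n) 1≤d)
      (trans (∑-cong' (quo x d) (λ k → trans (cong (u (d ℕ.* k) *_) (inv-* d k)) (r₂ (u (d ℕ.* k)) (inv d) (inv k)))) (∑-*ˡ (quo x d) (inv d) _)))) (sym (ℚₚ.*-assoc (a d) (inv d) _)))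

  -- The tail of `A` beyond ⌊x/d⌋ is at most 2 M/(⌊x/d⌋ + 1) ≤ 2 M d/x, and this d cancels `inv d`.
  -- Hence only the mean size of a over d ≤ x enters.
  completion-error : ∀ {M} x (u a : ℕ → ℚ) → 1 ℕ.≤ x → x ℕ.≤ X → 0ℚ ≤ M → Osc M u →
    ∣ ∑ x (λ d → a d * inv d * A (dil d u) (quo x d)) - ∑ x (λ d → a d * inv d * A (dil d u) X) ∣ ≤ 2ℚ * M * inv x * ∑ x (λ d → ∣ a d ∣)
  completion-error {M} x u a 1≤x x≤X 0≤M osc = subst₂ (λ s t → ∣ s ∣ ≤ t) (∑-- x _ _) (∑-*ˡ x (2ℚ * M * inv x) _) (∑-abs-mono x bound)
    where
    r₁ : ∀ a b c → a * b - a * c ≡ a * - (c - b)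
    r₁ = solve-∀ ℚ-ring
    r₂ : ∀ a i M j → a * i * (2ℚ * M * j) ≡ 2ℚ * M * (i * j) * a
    r₂ = solve-∀ ℚ-ring
    bound : ∀ d → 1 ℕ.≤ d → d ℕ.≤ x → ∣ a d * inv d * A (dil d u) (quo x d) - a d * inv d * A (dil d u) X ∣ ≤ 2ℚ * M * inv x * ∣ a d ∣
    bound d 1≤d _ = subst (λ s → ∣ s ∣ ≤ 2ℚ * M * inv x * ∣ a d ∣) (sym (r₁ (a d * inv d) (A (dil d u) (quo x d)) (A (dil d u) X)))
      (≤-trans (∣*∣≤ {a d * inv d} (≤-eq (trans (ℚₚ.∣p*q∣≡∣p∣*∣q∣ (a d) (inv d)) (cong (∣ a d ∣ *_) (∣∣≥0 (0≤inv d)))))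
        (subst (_≤ 2ℚ * M * inv (suc (quo x d))) (sym (ℚₚ.∣-p∣≡∣p∣ (A (dil d u) X - A (dil d u) (quo x d)))) (A-tail {u = dil d u} (Osc-dil {u = u} d 1≤d osc) (ℕₚ.≤-trans (quo≤ x d) x≤X))))
      (≤-trans (≤-eq (r₂ ∣ a d ∣ (inv d) M (inv (suc (quo x d))))) (*-monoˡ (ℚₚ.0≤∣p∣ (a d)) (0≤* (0≤ι 2) 0≤M ⊙ subst (_≤ inv x) (inv-* d (suc (quo x d))) (inv-anti 1≤x (ℕₚ.<⇒≤ (<-quo x 1≤d)))))))

  -- The hyperbola method for Λ * 1 = log: 14 from `oscillating-log`, and 6 = 2 · 3 from completing
  -- the sums by Chebyshev's bound.
  twisted-Λ : ∀ {M} j (u : ℕ → ℚ) → suc (2 ℕ.^ j) ℕ.≤ X → 0ℚ ≤ M → Osc M u → ∣ ∑ (2 ℕ.^ j) (λ d → Λ/ d * A (dil d u) X) ∣ ≤ M * 20ℚ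
  twisted-Λ {M} j u x<X 0≤M osc = subst₂ (λ s t → ∣ s ∣ ≤ t) (r₁ (∑ x (λ n → u n * log/n n)) (∑ x (λ d → Λ/ d * A (dil d u) X))) (r₂ M)
    (∣-∣≤ {∑ x (λ n → u n * log/n n)} (oscillating-log x u 0≤M x<X (Osc⇒bounded osc)) (subst (λ s → ∣ s - ∑ x (λ d → Λ/ d * A (dil d u) X) ∣ ≤ M * 6ℚ) (sym eq) err))
    where
    x = 2 ℕ.^ j
    1≤x : 1 ℕ.≤ x
    1≤x = ℕₚ.m^n>0 2 j
    x≤X = ℕₚ.<⇒≤ x<X
    r₁ : ∀ a b → a - (a - b) ≡ b
    r₁ = solve-∀ ℚ-ring
    r₂ : ∀ M → M * 14ℚ + M * 6ℚ ≡ M * 20ℚ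
    r₂ = solve-∀ ℚ-ring
    r₃ : ∀ u l i → u * (l * i) ≡ u * i * l
    r₃ = solve-∀ ℚ-ring
    r₄ : ∀ M i x → 2ℚ * M * i * (3ℚ * x) ≡ M * 6ℚ * (i * x)
    r₄ = solve-∀ ℚ-ring
    eq : ∑ x (λ n → u n * log/n n) ≡ ∑ x (λ d → Λ/ d * A (dil d u) (quo x d))
    eq = trans (∑-cong x (λ n 1≤n n≤x → trans (r₃ (u n) (ℓ n) (inv n)) (cong (u n * inv n *_) (sym (Λ*1 x 1≤n n≤x (ℕₚ.≤-trans n≤x x≤X)))))) (hyperbola x u Λ)
    err : ∣ ∑ x (λ d → Λ/ d * A (dil d u) (quo x d)) - ∑ x (λ d → Λ/ d * A (dil d u) X) ∣ ≤ M * 6ℚ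
    err = ≤-trans (completion-error x u Λ 1≤x x≤X 0≤M osc) (≤-trans (0≤* (0≤* (0≤ι 2) 0≤M) (0≤inv x) ⊙ ≤-trans (≤-eq (∑-cong' x (λ d → ∣∣≥0 (0≤Λ d)))) (chebyshev j x≤X))
      (≤-eq (trans (r₄ M (inv x) (ι x)) (trans (cong (M * 6ℚ *_) (inv*ι 1≤x)) (ℚₚ.*-identityʳ _)))))

  -- μ(d) log(x/d) for x = 2^j, whose convolution with 1 is log x δ + Λ.
  weight : ℕ → ℕ → ℚ
  weight j d = μ d * (ι j - ℓ d)

  weight*1 : ∀ j {n} x → 1 ℕ.≤ n → n ℕ.≤ x → n ℕ.≤ X → ∑ x (λ d → 𝟙 (d ∣? n) * weight j d) ≡ ι j * 𝟙 (n ℕₚ.≟ 1) + Λ n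
  weight*1 j {n} x 1≤n n≤x n≤X = trans (∑-cong' x (λ d → r (𝟙 (d ∣? n)) (μ d) (ι j) (ℓ d))) (trans (∑-- x _ _)
    (trans (cong₂ _-_ (trans (∑-*ˡ x (ι j) _) (cong (ι j *_) (μ*1 x 1≤n n≤x n≤X))) (μℓ*1 x 1≤n n≤x n≤X)) (s (ι j * 𝟙 (n ℕₚ.≟ 1)) (Λ n))))
    where
    r : ∀ a m t l → a * (m * (t - l)) ≡ t * (a * m) - a * (m * l)
    r = solve-∀ ℚ-ring
    s : ∀ a b → a - - b ≡ a + b
    s = solve-∀ ℚ-ring

  ∣weight∣ : ∀ j d → ∣ weight j d ∣ ≤ ∣ ℓ (2 ℕ.^ j) - ℓ d ∣
  ∣weight∣ j d = subst (∣ weight j d ∣ ≤_) (trans (ℚₚ.*-identityˡ _) (cong (λ t → ∣ t - ℓ d ∣) (sym (ℓ-2^ j)))) (∣*∣≤ {μ d} (∣μ∣≤1 d) ≤-refl)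

  weighted : (ℕ → ℚ) → ℕ → ℚ
  weighted u j = ι j * u 1 + ∑ (2 ℕ.^ j) (λ n → u n * Λ/ n)

  -- The hyperbola method for `weight`. The error needs no cancellation in μ, only |μ| ≤ 1 and ∑
  -- |log(x/d)| ≤ 5 x, whence 10 = 2 · 5.
  twisted-μ : ∀ {M} j (u : ℕ → ℚ) → 2 ℕ.^ j ℕ.≤ X → 0ℚ ≤ M → Osc M u →
    ∣ weighted u j - ∑ (2 ℕ.^ j) (λ d → weight j d * inv d * A (dil d u) X) ∣ ≤ M * 10ℚ
  twisted-μ {M} j u x≤X 0≤M osc = subst (λ s → ∣ s - ∑ x (λ d → weight j d * inv d * A (dil d u) X) ∣ ≤ M * 10ℚ) (sym eq)
    (≤-trans (completion-error x u (weight j) 1≤x x≤X 0≤M osc) (≤-trans (0≤* (0≤* (0≤ι 2) 0≤M) (0≤inv x) ⊙ ≤-trans (∑-mono x (λ d _ _ → ∣weight∣ j d)) (log-mean-abs x 1≤x x≤X))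
      (≤-eq (trans (r₄ M (inv x) (ι x)) (trans (cong (M * 10ℚ *_) (inv*ι 1≤x)) (ℚₚ.*-identityʳ _))))))
    where
    x = 2 ℕ.^ j
    1≤x : 1 ℕ.≤ x
    1≤x = ℕₚ.m^n>0 2 j
    r₄ : ∀ M i x → 2ℚ * M * i * (5ℚ * x) ≡ M * 10ℚ * (i * x)
    r₄ = solve-∀ ℚ-ring
    r₅ : ∀ u i t δ l → u * i * (t * δ + l) ≡ δ * (u * i * t) + u * (l * i)
    r₅ = solve-∀ ℚ-ring
    first : ∑ x (λ n → 𝟙 (n ℕₚ.≟ 1) * (u n * inv n * ι j)) ≡ ι j * u 1
    first = trans (∑-pick x 1 (s≤s z≤n) 1≤x (λ i _ _ i≢1 → 𝟙*-no (i ℕₚ.≟ 1) i≢1)) (trans (𝟙*-yes (1 ℕₚ.≟ 1) refl) (trans (cong (λ z → u 1 * z * ι j) inv-1) (r₆ (u 1) (ι j))))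
      where
      r₆ : ∀ u t → u * 1ℚ * t ≡ t * u
      r₆ = solve-∀ ℚ-ring
    eq : weighted u j ≡ ∑ x (λ d → weight j d * inv d * A (dil d u) (quo x d))
    eq = trans (cong (_+ ∑ x (λ n → u n * Λ/ n)) (sym first)) (trans (sym (∑-+ x _ _)) (trans
      (∑-cong x (λ n 1≤n n≤x → trans (sym (r₅ (u n) (inv n) (ι j) (𝟙 (n ℕₚ.≟ 1)) (Λ n))) (cong (u n * inv n *_) (sym (weight*1 j x 1≤n n≤x (ℕₚ.≤-trans n≤x x≤X)))))) (hyperbola x u (weight j))))

  selberg-error : ℕ → ℕ → ℚ
  selberg-error j j' = (ι j + 2ℚ) * (ι j + 1ℚ) * 20ℚ + (ι j' + 4ℚ) * 10ℚ

  -- Insert `twisted-μ` for every dilation of u and exchange the sums: the inner sum over d is then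
  -- a `twisted-Λ` for u dilated by e, bounded although the values of `A` are unknown. Its weights
  -- log(x/e)/e contribute (log x)², while the error of `twisted-μ`, summed against Λ(d)/d up to x',
  -- contributes log x'.
  selberg : ∀ {M} j j' (u : ℕ → ℚ) → 2 ℕ.^ j ℕ.≤ X → suc (2 ℕ.^ j') ℕ.≤ X → 0ℚ ≤ M → Osc M u →
    ∣ ∑ (2 ℕ.^ j') (λ d → Λ/ d * weighted (dil d u) j) ∣ ≤ M * selberg-error j j'
  selberg {M} j j' u x≤X x'<X 0≤M osc = subst₂ (λ s t → ∣ s ∣ ≤ t) (r₁ W V) (r₂ M (ι j) (ι j'))
    (∣+∣≤ {W - V} diff main)
    where
    x = 2 ℕ.^ j
    x' = 2 ℕ.^ j'
    b : ℕ → ℚ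
    b e = weight j e * inv e
    W = ∑ x' (λ d → Λ/ d * weighted (dil d u) j)
    V = ∑ x' (λ d → Λ/ d * ∑ x (λ e → b e * A (dil e (dil d u)) X))
    r₁ : ∀ a b → (a - b) + b ≡ a
    r₁ = solve-∀ ℚ-ring
    r₂ : ∀ M t t' → (t' + 4ℚ) * (M * 10ℚ) + (t + 2ℚ) * (1ℚ + t) * (M * 20ℚ) ≡ M * ((t + 2ℚ) * (t + 1ℚ) * 20ℚ + (t' + 4ℚ) * 10ℚ)
    r₂ = solve-∀ ℚ-ring
    r₃ : ∀ a b c → a * b - a * c ≡ a * (b - c)
    r₃ = solve-∀ ℚ-ring
    r₄ : ∀ a b c → a * (b * c) ≡ b * (a * c)
    r₄ = solve-∀ ℚ-ring
    diff : ∣ W - V ∣ ≤ (ι j' + 4ℚ) * (M * 10ℚ)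
    diff = subst (λ s → ∣ s ∣ ≤ (ι j' + 4ℚ) * (M * 10ℚ)) (∑-- x' _ _) (≤-trans (∑-abs-mono x' (λ d 1≤d _ →
        subst (λ s → ∣ s ∣ ≤ Λ/ d * (M * 10ℚ)) (sym (r₃ (Λ/ d) (weighted (dil d u) j) _)) (∣*∣≤ {Λ/ d} (≤-eq (∣∣≥0 (0≤Λ/ d))) (twisted-μ j (dil d u) x≤X 0≤M (Osc-dil {u = u} d 1≤d osc)))))
      (≤-trans (≤-eq (∑-*ʳ x' (M * 10ℚ) Λ/)) (*-monoˡ (0≤* 0≤M (0≤ι 10)) (mertens-upper j' (ℕₚ.<⇒≤ x'<X)))))
    V≡ : V ≡ ∑ x (λ e → b e * ∑ x' (λ d → Λ/ d * A (dil d (dil e u)) X))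
    V≡ = trans (∑-cong' x' (λ d → sym (∑-*ˡ x (Λ/ d) _))) (trans (∑-swap x' x _) (∑-cong' x (λ e → trans (∑-cong' x' (λ d → trans (r₄ (Λ/ d) (b e) _)
       (cong (λ z → b e * (Λ/ d * z)) (∑-cong' X (λ k → cong (λ z → u z * inv k) (comm d e k)))))) (∑-*ˡ x' (b e) _))))
      where
      comm : ∀ d e k → d ℕ.* (e ℕ.* k) ≡ e ℕ.* (d ℕ.* k)
      comm = ℕ-Solver.solve-∀
    1≤x : 1 ℕ.≤ x
    1≤x = ℕₚ.m^n>0 2 j
    ∣b∣ : ∀ e → 1 ℕ.≤ e → e ℕ.≤ x → ∣ b e ∣ ≤ (ι j + 2ℚ) * inv e
    ∣b∣ e 1≤e e≤x = ∣*∣≤ {weight j e} {inv e} {ι j + 2ℚ} (≤-trans (∣weight∣ j e) (≤-trans (∣log-diff∣ 1≤e e≤x x≤X)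
        (lin (0≤ℓ e ⊕ 0≤ι 2 ⊙ inv≤1 X) (trans (cong (λ z → z + 2ℚ + (0ℚ + 2ℚ * inv X)) (sym (ℓ-2^ j))) (r₅ (ℓ x) (ℓ e) (inv X)))))) (≤-eq (∣∣≥0 (0≤inv e)))
      where
      r₅ : ∀ t l i → t + 2ℚ + (0ℚ + 2ℚ * i) ≡ t - l + 2ℚ * i + (l + 2ℚ * 1ℚ)
      r₅ = solve-∀ ℚ-ring
    main : ∣ V ∣ ≤ (ι j + 2ℚ) * (1ℚ + ι j) * (M * 20ℚ)
    main = subst (λ s → ∣ s ∣ ≤ (ι j + 2ℚ) * (1ℚ + ι j) * (M * 20ℚ)) (sym V≡)
      (≤-trans (∑-abs-mono x (λ e 1≤e e≤x → ∣*∣≤ {b e} (∣b∣ e 1≤e e≤x) (twisted-Λ j' (dil e u) x'<X 0≤M (Osc-dil {u = u} e 1≤e osc))))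
        (≤-trans (≤-eq (∑-*ʳ x (M * 20ℚ) _)) (*-monoˡ (0≤* 0≤M (0≤ι 20)) (≤-trans (≤-eq (∑-*ˡ x (ι j + 2ℚ) inv)) (0≤+ (0≤ι j) (0≤ι 2) ⊙ harmonic-2^ j)))))

-- Prime powers contribute little

-- The last term, counted twice, is what lets the induction close: by 2 ≤ q the next one is at most
-- half of it.
geometric : ∀ {q} n → 2 ℕ.≤ q → ∑ (suc n) (λ k → inv (q ℕ.^ k)) + inv (q ℕ.^ suc n) ≤ 2ℚ * inv q
geometric {q} zero 2≤q = ≤-eq (trans (cong (λ z → 0ℚ + inv z + inv z) (ℕₚ.*-identityʳ q)) (r (inv q)))
  where
  r : ∀ a → 0ℚ + a + a ≡ 2ℚ * a
  r = solve-∀ ℚ-ring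
geometric {q} (suc n) 2≤q = lin (geometric n 2≤q ⊕ *-monoˡ (0≤inv (q ℕ.* q ℕ.^ suc n)) (ι-mono 2≤q))
  (trans (cong (λ z → 2ℚ * inv q + (S + a₁ + z)) (r₁ a₂)) (trans (r₂ (2ℚ * inv q) S a₁ a₂) (cong (λ z → S + a₂ + a₂ + (2ℚ * inv q + z)) a₁≡)))
  where
  S = ∑ (suc n) (λ k → inv (q ℕ.^ k))
  a₁ = inv (q ℕ.^ suc n)
  a₂ = inv (q ℕ.* q ℕ.^ suc n)
  a₁≡ : a₁ ≡ ι q * a₂
  a₁≡ = sym (trans (cong (ι q *_) (inv-* q (q ℕ.^ suc n))) (trans (sym (ℚₚ.*-assoc (ι q) (inv q) a₁)) (trans (cong (_* a₁) (ι*inv (ℕₚ.≤-trans (s≤s z≤n) 2≤q))) (ℚₚ.*-identityˡ a₁))))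
  r₁ : ∀ b → 2ℚ * b ≡ b + b
  r₁ = solve-∀ ℚ-ring
  r₂ : ∀ t s a b → t + (s + a + (b + b)) ≡ s + b + b + (t + a)
  r₂ = solve-∀ ℚ-ring

geometric-sum : ∀ {q} n → 2 ℕ.≤ q → ∑ n (λ k → inv (q ℕ.^ k)) ≤ 2ℚ * inv q
geometric-sum {q} zero    _   = 0≤* (0≤ι 2) (0≤inv q)
geometric-sum {q} (suc n) 2≤q = lin (geometric n 2≤q ⊕ 0≤inv (q ℕ.^ suc n)) (r (2ℚ * inv q) (∑ (suc n) (λ k → inv (q ℕ.^ k))) (inv (q ℕ.^ suc n)))
  where
  r : ∀ a b c → a + (b + c + 0ℚ) ≡ b + (a + c)
  r = solve-∀ ℚ-ring

module Classes {X : ℕ} (1≤X : 1 ℕ.≤ X) (log : LogUpTo X) (m : ℕ) {{m≢0 : ℕ.NonZero m}} where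
  open Twisted 1≤X log public
  open Residues m

  S : ℕ → ℕ → ℚ
  S j g = ∑ (2 ℕ.^ j) (λ d → Λ/ d * cls g d)

  0≤S : ∀ j g → 0ℚ ≤ S j g
  0≤S j g = 0≤∑ (2 ℕ.^ j) (λ d _ _ → 0≤* (0≤Λ/ d) (0≤𝟙 (d ≋? g)))

  S-cong : ∀ j {g h} → g ≋ h → S j g ≡ S j h
  S-cong j {g} {h} e = ∑-cong' (2 ℕ.^ j) (λ d → cong (Λ/ d *_) (𝟙-⇔ (d ≋? g) (d ≋? h) (λ p → trans p e) (λ p → trans p (sym e))))

  σ : ℕ → ℚ
  σ j = ∑ (2 ℕ.^ j) (λ d → Λ/ d * 𝟙 (unit? d))

  ∑ᵤ-S : ∀ j → ∑ᵤ (S j) ≡ σ j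
  ∑ᵤ-S j = trans (∑ᵤ-∑ (2 ℕ.^ j) _) (∑-cong' (2 ℕ.^ j) (λ d → trans (∑ᵤ-*ˡ (Λ/ d) (λ h → cls h d)) (cong (Λ/ d *_) (∑ᵤ-cls-1 d))))

  conv : ℕ → ℕ → ℕ → ℚ
  conv j j' g = ∑ (2 ℕ.^ j') (λ d → Λ/ d * ∑ (2 ℕ.^ j) (λ n → cls g (d ℕ.* n) * Λ/ n))

  conv-∑ᵤ : ∀ j j' g → Unit g → conv j j' g ≡ ∑ᵤ (λ h → S j h * S j' (hinv h ℕ.* g))
  conv-∑ᵤ j j' g ug = begin
    conv j j' g
      ≡⟨ ∑-cong' x' (λ d → cong (Λ/ d *_) (trans (∑-cong' x (λ n → trans (cong (_* Λ/ n) (cls-expand d n g ug)) (trans (ℚₚ.*-comm _ (Λ/ n)) (sym (∑ᵤ-*ˡ (Λ/ n) _))))) (sym (∑ᵤ-∑ x _)))) ⟩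
    ∑ x' (λ d → Λ/ d * ∑ᵤ (λ h → ∑ x (λ n → Λ/ n * (cls h n * cls (hinv h ℕ.* g) d))))
      ≡⟨ ∑-cong' x' (λ d → trans (sym (∑ᵤ-*ˡ (Λ/ d) _)) (∑ᵤ-cong (λ h _ → trans (cong (Λ/ d *_) (trans (∑-cong' x (λ n → sym (ℚₚ.*-assoc (Λ/ n) (cls h n) _))) (∑-*ʳ x _ _))) (r (Λ/ d) (S j h) (cls (hinv h ℕ.* g) d))))) ⟩
    ∑ x' (λ d → ∑ᵤ (λ h → S j h * (Λ/ d * cls (hinv h ℕ.* g) d)))
      ≡⟨ sym (∑ᵤ-∑ x' _) ⟩
    ∑ᵤ (λ h → ∑ x' (λ d → S j h * (Λ/ d * cls (hinv h ℕ.* g) d)))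
      ≡⟨ ∑ᵤ-cong (λ h _ → ∑-*ˡ x' (S j h) _) ⟩
    ∑ᵤ (λ h → S j h * S j' (hinv h ℕ.* g)) ∎
    where
    open ≡-Reasoning
    x = 2 ℕ.^ j
    x' = 2 ℕ.^ j'
    r : ∀ a b c → a * (b * c) ≡ b * (a * c)
    r = solve-∀ ℚ-ring

  -- The left side of the Selberg formula for the class g. `E-diff` shows that it hardly depends on
  -- g, so its main term is its mean over the units, computed in `∑ᵤ-E`.
  E : ℕ → ℕ → ℕ → ℚ
  E j j' g = ι j * S j' g + conv j j' g

  E-diff : ∀ j j' {g g'} → 2 ℕ.^ j ℕ.≤ X → suc (2 ℕ.^ j') ℕ.≤ X → Unit g → Unit g' → ∣ E j j' g - E j j' g' ∣ ≤ selberg-error j j'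
  E-diff j j' {g} {g'} h h' ug ug' = subst₂ (λ s t → ∣ s ∣ ≤ t) eq (ℚₚ.*-identityˡ _) (selberg j j' (cls-diff g g') h h' 0≤1 (Osc-cls-diff ug ug'))
    where
    x = 2 ℕ.^ j
    x' = 2 ℕ.^ j'
    r₁ : ∀ l t a b p q → l * (t * (a - b) + (p - q)) ≡ (t * (l * a) + l * p) - (t * (l * b) + l * q)
    r₁ = solve-∀ ℚ-ring
    r₂ : ∀ a b l → (a - b) * l ≡ a * l - b * l
    r₂ = solve-∀ ℚ-ring
    E≡ : ∀ g → ∑ x' (λ d → ι j * (Λ/ d * cls g d) + Λ/ d * ∑ x (λ n → cls g (d ℕ.* n) * Λ/ n)) ≡ E j j' g
    E≡ g = trans (∑-+ x' _ _) (cong (_+ conv j j' g) (∑-*ˡ x' (ι j) _))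
    eq : ∑ x' (λ d → Λ/ d * weighted (dil d (cls-diff g g')) j) ≡ E j j' g - E j j' g'
    eq = trans (∑-cong' x' (λ d → trans (cong (Λ/ d *_) (cong₂ (λ a b → ι j * a + b) (cong (cls-diff g g') (ℕₚ.*-identityʳ d))
           (trans (∑-cong' x (λ n → r₂ (cls g (d ℕ.* n)) (cls g' (d ℕ.* n)) (Λ/ n))) (∑-- x _ _)))) (r₁ (Λ/ d) (ι j) (cls g d) (cls g' d) _ _)))
         (trans (∑-- x' _ _) (cong₂ _-_ (E≡ g) (E≡ g')))

  ∑ᵤ-E : ∀ j j' → ∑ᵤ (E j j') ≡ ι j * σ j' + σ j' * σ j
  ∑ᵤ-E j j' = trans (∑ᵤ-+ _ _) (cong₂ _+_ (trans (∑ᵤ-*ˡ (ι j) (S j')) (cong (ι j *_) (∑ᵤ-S j'))) cv)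
    where
    x = 2 ℕ.^ j
    x' = 2 ℕ.^ j'
    r : ∀ a b c d → a * b * (c * d) ≡ a * (b * (c * d))
    r = solve-∀ ℚ-ring
    r' : ∀ a b c → a * b * c ≡ b * (c * a)
    r' = solve-∀ ℚ-ring
    um : ∀ d n → 𝟙 (unit? (d ℕ.* n)) ≡ 𝟙 (unit? d) * 𝟙 (unit? n)
    um d n with unit? d | unit? n
    ... | yes u | yes v = 𝟙-yes (unit? (d ℕ.* n)) (λ {i} → unit-* {d} u v {i})
    ... | no ¬u | w     = trans (𝟙-no (unit? (d ℕ.* n)) (λ v → ¬u (λ {i} → unit-*ˡ {d} {n} v {i}))) (sym (ℚₚ.*-zeroˡ (𝟙 w)))
    ... | yes _ | no ¬v = 𝟙-no (unit? (d ℕ.* n)) (λ w → ¬v (λ {i} → unit-*ʳ {d} {n} w {i}))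
    cv : ∑ᵤ (conv j j') ≡ σ j' * σ j
    cv = trans (∑ᵤ-∑ x' _) (trans (∑-cong' x' (λ d → trans (∑ᵤ-*ˡ (Λ/ d) _) (trans (cong (Λ/ d *_) (trans (∑ᵤ-∑ x _) (trans (∑-cong' x (λ n →
           trans (∑ᵤ-cong (λ h _ → ℚₚ.*-comm (cls h (d ℕ.* n)) (Λ/ n))) (trans (∑ᵤ-*ˡ (Λ/ n) _) (trans (cong (Λ/ n *_) (trans (∑ᵤ-cls-1 (d ℕ.* n)) (um d n))) (trans (sym (ℚₚ.*-assoc (Λ/ n) (𝟙 (unit? d)) _)) (r' (Λ/ n) (𝟙 (unit? d)) (𝟙 (unit? n))))))))
           (trans (∑-*ˡ x (𝟙 (unit? d)) _) (cong (𝟙 (unit? d) *_) (∑-cong' x (λ n → ℚₚ.*-comm (𝟙 (unit? n)) (Λ/ n)))))))) (sym (ℚₚ.*-assoc (Λ/ d) (𝟙 (unit? d)) (σ j)))))) (∑-*ʳ x' (σ j) _))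

  -- The map taking h to g/h permutes the unit classes.
  ∑ᵤ-S-hinv : ∀ j g → Unit g → ∑ᵤ (λ h → S j (hinv h ℕ.* g)) ≡ σ j
  ∑ᵤ-S-hinv j g ug = trans (∑ᵤ-∑ (2 ℕ.^ j) _) (∑-cong' (2 ℕ.^ j) (λ d → trans (∑ᵤ-*ˡ (Λ/ d) _) (cong (Λ/ d *_) (one d))))
    where
    one : ∀ d → ∑ᵤ (λ h → cls (hinv h ℕ.* g) d) ≡ 𝟙 (unit? d)
    one d with unit? d
    ... | no ¬u = trans (∑ᵤ-cong (λ h uh → 𝟙-no (d ≋? hinv h ℕ.* g) (λ e → ¬u (λ {i} → unit-resp-≋ (sym e) (hinv-unit g uh ug) {i})))) (trans (∑ᵤ-const 0ℚ) (ℚₚ.*-zeroʳ φ))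
    ... | yes u = trans (∑ᵤ-cong (λ h uh → trans (sym (cls-* d g uh)) (trans (cong (λ z → 𝟙 (z ≋? g)) (ℕₚ.*-comm d h)) (trans (cls-* h g u) (𝟙-⇔ (h ≋? hinv d ℕ.* g) (hinv d ℕ.* g ≋? h) sym sym))))) (trans (∑ᵤ-cls-1 (hinv d ℕ.* g)) (𝟙-yes (unit? (hinv d ℕ.* g)) (λ {i} → hinv-unit g u ug {i})))

  prime-power-sum : ∀ j (B : ℕ → ℚ) (f : ℕ → ℚ) → (∀ q → Prime q → q ℕ.≤ X → ∑ X (λ k → 𝟙 (q ℕ.^ k ℕₚ.≤? 2 ℕ.^ j) * (inv (q ℕ.^ k) * f (q ℕ.^ k))) ≤ B q) →
    ∑ (2 ℕ.^ j) (λ d → Λ/ d * f d) ≤ ∑ X (λ q → 𝟙 (prime? q) * (ℓ q * B q))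
  prime-power-sum j B f h = ≤-trans (≤-eq (trans (∑-cong' (2 ℕ.^ j) (λ d → ℚₚ.*-assoc (Λ d) (inv d) (f d))) (∑-Λ (2 ℕ.^ j) (λ d → inv d * f d))))
    (∑-mono X (λ q _ q≤X → ≤-trans (≤-eq (ℚₚ.*-assoc (𝟙 (prime? q)) (ℓ q) _)) (𝟙*-mono (prime? q) (λ pq → 0≤ℓ q ⊙ h q pq q≤X))))

  log≤3n : ∀ q → 1 ℕ.≤ q → q ℕ.≤ X → ℓ q ≤ 3ℚ * ι q
  log≤3n (suc q) _ h = subst (_≤ 3ℚ * ι (suc q)) (trans (ℚₚ.*-assoc (ℓ (suc q)) (inv (suc q)) (ι (suc q))) (trans (cong (ℓ (suc q) *_) (inv*ι {suc q} (s≤s z≤n))) (ℚₚ.*-identityʳ (ℓ (suc q))))) (*-monoˡ (0≤ι (suc q)) (log/n≤3 q (ℕₚ.<⇒≤ h)))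

  cm : ℚ
  cm = ι m * (3ℚ * ι m)

  -- Only powers of primes q ≤ m can fail to be units, and the powers of one q contribute at most
  -- log q · 2/q ≤ log q ≤ 3 m.
  non-unit-sum : ∀ j → m ℕ.≤ X → ∑ (2 ℕ.^ j) (λ d → Λ/ d * (1ℚ - 𝟙 (unit? d))) ≤ cm
  non-unit-sum j m≤X = ≤-trans (prime-power-sum j (λ q → 𝟙 (q ℕₚ.≤? m)) (λ d → 1ℚ - 𝟙 (unit? d)) bound)
    (≤-trans (∑-mono X bound₂) (≤-trans (≤-eq (trans (∑-extend m≤X (λ i m<i _ → 𝟙*-no (i ℕₚ.≤? m) (ℕₚ.<⇒≱ m<i))) (∑-cong m (λ i _ i≤m → 𝟙*-yes (i ℕₚ.≤? m) i≤m)))) (≤-eq (∑-const m (3ℚ * ι m)))))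
    where
    bound : ∀ q → Prime q → q ℕ.≤ X → ∑ X (λ k → 𝟙 (q ℕ.^ k ℕₚ.≤? 2 ℕ.^ j) * (inv (q ℕ.^ k) * (1ℚ - 𝟙 (unit? (q ℕ.^ k))))) ≤ 𝟙 (q ℕₚ.≤? m)
    bound q pq _ with q ℕₚ.≤? m
    ... | yes _ = ≤-trans (∑-mono X (λ k _ _ → ≤-trans (*-mono (0≤𝟙 (q ℕ.^ k ℕₚ.≤? 2 ℕ.^ j)) (0≤* (0≤inv (q ℕ.^ k)) 0≤1) (𝟙≤1 (q ℕ.^ k ℕₚ.≤? 2 ℕ.^ j)) (0≤inv (q ℕ.^ k) ⊙ lin (0≤𝟙 (unit? (q ℕ.^ k))) (r (𝟙 (unit? (q ℕ.^ k)))))) (≤-eq (r' (inv (q ℕ.^ k))))))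
          (≤-trans (geometric-sum X (prime≥2 pq)) (ι*inv≤1 (prime≥2 pq)))
      where
      r : ∀ a → 1ℚ + 0ℚ ≡ 1ℚ - a + a
      r = solve-∀ ℚ-ring
      r' : ∀ a → 1ℚ * (a * 1ℚ) ≡ a
      r' = solve-∀ ℚ-ring
    ... | no q≰m = ≤-eq (∑-≡0 X (λ k _ _ → trans (cong (λ z → 𝟙 (q ℕ.^ k ℕₚ.≤? 2 ℕ.^ j) * (inv (q ℕ.^ k) * (1ℚ - z))) (𝟙-yes (unit? (q ℕ.^ k)) (λ {i} → u k {i}))) (r (𝟙 (q ℕ.^ k ℕₚ.≤? 2 ℕ.^ j)) (inv (q ℕ.^ k)))))
      where
      r : ∀ a b → a * (b * (1ℚ - 1ℚ)) ≡ 0ℚ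
      r = solve-∀ ℚ-ring
      u : ∀ k → Unit (q ℕ.^ k)
      u zero    = Cop.1-coprimeTo m
      u (suc k) = unit-* {q} (Cop.sym (coprime-prime pq (λ q∣m → q≰m (∣⇒≤' 1≤m q∣m)))) (λ {i} → u k {i})
    bound₂ : ∀ q → 1 ℕ.≤ q → q ℕ.≤ X → 𝟙 (prime? q) * (ℓ q * 𝟙 (q ℕₚ.≤? m)) ≤ 𝟙 (q ℕₚ.≤? m) * (3ℚ * ι m)
    bound₂ q 1≤q q≤X = ≤-trans (*-monoˡ (0≤* (0≤ℓ q) (0≤𝟙 (q ℕₚ.≤? m))) (𝟙≤1 (prime? q))) (≤-trans (≤-eq (trans (ℚₚ.*-identityˡ _) (ℚₚ.*-comm (ℓ q) _)))
      (𝟙*-mono (q ℕₚ.≤? m) (λ q≤m → ≤-trans (log≤3n q 1≤q q≤X) (0≤ι 3 ⊙ ι-mono q≤m))))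

  σ-upper : ∀ j → 2 ℕ.^ j ℕ.≤ X → σ j ≤ ι j + 4ℚ
  σ-upper j h = ≤-trans (∑-mono (2 ℕ.^ j) (λ d _ _ → ≤-trans (0≤Λ/ d ⊙ 𝟙≤1 (unit? d)) (≤-eq (ℚₚ.*-identityʳ _)))) (mertens-upper j h)

  σ-lower : ∀ j → 2 ℕ.^ j ℕ.≤ X → m ℕ.≤ X → ι j ≤ σ j + (cm + 3ℚ)
  σ-lower j h m≤X = lin (mertens-lower j h ⊕ non-unit-sum j m≤X) (trans (cong (λ z → σ j + (cm + 3ℚ) + (ι j + z)) split) (r (σ j) cm (ι j) (∑ (2 ℕ.^ j) Λ/)))
    where
    r₀ : ∀ l u → l * (1ℚ - u) ≡ l - l * u
    r₀ = solve-∀ ℚ-ring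
    split : ∑ (2 ℕ.^ j) (λ d → Λ/ d * (1ℚ - 𝟙 (unit? d))) ≡ ∑ (2 ℕ.^ j) Λ/ - σ j
    split = trans (∑-cong' (2 ℕ.^ j) (λ d → r₀ (Λ/ d) (𝟙 (unit? d)))) (∑-- (2 ℕ.^ j) _ _)
    r : ∀ s c t M → s + (c + 3ℚ) + (t + (M - s)) ≡ t + (M + 3ℚ + c)
    r = solve-∀ ℚ-ring

  -- Only proper prime powers are left. The sum of q^(-k) over k ≥ 2 is at most 2/q² ≤ 4/(q (q +
  -- 1)), and ∑ log q/(q (q + 1)) ≤ 3.
  S-small : ∀ j c → (∀ p → Prime p → ¬ p ≋ c) → S j c ≤ 12ℚ
  S-small j c no-prime = ≤-trans (prime-power-sum j (λ q → 4ℚ * (inv q * inv (suc q))) (cls c) bound)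
    (≤-trans (∑-mono X (λ q _ _ → ≤-trans (*-monoˡ (0≤* (0≤ℓ q) (0≤* (0≤ι 4) (0≤* (0≤inv q) (0≤inv (suc q))))) (𝟙≤1 (prime? q))) (≤-eq (r₀ (ℓ q) (inv q * inv (suc q))))))
      (≤-trans (≤-eq (∑-*ˡ X 4ℚ _)) (0≤ι 4 ⊙ ∑-log/n² X ℕₚ.≤-refl)))
    where
    r₀ : ∀ l a → 1ℚ * (l * (4ℚ * a)) ≡ 4ℚ * (l * a)
    r₀ = solve-∀ ℚ-ring
    bound : ∀ q → Prime q → q ℕ.≤ X → ∑ X (λ k → 𝟙 (q ℕ.^ k ℕₚ.≤? 2 ℕ.^ j) * (inv (q ℕ.^ k) * cls c (q ℕ.^ k))) ≤ 4ℚ * (inv q * inv (suc q))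
    bound q pq _ = ≤-trans (∑-mono X term) (≤-trans (tail X 1≤X) (≤-trans (0≤inv q ⊙ geometric-sum (ℕ.pred X) (prime≥2 pq)) half))
      where
      term : ∀ k → 1 ℕ.≤ k → k ℕ.≤ X → 𝟙 (q ℕ.^ k ℕₚ.≤? 2 ℕ.^ j) * (inv (q ℕ.^ k) * cls c (q ℕ.^ k)) ≤ 𝟙 (2 ℕₚ.≤? k) * inv (q ℕ.^ k)
      term (suc zero) _ _ = ≤-eq (trans (cong (λ z → 𝟙 (q ℕ.^ 1 ℕₚ.≤? 2 ℕ.^ j) * (inv (q ℕ.^ 1) * z)) (𝟙-no (q ℕ.^ 1 ≋? c) (λ e → no-prime q pq (trans (cong (DM._% m) (sym (ℕₚ.*-identityʳ q))) e)))) (r₁ (𝟙 (q ℕ.^ 1 ℕₚ.≤? 2 ℕ.^ j)) (inv (q ℕ.^ 1))))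
        where
        r₁ : ∀ a b → a * (b * 0ℚ) ≡ 0ℚ * b
        r₁ = solve-∀ ℚ-ring
      term k@(suc (suc k')) _ _ = *-mono (0≤𝟙 (q ℕ.^ k ℕₚ.≤? 2 ℕ.^ j)) (0≤inv (q ℕ.^ k)) (𝟙≤1 (q ℕ.^ k ℕₚ.≤? 2 ℕ.^ j)) (≤-trans (0≤inv (q ℕ.^ k) ⊙ 𝟙≤1 (q ℕ.^ k ≋? c)) (≤-eq (ℚₚ.*-identityʳ _)))
      tail : ∀ n → 1 ℕ.≤ n → ∑ n (λ k → 𝟙 (2 ℕₚ.≤? k) * inv (q ℕ.^ k)) ≤ inv q * ∑ (ℕ.pred n) (λ k → inv (q ℕ.^ k))
      tail (suc zero) _ = ≤-eq (r₂ (inv (q ℕ.^ 1)) (inv q))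
        where
        r₂ : ∀ a b → 0ℚ + 0ℚ * a ≡ b * 0ℚ
        r₂ = solve-∀ ℚ-ring
      tail (suc (suc n)) _ = ≤-trans (tail (suc n) (s≤s z≤n) ⊕ ≤-eq (trans (ℚₚ.*-identityˡ _) (inv-* q (q ℕ.^ suc n)))) (≤-eq (sym (ℚₚ.*-distribˡ-+ (inv q) _ _)))
      half : inv q * (2ℚ * inv q) ≤ 4ℚ * (inv q * inv (suc q))
      half = subst₂ _≤_ (r₃ (inv q)) (r₄ (inv q) (inv (suc q))) (0≤* (0≤ι 2) (0≤inv q) ⊙ inv≤2inv)
        where
        r₃ : ∀ a → 2ℚ * a * a ≡ a * (2ℚ * a)
        r₃ = solve-∀ ℚ-ring
        r₄ : ∀ a b → 2ℚ * a * (2ℚ * b) ≡ 4ℚ * (a * b)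
        r₄ = solve-∀ ℚ-ring
        1≤q = prime≥1 pq
        inv≤2inv : inv q ≤ 2ℚ * inv (suc q)
        inv≤2inv = *-cancelˡ-ι {suc q} (s≤s z≤n) (≤-trans (*-monoˡ (0≤inv q) (ℚₚ.+-monoˡ-≤ (ι q) (ι-mono 1≤q)))
          (≤-eq (trans (r₅ (ι q) (inv q)) (trans (cong (2ℚ *_) (trans (ι*inv 1≤q) (sym (ι*inv {suc q} (s≤s z≤n))))) (r₆ (ι (suc q)) (inv (suc q)))))))
          where
          r₅ : ∀ a b → (a + a) * b ≡ 2ℚ * (a * b)
          r₅ = solve-∀ ℚ-ring
          r₆ : ∀ a b → 2ℚ * (a * b) ≡ a * (2ℚ * b)
          r₆ = solve-∀ ℚ-ring

-- Real characters from approximate ones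

½≰0 : ¬ (½ ≤ 0ℚ)
½≰0 (*≤* (ℤ.+≤+ ()))

IsSign : ℚ → Set
IsSign s = s ≡ 1ℚ ⊎ s ≡ - 1ℚ

-- Zero gets the sign 1, so that every value is a sign.
sg : ℚ → ℚ
sg x with 0ℚ ℚₚ.≤? x
... | yes _ = 1ℚ
... | no _  = - 1ℚ

sg-sign : ∀ x → IsSign (sg x)
sg-sign x with 0ℚ ℚₚ.≤? x
... | yes _ = inj₁ refl
... | no _  = inj₂ refl

neg-one : ∀ x → - 1ℚ * x ≡ - x
neg-one = solve-∀ ℚ-ring

sg*∣∣ : ∀ x → sg x * x ≡ ∣ x ∣
sg*∣∣ x with 0ℚ ℚₚ.≤? x
... | yes h = trans (ℚₚ.*-identityˡ x) (sym (∣∣≥0 h))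
... | no ¬h = trans (neg-one x) (trans (sym (∣∣≥0 (ℚₚ.neg-antimono-≤ (ℚₚ.<⇒≤ (ℚₚ.≰⇒> ¬h))))) (ℚₚ.∣-p∣≡∣p∣ x))

sg-pos : ∀ {x} → 0ℚ ≤ x → sg x ≡ 1ℚ
sg-pos {x} h with 0ℚ ℚₚ.≤? x
... | yes _ = refl
... | no ¬h = contradiction h ¬h

∣sign*∣ : ∀ {s} x → IsSign s → ∣ s * x ∣ ≡ ∣ x ∣
∣sign*∣ x (inj₁ refl) = cong ∣_∣ (ℚₚ.*-identityˡ x)
∣sign*∣ x (inj₂ refl) = trans (cong ∣_∣ (neg-one x)) (ℚₚ.∣-p∣≡∣p∣ x)

∣value∣≤1 : ∀ {x} → x ≡ 0ℚ ⊎ IsSign x → ∣ x ∣ ≤ 1ℚ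
∣value∣≤1 (inj₁ refl)        = 0≤1
∣value∣≤1 (inj₂ (inj₁ refl)) = ≤-refl
∣value∣≤1 (inj₂ (inj₂ refl)) = ≤-refl

sign² : ∀ {s} → IsSign s → s * s ≡ 1ℚ
sign² (inj₁ refl) = refl
sign² (inj₂ refl) = refl

-- The product s · sg x · sg y is a sign, and the value -1 would make s x y non-positive.
sign-pos : ∀ {s x y} → IsSign s → ½ ≤ s * (x * y) → s ≡ sg x * sg y
sign-pos {s} {x} {y} is h = unique is (sg-sign x) (sg-sign y)
  (subst (½ ≤_) (expand s x y) h)
  where
  expand : ∀ s x y → s * (x * y) ≡ (s * (sg x * sg y)) * (∣ x ∣ * ∣ y ∣)
  expand s x y = trans (r₁ s x y) (trans (cong₂ (λ a b → s * (a * x * (b * y))) (sym (sign² (sg-sign x))) (sym (sign² (sg-sign y))))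
    (trans (r₂ s (sg x) (sg y) x y) (cong₂ (λ a b → s * (sg x * sg y) * (a * b)) (sg*∣∣ x) (sg*∣∣ y))))
    where
    r₁ : ∀ s x y → s * (x * y) ≡ s * (1ℚ * x * (1ℚ * y))
    r₁ = solve-∀ ℚ-ring
    r₂ : ∀ s a b x y → s * (a * a * x * (b * b * y)) ≡ s * (a * b) * (a * x * (b * y))
    r₂ = solve-∀ ℚ-ring
  0≤xy : 0ℚ ≤ ∣ x ∣ * ∣ y ∣
  0≤xy = 0≤* (ℚₚ.0≤∣p∣ x) (ℚₚ.0≤∣p∣ y)
  bad : ¬ (½ ≤ - 1ℚ * (∣ x ∣ * ∣ y ∣))
  bad h' = ½≰0 (lin (h' ⊕ 0≤xy) (r ½ (∣ x ∣ * ∣ y ∣)))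
    where
    r : ∀ a z → 0ℚ + (a + 0ℚ) ≡ a + (- 1ℚ * z + z)
    r = solve-∀ ℚ-ring
  unique : ∀ {s a b} → IsSign s → IsSign a → IsSign b → ½ ≤ s * (a * b) * (∣ x ∣ * ∣ y ∣) → s ≡ a * b
  unique (inj₁ refl) (inj₁ refl) (inj₁ refl) _ = refl
  unique (inj₁ refl) (inj₁ refl) (inj₂ refl) h' = contradiction h' bad
  unique (inj₁ refl) (inj₂ refl) (inj₁ refl) h' = contradiction h' bad
  unique (inj₁ refl) (inj₂ refl) (inj₂ refl) _ = refl
  unique (inj₂ refl) (inj₁ refl) (inj₁ refl) h' = contradiction h' bad
  unique (inj₂ refl) (inj₁ refl) (inj₂ refl) _ = refl
  unique (inj₂ refl) (inj₂ refl) (inj₁ refl) _ = refl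
  unique (inj₂ refl) (inj₂ refl) (inj₂ refl) h' = contradiction h' bad

-- An approximate solution P' of P * P' = φ P' with values in [-1, 1] that reaches 1 is approximately a character:
-- the terms of the convolution are forced to agree in sign.
module ApproximateCharacter (m : ℕ) {{m≢0 : ℕ.NonZero m}} where
  open Residues m

  1≤φ : 1ℚ ≤ φ
  1≤φ = ≤-trans (≤-eq (sym (trans (ℚₚ.*-identityʳ _) (𝟙-yes (unit? (rep 1)) (λ {i} → unit-resp-≋ (sym (rep-≋ 1)) unit-1 {i})))))
    (≤-∑ m (rep 1) (1≤rep 1) (rep≤m 1) (λ i _ _ → 0≤* (0≤𝟙 (unit? i)) 0≤1))

  0≤φ : 0ℚ ≤ φ
  0≤φ = ≤-trans 0≤1 1≤φ

  module Signs (P P' : ℕ → ℚ) (ε : ℚ) (c : ℕ) (uc : Unit c)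
    (P-resp : ∀ {a b} → a ≋ b → P a ≡ P b) (P'-resp : ∀ {a b} → a ≋ b → P' a ≡ P' b)
    (0≤ε : 0ℚ ≤ ε) (small : ε * (32ℚ * (φ * φ)) ≤ 1ℚ)
    (∣P∣ : ∀ h → Unit h → ∣ P h ∣ ≤ 1ℚ + ε) (∣P'∣ : ∀ h → Unit h → ∣ P' h ∣ ≤ 1ℚ + ε)
    (eigen : ∀ g → Unit g → ∣ ∑ᵤ (λ h → P h * P' (hinv h ℕ.* g)) - φ * P' g ∣ ≤ ε)
    (P-c : 1ℚ - ε ≤ P c) (P'-c : 1ℚ - ε ≤ P' c) where

    φε≤ : ε * φ ≤ ε * (φ * φ)
    φε≤ = 0≤ε ⊙ subst (_≤ φ * φ) (ℚₚ.*-identityʳ φ) (0≤φ ⊙ 1≤φ)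

    ε≤ : ε ≤ ε * φ
    ε≤ = subst (_≤ ε * φ) (ℚₚ.*-identityʳ ε) (0≤ε ⊙ 1≤φ)

    ε≤1 : ε ≤ 1ℚ
    ε≤1 = lin (small ⊕ ε≤ ⊕ φε≤ ⊕ 0≤* (0≤ι 31) (0≤* 0≤ε (0≤* 0≤φ 0≤φ))) (r ε φ)
      where
      r : ∀ e f → 1ℚ + (e * (32ℚ * (f * f)) + (e + (e * f + 0ℚ))) ≡ e + (1ℚ + (e * f + (e * (f * f) + ι 31 * (e * (f * f)))))
      r = solve-∀ ℚ-ring

    convolve : ℕ → ℕ → ℚ
    convolve g h = P h * P' (hinv h ℕ.* g)

    -- No term of the convolution exceeds 1 + 3 ε, and the sum of the φ terms is within ε of φ
    -- P'(g). If s P'(g) is near 1, the whole sum falls short of its maximum by at most φ (1 + 3 ε -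
    -- a) + ε, and so does each single term.
    term-rep : ∀ {s a} i g → 1 ℕ.≤ i → i ℕ.≤ m → Unit i → Unit g → IsSign s → a ≤ s * P' g →
      1ℚ + 2ℚ * ε - φ * (1ℚ + 3ℚ * ε - a) ≤ s * convolve g i
    term-rep {s} {a} i g 1≤i i≤m ui ug is h = lin (one ⊕ approx ⊕ 0≤φ ⊙ h)
      (trans (r (F i) ε φ a s (∑ᵤ (convolve g)) (P' g))
        (cong (λ z → 1ℚ + 2ℚ * ε - φ * (1ℚ + 3ℚ * ε - a) + (z + (ε + φ * (s * P' g)))) (sym total)))
      where
      b = 1ℚ + 3ℚ * ε
      F : ℕ → ℚ
      F h = s * convolve g h
      bnd : ∀ h → Unit h → 0ℚ ≤ b - F h
      bnd h uh = lin (≤-trans (p≤∣p∣ (F h)) (≤-trans (≤-eq (∣sign*∣ (convolve g h) is)) (∣*∣≤ {P h} (∣P∣ h uh) (∣P'∣ (hinv h ℕ.* g) (hinv-unit g uh ug)))) ⊕ 0≤ε ⊙ ε≤1)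
        (r₀ (F h) ε)
        where
        r₀ : ∀ f e → 1ℚ + 3ℚ * e - f + (f + e * e) ≡ 0ℚ + ((1ℚ + e) * (1ℚ + e) + e * 1ℚ)
        r₀ = solve-∀ ℚ-ring
      one : b - F i ≤ ∑ᵤ (λ h → b - F h)
      one = ≤-trans (≤-eq (sym (𝟙*-yes (unit? i) (λ {d} → ui {d})))) (≤-∑ m i 1≤i i≤m (λ j _ _ → subst (_≤ 𝟙 (unit? j) * (b - F j)) (ℚₚ.*-zeroʳ (𝟙 (unit? j))) (𝟙*-mono (unit? j) (λ uj → bnd j uj))))
      total : ∑ᵤ (λ h → b - F h) ≡ φ * b - s * ∑ᵤ (convolve g)
      total = trans (∑-cong' m (λ j → ℚₚ.*-distribˡ-+ (𝟙 (unit? j)) b (- F j))) (trans (∑-+ m _ _) (cong₂ _+_ (∑ᵤ-const b)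
        (trans (∑-cong' m (λ j → sym (ℚₚ.neg-distribʳ-* (𝟙 (unit? j)) (F j)))) (trans (∑-neg m _) (cong -_ (∑ᵤ-*ˡ s (convolve g)))))))
      approx : - (s * ∑ᵤ (convolve g) - s * (φ * P' g)) ≤ ε
      approx = ≤-trans (-p≤∣p∣ _) (≤-trans (≤-eq (trans (cong ∣_∣ (r₁ s _ _)) (∣sign*∣ _ is))) (eigen g ug))
        where
        r₁ : ∀ s a b → s * a - s * b ≡ s * (a - b)
        r₁ = solve-∀ ℚ-ring
      r : ∀ F e f a s C p → F + (1ℚ + 3ℚ * e - F + (- (s * C - s * (f * p)) + f * a)) ≡ 1ℚ + 2ℚ * e - f * (1ℚ + 3ℚ * e - a) + (f * (1ℚ + 3ℚ * e) - s * C + (e + f * (s * p)))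
      r = solve-∀ ℚ-ring

    term : ∀ {s a} h k → Unit h → Unit k → IsSign s → a ≤ s * P' (h ℕ.* k) → 1ℚ + 2ℚ * ε - φ * (1ℚ + 3ℚ * ε - a) ≤ s * (P h * P' k)
    term {s} {a} h k uh uk is le = subst (1ℚ + 2ℚ * ε - φ * (1ℚ + 3ℚ * ε - a) ≤_) (cong₂ (λ x y → s * (x * y)) (P-resp (rep-≋ h)) (P'-resp e))
      (term-rep (rep h) (rep h ℕ.* k) (1≤rep h) (rep≤m h) ui (unit-* {rep h} ui uk) is (subst (λ z → a ≤ s * z) (P'-resp (*-cong-≋ (sym (rep-≋ h)) refl)) le))
      where
      ui : Unit (rep h)
      ui = unit-resp-≋ (sym (rep-≋ h)) uh
      e : hinv (rep h) ℕ.* (rep h ℕ.* k) ≋ k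
      e = *-cancelˡ-≋ (rep h) ui (hinv-* (rep h ℕ.* k) ui)

    at-c : ∀ h k → Unit h → Unit k → h ℕ.* k ≋ c → 1ℚ - 4ℚ * (ε * φ) ≤ P h * P' k
    at-c h k uh uk e = ≤-trans (lin (0≤ε ⊕ 0≤ε) (r ε φ)) (subst (1ℚ + 2ℚ * ε - φ * (1ℚ + 3ℚ * ε - (1ℚ - ε)) ≤_) (ℚₚ.*-identityˡ _)
      (term h k uh uk (inj₁ refl) (subst (1ℚ - ε ≤_) (trans (P'-resp (sym e)) (sym (ℚₚ.*-identityˡ _))) P'-c)))
      where
      r : ∀ e f → 1ℚ + 2ℚ * e - f * (1ℚ + 3ℚ * e - (1ℚ - e)) + (0ℚ + 0ℚ) ≡ 1ℚ - 4ℚ * (e * f) + (e + e)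
      r = solve-∀ ℚ-ring

    -- As neither factor can exceed 1 + ε, a product near 1 leaves no room for a small factor.
    large-factor : ∀ {x y} → ∣ x ∣ ≤ 1ℚ + ε → ∣ y ∣ ≤ 1ℚ + ε → 1ℚ - 4ℚ * (ε * φ) ≤ x * y → 1ℚ - 6ℚ * (ε * φ) ≤ ∣ x ∣
    large-factor {x} {y} hx hy h = lin (≤-trans h (≤-trans (p≤∣p∣ (x * y)) (∣*∣≤ {x} (≤-refl {∣ x ∣}) hy)) ⊕ 0≤ε ⊙ hx ⊕ 0≤ε ⊙ ε≤1 ⊕ 0≤ι 2 ⊙ ε≤)
      (r ∣ x ∣ ε φ)
      where
      r : ∀ x e f → x + (1ℚ - 4ℚ * (e * f) + (e * x + (e * e + 2ℚ * e))) ≡ 1ℚ - 6ℚ * (e * f) + (x * (1ℚ + e) + (e * (1ℚ + e) + (e * 1ℚ + 2ℚ * (e * f))))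
      r = solve-∀ ℚ-ring

    P'-large : ∀ k → Unit k → 1ℚ - 6ℚ * (ε * φ) ≤ ∣ P' k ∣
    P'-large k uk = large-factor {P' k} {P h} (∣P'∣ k uk) (∣P∣ h uh) (subst (1ℚ - 4ℚ * (ε * φ) ≤_) (ℚₚ.*-comm (P h) (P' k))
        (at-c h k uh uk (trans (cong (DM._% m) (ℕₚ.*-comm h k)) (hinv-* c uk))))
      where
      h = hinv k ℕ.* c
      uh : Unit h
      uh = hinv-unit c uk uc

    P'-half : ∀ k → Unit k → ½ ≤ ∣ P' k ∣
    P'-half k uk = ≤-trans (lin (ℚₚ.nonNegative⁻¹ ½ ⊙ small ⊕ 0≤ι 6 ⊙ φε≤ ⊕ 0≤* (0≤ι 10) (0≤* 0≤ε (0≤* 0≤φ 0≤φ))) (r ε φ)) (P'-large k uk)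
      where
      r : ∀ e f → 1ℚ - 6ℚ * (e * f) + (½ * (e * (32ℚ * (f * f))) + (6ℚ * (e * f) + 0ℚ)) ≡ ½ + (½ * 1ℚ + (6ℚ * (e * (f * f)) + 10ℚ * (e * (f * f))))
      r = solve-∀ ℚ-ring

    -- `term` with the sign of P'(h k) and a = 1 - 6 ε φ: the loss 3 ε φ + 6 ε φ² is below 1/2 since
    -- 32 ε φ² ≤ 1, and `sign-pos` applies.
    sign-* : ∀ h k → Unit h → Unit k → sg (P' (h ℕ.* k)) ≡ sg (P h) * sg (P' k)
    sign-* h k uh uk = sign-pos {sg (P' (h ℕ.* k))} {P h} {P' k} (sg-sign (P' (h ℕ.* k)))
      (≤-trans (lin (ℚₚ.nonNegative⁻¹ ½ ⊙ small ⊕ 0≤ι 3 ⊙ φε≤ ⊕ 0≤* (0≤ι 7) (0≤* 0≤ε (0≤* 0≤φ 0≤φ)) ⊕ 0≤* (0≤ι 2) 0≤ε) (r ε φ))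
        (term h k uh uk (sg-sign (P' (h ℕ.* k))) (≤-trans (P'-large (h ℕ.* k) (unit-* {h} uh uk)) (≤-eq (sym (sg*∣∣ (P' (h ℕ.* k))))))))
      where
      r : ∀ e f → 1ℚ + 2ℚ * e - f * (1ℚ + 3ℚ * e - (1ℚ - 6ℚ * (e * f))) + (½ * (e * (32ℚ * (f * f))) + (3ℚ * (e * f) + (0ℚ + 0ℚ))) ≡ ½ + (½ * 1ℚ + (3ℚ * (e * (f * f)) + (7ℚ * (e * (f * f)) + 2ℚ * e)))
      r = solve-∀ ℚ-ring

    private
      0≤P-c : ∀ {x} → 1ℚ - ε ≤ x → 0ℚ ≤ x
      0≤P-c {x} h = lin (h ⊕ ε≤1) (r x ε)
        where
        r : ∀ x e → x + (1ℚ - e + e) ≡ 0ℚ + (x + 1ℚ)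
        r = solve-∀ ℚ-ring

      -- In sg P'(c) = sg P(c) · sg P'(1) both values at c are non-negative. This fixes the common
      -- sign up to which sg P' would otherwise be a character.
      sgP'-1 : sg (P' 1) ≡ 1ℚ
      sgP'-1 = trans (sym (ℚₚ.*-identityˡ (sg (P' 1)))) (trans (cong (_* sg (P' 1)) (sym (sg-pos (0≤P-c P-c)))) (trans (sym (sign-* c 1 uc unit-1))
        (trans (cong (λ n → sg (P' n)) (ℕₚ.*-identityʳ c)) (sg-pos (0≤P-c P'-c)))))

      sgP≡sgP' : ∀ h → Unit h → sg (P h) ≡ sg (P' h)
      sgP≡sgP' h uh = trans (sym (ℚₚ.*-identityʳ (sg (P h)))) (trans (cong (sg (P h) *_) (sym sgP'-1)) (trans (sym (sign-* h 1 uh unit-1)) (cong (λ n → sg (P' n)) (ℕₚ.*-identityʳ h))))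

    χ : ℕ → ℚ
    χ n = 𝟙 (unit? n) * sg (P' n)

    χ-unit : ∀ {n} → Unit n → χ n ≡ sg (P' n)
    χ-unit {n} u = 𝟙*-yes (unit? n) (λ {d} → u {d})

    χ-non-unit : ∀ {n} → ¬ Unit n → χ n ≡ 0ℚ
    χ-non-unit {n} ¬u = 𝟙*-no (unit? n) ¬u

    χ-1 : χ 1 ≡ 1ℚ
    χ-1 = trans (χ-unit unit-1) sgP'-1

    χ-* : ∀ a b → χ (a ℕ.* b) ≡ χ a * χ b
    χ-* a b = by-cases (unit? a) (unit? b)
      where
      by-cases : Dec (Unit a) → Dec (Unit b) → χ (a ℕ.* b) ≡ χ a * χ b
      by-cases (yes u) (yes v) = trans (χ-unit (unit-* {a} u v)) (trans (sign-* a b u v) (cong₂ _*_ (trans (sgP≡sgP' a u) (sym (χ-unit u))) (sym (χ-unit v))))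
      by-cases (no ¬u) _       = trans (χ-non-unit (λ w → ¬u (λ {i} → unit-*ˡ {a} {b} w {i}))) (sym (trans (cong (_* χ b) (χ-non-unit ¬u)) (ℚₚ.*-zeroˡ (χ b))))
      by-cases (yes _) (no ¬v) = trans (χ-non-unit (λ w → ¬v (λ {i} → unit-*ʳ {a} {b} w {i}))) (sym (trans (cong (χ a *_) (χ-non-unit ¬v)) (ℚₚ.*-zeroʳ (χ a))))

    χ-values : ∀ n → χ n ≡ 0ℚ ⊎ IsSign (χ n)
    χ-values n with unit? n
    ... | no _  = inj₁ (ℚₚ.*-zeroˡ (sg (P' n)))
    ... | yes _ = inj₂ (subst IsSign (sym (ℚₚ.*-identityˡ (sg (P' n)))) (sg-sign (P' n)))

    χ-resp : ∀ {a b} → a ≋ b → χ a ≡ χ b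
    χ-resp {a} {b} e = cong₂ _*_ (𝟙-⇔ (unit? a) (unit? b) (λ u {i} → unit-resp-≋ e u {i}) (λ u {i} → unit-resp-≋ (sym e) u {i})) (cong sg (P'-resp e))

    private
      sum-of-values : ∀ n → ∃[ a ] ∃[ b ] ∑ n χ ≡ ι a - ι b
      sum-of-values zero = 0 , 0 , refl
      sum-of-values (suc n) with sum-of-values n | χ-values (suc n)
      ... | a , b , e | inj₁ z        = a , b , trans (cong₂ _+_ e z) (ℚₚ.+-identityʳ _)
      ... | a , b , e | inj₂ (inj₁ z) = suc a , b , trans (cong₂ _+_ e z) (r (ι a) (ι b))
        where
        r : ∀ a b → a - b + 1ℚ ≡ 1ℚ + a - b
        r = solve-∀ ℚ-ring
      ... | a , b , e | inj₂ (inj₂ z) = a , suc b , trans (cong₂ _+_ e z) (r (ι a) (ι b))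
        where
        r : ∀ a b → a - b + - 1ℚ ≡ a - (1ℚ + b)
        r = solve-∀ ℚ-ring

      integer-gap : ∀ a b → ∣ ι a - ι b ∣ ≤ ½ → ι a - ι b ≡ 0ℚ
      integer-gap zero    zero    _ = refl
      integer-gap zero    (suc b) h = contradiction (lin (≤-trans (-p≤∣p∣ (0ℚ - (1ℚ + ι b))) h ⊕ 0≤ι b) (r ½ (ι b))) ½≰0
        where
        r : ∀ h b → 0ℚ + (- (0ℚ - (1ℚ + b)) + 0ℚ) ≡ (1ℚ - h) + (h + b)
        r = solve-∀ ℚ-ring
      integer-gap (suc a) zero    h = contradiction (lin (≤-trans (p≤∣p∣ (1ℚ + ι a - 0ℚ)) h ⊕ 0≤ι a) (r ½ (ι a))) ½≰0
        where
        r : ∀ h a → 0ℚ + (1ℚ + a - 0ℚ + 0ℚ) ≡ (1ℚ - h) + (h + a)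
        r = solve-∀ ℚ-ring
      integer-gap (suc a) (suc b) h = trans (r (ι a) (ι b)) (integer-gap a b (subst (λ z → ∣ z ∣ ≤ ½) (r (ι a) (ι b)) h))
        where
        r : ∀ a b → 1ℚ + a - (1ℚ + b) ≡ a - b
        r = solve-∀ ℚ-ring

      near-sign : ∀ h → Unit h → ∣ P' h - sg (P' h) ∣ ≤ 6ℚ * (ε * φ)
      near-sign h uh = subst (_≤ 6ℚ * (ε * φ)) (trans (cong ∣_∣ (sym eq)) (∣sign*∣ (P' h - sg (P' h)) (sg-sign (P' h))))
        (∣∣≤ (lin (∣P'∣ h uh ⊕ ε≤ ⊕ 0≤* (0≤ι 5) (0≤* 0≤ε 0≤φ)) (r₁ ∣ P' h ∣ ε φ)) (lin (P'-large h uh) (r₂ ∣ P' h ∣ ε φ)))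
        where
        eq : sg (P' h) * (P' h - sg (P' h)) ≡ ∣ P' h ∣ - 1ℚ
        eq = trans (r₀ (sg (P' h)) (P' h)) (cong₂ _-_ (sg*∣∣ (P' h)) (sign² (sg-sign (P' h))))
          where
          r₀ : ∀ s p → s * (p - s) ≡ s * p - s * s
          r₀ = solve-∀ ℚ-ring
        r₁ : ∀ p e f → 6ℚ * (e * f) + (p + (e + 0ℚ)) ≡ p - 1ℚ + ((1ℚ + e) + (e * f + 5ℚ * (e * f)))
        r₁ = solve-∀ ℚ-ring
        r₂ : ∀ p e f → 6ℚ * (e * f) + (1ℚ - 6ℚ * (e * f)) ≡ - (p - 1ℚ) + p
        r₂ = solve-∀ ℚ-ring

    -- P' is within 6 ε φ of its sign, so the sum of the signs is an integer of absolute value at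
    -- most ε + 6 ε φ² ≤ 1/2. Hence χ is not principal.
    ∑χ≡0 : ∣ ∑ᵤ P' ∣ ≤ ε → ∑ᵤ (λ h → sg (P' h)) ≡ 0ℚ
    ∑χ≡0 h with sum-of-values m
    ... | a , b , e = trans e (integer-gap a b (subst (λ z → ∣ z ∣ ≤ ½) e (≤-trans (≤-eq (cong ∣_∣ split)) (≤-trans (∣-∣≤ {∑ᵤ P'} h diff) bound))))
      where
      D : ℕ → ℚ
      D h = P' h - sg (P' h)
      r : ∀ a b → a ≡ b - (b - a)
      r = solve-∀ ℚ-ring
      r' : ∀ a b c → a * b - a * c ≡ a * (b - c)
      r' = solve-∀ ℚ-ring
      split : ∑ m χ ≡ ∑ᵤ P' - ∑ᵤ D
      split = trans (r (∑ m χ) (∑ᵤ P')) (cong (λ z → ∑ᵤ P' - z) (trans (sym (∑-- m _ _)) (∑-cong' m (λ j → r' (𝟙 (unit? j)) (P' j) (sg (P' j))))))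
      diff : ∣ ∑ᵤ D ∣ ≤ φ * (6ℚ * (ε * φ))
      diff = ≤-trans (∑-abs-mono m (λ j _ _ → subst (_≤ 𝟙 (unit? j) * (6ℚ * (ε * φ))) (sym (trans (ℚₚ.∣p*q∣≡∣p∣*∣q∣ (𝟙 (unit? j)) (D j)) (cong (_* ∣ D j ∣) (∣∣≥0 (0≤𝟙 (unit? j)))))) (𝟙*-mono (unit? j) (λ uj → near-sign j uj))))
        (≤-eq (∑ᵤ-const (6ℚ * (ε * φ))))
      bound : ε + φ * (6ℚ * (ε * φ)) ≤ ½
      bound = lin (ℚₚ.nonNegative⁻¹ ½ ⊙ small ⊕ ε≤ ⊕ φε≤ ⊕ 0≤* (0≤ι 9) (0≤* 0≤ε (0≤* 0≤φ 0≤φ))) (r₁ ε φ)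
        where
        r₁ : ∀ e f → ½ + (½ * (e * (32ℚ * (f * f))) + (e + (e * f + 0ℚ))) ≡ e + f * (6ℚ * (e * f)) + (½ * 1ℚ + (e * f + (e * (f * f) + 9ℚ * (e * (f * f)))))
        r₁ = solve-∀ ℚ-ring

    -- Because χ sums to 0, χ(n) is the sum over i of χ(i) times `cls-diff i 1 n`, a combination of
    -- m sequences handled by `Osc-cls-diff`.
    Osc-χ : ∣ ∑ᵤ P' ∣ ≤ ε → Osc (ι m) χ
    Osc-χ h = subst (λ M → Osc M χ) (ℚₚ.*-identityʳ (ι m)) (Osc-cong expand (Osc-∑ m χ (λ i n → 𝟙 (unit? i) * cls-diff i 1 n) (λ i _ _ → ∣value∣≤1 (χ-values i) , osc i)))
      where
      osc : ∀ i → Osc 1ℚ (λ n → 𝟙 (unit? i) * cls-diff i 1 n)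
      osc i with unit? i
      ... | yes u = Osc-cong {1ℚ} {cls-diff i 1} (λ n → sym (ℚₚ.*-identityˡ _)) (Osc-cls-diff u unit-1)
      ... | no _  = λ d n _ → subst (λ s → ∣ s ∣ ≤ 1ℚ) (sym (∑-≡0 n (λ k _ _ → ℚₚ.*-zeroˡ (cls-diff i 1 (d ℕ.* k))))) 0≤1
      r : ∀ u s a b → u * s * (u * (a - b)) ≡ u * (a * (u * s)) - u * (u * s) * b
      r = solve-∀ ℚ-ring
      𝟙² : ∀ i → 𝟙 (unit? i) * (𝟙 (unit? i) * sg (P' i)) ≡ 𝟙 (unit? i) * sg (P' i)
      𝟙² i with unit? i
      ... | yes _ = ℚₚ.*-identityˡ _
      ... | no _  = r₀ (sg (P' i))
        where
        r₀ : ∀ s → 0ℚ * (0ℚ * s) ≡ 0ℚ * s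
        r₀ = solve-∀ ℚ-ring
      𝟙χ : ∀ n → 𝟙 (unit? n) * χ n ≡ χ n
      𝟙χ = 𝟙²
      expand : ∀ n → ∑ m (λ i → χ i * (𝟙 (unit? i) * cls-diff i 1 n)) ≡ χ n
      expand n = trans (∑-cong' m (λ i → r (𝟙 (unit? i)) (sg (P' i)) (cls i n) (cls 1 n))) (trans (∑-- m _ _) (trans (cong₂ _-_
        (trans (∑ᵤ-cls n χ χ-resp) (𝟙χ n))
        (trans (∑-*ʳ m (cls 1 n) _) (trans (cong (_* cls 1 n) (trans (∑-cong' m 𝟙²) (∑χ≡0 h))) (ℚₚ.*-zeroˡ (cls 1 n))))) (r₁ (χ n))))
        where
        r₁ : ∀ a → a - 0ℚ ≡ a
        r₁ = solve-∀ ℚ-ring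

-- Non-vanishing of L(1, χ) for real χ

p-part : ∀ {p} fuel n → Prime p → 1 ℕ.≤ n → n ℕ.≤ fuel → ∃[ a ] ∃[ k ] (n ≡ p ℕ.^ a ℕ.* k × ¬ p ∣ k × 1 ℕ.≤ k)
p-part zero n pp 1≤n n≤0 = contradiction (ℕₚ.≤-trans 1≤n n≤0) λ ()
p-part {p} (suc fuel) n pp 1≤n n≤f with p ∣? n
... | no ¬h = 0 , n , sym (ℕₚ.*-identityˡ n) , ¬h , 1≤n
... | yes (divides q eq) with p-part fuel q pp 1≤q (ℕₚ.≤-pred (ℕₚ.≤-trans q<n n≤f))
  where
  1≤q : 1 ℕ.≤ q
  1≤q = ℕₚ.n≢0⇒n>0 λ { refl → contradiction (subst (1 ℕ.≤_) eq 1≤n) λ () }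
  q<n : q ℕ.< n
  q<n = subst (q ℕ.<_) (sym eq) (ℕₚ.m<m*n q p {{ℕ.>-nonZero 1≤q}} (prime≥2 pp))
...   | a , k , e , ¬p∣k , 1≤k = suc a , k , trans eq (trans (cong (ℕ._* p) e) (r (p ℕ.^ a) k p)) , ¬p∣k , 1≤k
  where
  r : ∀ x k p → x ℕ.* k ℕ.* p ≡ p ℕ.* x ℕ.* k
  r = ℕ-Solver.solve-∀

module RealCharacter (χ : ℕ → ℚ) (χ-* : ∀ a b → χ (a ℕ.* b) ≡ χ a * χ b) (χ-1 : χ 1 ≡ 1ℚ) (χ-values : ∀ n → χ n ≡ 0ℚ ⊎ IsSign (χ n)) where

  module DivisorSum (Y : ℕ) where

    r : ℕ → ℚ
    r n = ∑ Y (λ d → 𝟙 (d ∣? n) * χ d)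

    r-1 : 1 ℕ.≤ Y → r 1 ≡ 1ℚ
    r-1 1≤Y = trans (∑-pick Y 1 (s≤s z≤n) 1≤Y (λ i _ _ i≢1 → 𝟙*-no (i ∣? 1) (i≢1 ∘ ∣ₚ.∣1⇒≡1))) (trans (𝟙*-yes (1 ∣? 1) (∣ₚ.1∣ 1)) χ-1)

    -- The divisors not divisible by p are the divisors of k, and the others are p d, where χ(p)
    -- factors out.
    r-p : ∀ {p k} a → Prime p → ¬ p ∣ k → 1 ℕ.≤ k → p ℕ.^ suc a ℕ.* k ℕ.≤ Y → r (p ℕ.^ suc a ℕ.* k) ≡ r k + χ p * r (p ℕ.^ a ℕ.* k)
    r-p {p} {k} a pp ¬p∣k 1≤k ≤Y = trans (cong r (ℕₚ.*-assoc p (p ℕ.^ a) k)) (trans (∑-divisors-*p Y χ pp (ℕₚ.*-mono-≤ (1≤^ a (prime≥1 pp)) 1≤k) (subst (ℕ._≤ Y) (ℕₚ.*-assoc p (p ℕ.^ a) k) ≤Y))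
      (cong₂ _+_ (∑-cong' Y away) (trans (∑-cong' Y (λ d → trans (cong (𝟙 (d ∣? p ℕ.^ a ℕ.* k) *_) (χ-* p d)) (s (𝟙 (d ∣? p ℕ.^ a ℕ.* k)) (χ p) (χ d)))) (∑-*ˡ Y (χ p) _))))
      where
      s : ∀ a b c → a * (b * c) ≡ b * (a * c)
      s = solve-∀ ℚ-ring
      strip : ∀ a {d} → ¬ p ∣ d → d ∣ p ℕ.^ a ℕ.* k → d ∣ k
      strip zero    {d} ¬h h = subst (d ∣_) (ℕₚ.*-identityˡ k) h
      strip (suc a) {d} ¬h h = strip a ¬h (Cop.coprime-divisor (coprime-prime pp ¬h) (subst (d ∣_) (ℕₚ.*-assoc p (p ℕ.^ a) k) h))
      away : ∀ d → 𝟙 (d ∣? p ℕ.^ a ℕ.* k) * (∤𝟙 p d * χ d) ≡ 𝟙 (d ∣? k) * χ d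
      away d with p ∣? d
      ... | no ¬h = cong₂ _*_ (𝟙-⇔ (d ∣? p ℕ.^ a ℕ.* k) (d ∣? k) (strip a ¬h) (∣ₚ.∣n⇒∣m*n (p ℕ.^ a))) (ℚₚ.*-identityˡ (χ d))
      ... | yes h = trans (s₀ (𝟙 (d ∣? p ℕ.^ a ℕ.* k)) (χ d)) (sym (𝟙*-no (d ∣? k) (λ d∣k → ¬p∣k (∣ₚ.∣-trans h d∣k))))
        where
        s₀ : ∀ a c → a * ((1ℚ - 1ℚ) * c) ≡ 0ℚ
        s₀ = solve-∀ ℚ-ring

    ≤Y-pred : ∀ {p k} a → Prime p → p ℕ.^ suc a ℕ.* k ℕ.≤ Y → p ℕ.^ a ℕ.* k ℕ.≤ Y
    ≤Y-pred {p} {k} a pp h = ℕₚ.≤-trans (ℕₚ.*-monoˡ-≤ k (ℕₚ.^-monoʳ-≤ p {{prime⇒nonZero pp}} (ℕₚ.n≤1+n a))) h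

    -- For χ p = -1 the values r (p^a k) alternate between r k and 0.
    r-pow : ∀ {p k} → Prime p → ¬ p ∣ k → 1 ℕ.≤ k → 0ℚ ≤ r k → ∀ b →
      (p ℕ.^ (b ℕ.+ b) ℕ.* k ℕ.≤ Y → r k ≤ r (p ℕ.^ (b ℕ.+ b) ℕ.* k)) × (p ℕ.^ suc (b ℕ.+ b) ℕ.* k ℕ.≤ Y → 0ℚ ≤ r (p ℕ.^ suc (b ℕ.+ b) ℕ.* k)) × (χ p ≡ - 1ℚ → p ℕ.^ (b ℕ.+ b) ℕ.* k ℕ.≤ Y → r (p ℕ.^ (b ℕ.+ b) ℕ.* k) ≡ r k)
    r-pow {p} {k} pp ¬p∣k 1≤k 0≤rk b = even b , odd b , alt b
      where
      step : ∀ a → p ℕ.^ suc a ℕ.* k ℕ.≤ Y → r (p ℕ.^ suc a ℕ.* k) ≡ r k + χ p * r (p ℕ.^ a ℕ.* k)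
      step a = r-p a pp ¬p∣k 1≤k
      alt : ∀ b → χ p ≡ - 1ℚ → p ℕ.^ (b ℕ.+ b) ℕ.* k ℕ.≤ Y → r (p ℕ.^ (b ℕ.+ b) ℕ.* k) ≡ r k
      alt zero    _ _ = cong r (ℕₚ.*-identityˡ k)
      alt (suc b) e h = subst (λ c → r (p ℕ.^ suc c ℕ.* k) ≡ r k) (sym (ℕₚ.+-suc b b))
        (trans (step (suc (b ℕ.+ b)) h') (trans (cong (λ z → r k + χ p * z) (step (b ℕ.+ b) h'')) (trans (cong₂ (λ x y → r k + x * (r k + x * y)) e (alt b e (≤Y-pred (b ℕ.+ b) pp h''))) (s (r k)))))
        where
        h' : p ℕ.^ suc (suc (b ℕ.+ b)) ℕ.* k ℕ.≤ Y
        h' = subst (λ c → p ℕ.^ suc c ℕ.* k ℕ.≤ Y) (ℕₚ.+-suc b b) h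
        h'' = ≤Y-pred (suc (b ℕ.+ b)) pp h'
        s : ∀ a → a + - 1ℚ * (a + - 1ℚ * a) ≡ a
        s = solve-∀ ℚ-ring
      0≤r-plus : ∀ a → χ p ≡ 1ℚ → p ℕ.^ a ℕ.* k ℕ.≤ Y → r k ≤ r (p ℕ.^ a ℕ.* k)
      0≤r-plus zero    _ _ = ≤-eq (cong r (sym (ℕₚ.*-identityˡ k)))
      0≤r-plus (suc a) e h = subst (r k ≤_) (sym (step a h)) (lin (≤-trans 0≤rk (0≤r-plus a e (≤Y-pred a pp h)))
        (trans (cong (λ x → r k + x * r (p ℕ.^ a ℕ.* k) + 0ℚ) e) (s (r k) (r (p ℕ.^ a ℕ.* k)))))
        where
        s : ∀ a b → a + 1ℚ * b + 0ℚ ≡ a + b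
        s = solve-∀ ℚ-ring
      zero-case : ∀ a → χ p ≡ 0ℚ → p ℕ.^ a ℕ.* k ℕ.≤ Y → r (p ℕ.^ a ℕ.* k) ≡ r k
      zero-case zero    _ _ = cong r (ℕₚ.*-identityˡ k)
      zero-case (suc a) e h = trans (step a h) (trans (cong (λ x → r k + x * r (p ℕ.^ a ℕ.* k)) e) (s (r k) (r (p ℕ.^ a ℕ.* k))))
        where
        s : ∀ a b → a + 0ℚ * b ≡ a
        s = solve-∀ ℚ-ring
      even : ∀ b → p ℕ.^ (b ℕ.+ b) ℕ.* k ℕ.≤ Y → r k ≤ r (p ℕ.^ (b ℕ.+ b) ℕ.* k)
      even b h with χ-values p
      ... | inj₁ e        = ≤-eq (sym (zero-case (b ℕ.+ b) e h))
      ... | inj₂ (inj₁ e) = 0≤r-plus (b ℕ.+ b) e h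
      ... | inj₂ (inj₂ e) = ≤-eq (sym (alt b e h))
      odd : ∀ b → p ℕ.^ suc (b ℕ.+ b) ℕ.* k ℕ.≤ Y → 0ℚ ≤ r (p ℕ.^ suc (b ℕ.+ b) ℕ.* k)
      odd b h with χ-values p
      ... | inj₁ e        = ≤-trans 0≤rk (≤-eq (sym (zero-case (suc (b ℕ.+ b)) e h)))
      ... | inj₂ (inj₁ e) = ≤-trans 0≤rk (0≤r-plus (suc (b ℕ.+ b)) e h)
      ... | inj₂ (inj₂ e) = ≤-eq (sym (trans (step (b ℕ.+ b) h) (trans (cong₂ (λ x y → r k + x * y) e (alt b e (≤Y-pred (b ℕ.+ b) pp h))) (s (r k)))))
        where
        s : ∀ a → a + - 1ℚ * a ≡ 0ℚ
        s = solve-∀ ℚ-ring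

    parity : ∀ a → (∃[ b ] a ≡ b ℕ.+ b) ⊎ (∃[ b ] a ≡ suc (b ℕ.+ b))
    parity zero = inj₁ (0 , refl)
    parity (suc a) with parity a
    ... | inj₁ (b , e) = inj₂ (b , cong suc e)
    ... | inj₂ (b , e) = inj₁ (suc b , trans (cong suc e) (cong suc (sym (ℕₚ.+-suc b b))))

    cofactor< : ∀ {p a k} → Prime p → 1 ℕ.≤ k → p ∣ p ℕ.^ a ℕ.* k → ¬ p ∣ k → k ℕ.< p ℕ.^ a ℕ.* k
    cofactor< {p} {zero}  {k} pp 1≤k h ¬h = contradiction (subst (p ∣_) (ℕₚ.*-identityˡ k) h) ¬h
    cofactor< {p} {suc a} {k} pp 1≤k h ¬h = subst (k ℕ.<_) (ℕₚ.*-comm k _) (ℕₚ.m<m*n k (p ℕ.^ suc a) {{ℕ.>-nonZero 1≤k}} (ℕₚ.*-mono-≤ (prime≥2 pp) (1≤^ a (prime≥1 pp))))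

    -- Induction on n: split off the full power of a prime divisor, whose effect on r is given by
    -- `r-pow`; the cofactor k is smaller than n.
    0≤r : ∀ fuel n → 1 ℕ.≤ n → n ℕ.≤ fuel → n ℕ.≤ Y → 0ℚ ≤ r n
    0≤r zero n 1≤n n≤0 _ = contradiction (ℕₚ.≤-trans 1≤n n≤0) λ ()
    0≤r (suc fuel) (suc zero) _ _ n≤Y = ≤-trans 0≤1 (≤-eq (sym (r-1 n≤Y)))
    0≤r (suc fuel) n@(suc (suc _)) 1≤n n≤f n≤Y with prime-factor {n} (s≤s (s≤s z≤n))
    ... | p , k₀ , pp , _ , e₀ with p-part n n pp 1≤n ℕₚ.≤-refl
    ...   | a , k , e , ¬p∣k , 1≤k = subst (λ z → 0ℚ ≤ r z) (sym e) (go (parity a))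
      where
      k<n : k ℕ.< n
      k<n = subst (k ℕ.<_) (sym e) (cofactor< {p} {a} pp 1≤k (subst (p ∣_) e (subst (p ∣_) (sym e₀) (∣ₚ.m∣m*n k₀))) ¬p∣k)
      0≤rk : 0ℚ ≤ r k
      0≤rk = 0≤r fuel k 1≤k (ℕₚ.≤-pred (ℕₚ.≤-trans k<n n≤f)) (ℕₚ.≤-trans (ℕₚ.<⇒≤ k<n) n≤Y)
      pw≤Y : p ℕ.^ a ℕ.* k ℕ.≤ Y
      pw≤Y = subst (ℕ._≤ Y) e n≤Y
      go : (∃[ b ] a ≡ b ℕ.+ b) ⊎ (∃[ b ] a ≡ suc (b ℕ.+ b)) → 0ℚ ≤ r (p ℕ.^ a ℕ.* k)
      go (inj₁ (b , refl)) = ≤-trans 0≤rk (proj₁ (r-pow pp ¬p∣k 1≤k 0≤rk b) pw≤Y)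
      go (inj₂ (b , refl)) = proj₁ (proj₂ (r-pow pp ¬p∣k 1≤k 0≤rk b)) pw≤Y

    -- All exponents of a square are even, where `r-pow` gives at least the value at the cofactor,
    -- again a square.
    1≤r-square : ∀ fuel n → 1 ℕ.≤ n → n ℕ.≤ fuel → n ℕ.* n ℕ.≤ Y → 1ℚ ≤ r (n ℕ.* n)
    1≤r-square zero n 1≤n n≤0 _ = contradiction (ℕₚ.≤-trans 1≤n n≤0) λ ()
    1≤r-square (suc fuel) (suc zero) _ _ n≤Y = ≤-eq (sym (r-1 n≤Y))
    1≤r-square (suc fuel) n@(suc (suc _)) 1≤n n≤f n²≤Y with prime-factor {n} (s≤s (s≤s z≤n))
    ... | p , k₀ , pp , _ , e₀ with p-part n n pp 1≤n ℕₚ.≤-refl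
    ...   | a , k , e , ¬p∣k , 1≤k = subst (λ z → 1ℚ ≤ r z) (sym e²) (≤-trans 1≤rk² (proj₁ (r-pow pp ¬p∣k² (ℕₚ.*-mono-≤ 1≤k 1≤k) (≤-trans 0≤1 1≤rk²) a) (subst (ℕ._≤ Y) e² n²≤Y)))
      where
      k<n : k ℕ.< n
      k<n = subst (k ℕ.<_) (sym e) (cofactor< {p} {a} pp 1≤k (subst (p ∣_) e (subst (p ∣_) (sym e₀) (∣ₚ.m∣m*n k₀))) ¬p∣k)
      e² : n ℕ.* n ≡ p ℕ.^ (a ℕ.+ a) ℕ.* (k ℕ.* k)
      e² = trans (cong₂ ℕ._*_ e e) (trans (s (p ℕ.^ a) k) (cong (ℕ._* (k ℕ.* k)) (sym (ℕₚ.^-distribˡ-+-* p a a))))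
        where
        s : ∀ x k → x ℕ.* k ℕ.* (x ℕ.* k) ≡ x ℕ.* x ℕ.* (k ℕ.* k)
        s = ℕ-Solver.solve-∀
      ¬p∣k² : ¬ p ∣ k ℕ.* k
      ¬p∣k² h = [ ¬p∣k , ¬p∣k ]′ (euclidsLemma k k pp h)
      1≤rk² : 1ℚ ≤ r (k ℕ.* k)
      1≤rk² = 1≤r-square fuel k 1≤k (ℕₚ.≤-pred (ℕₚ.≤-trans k<n n≤f)) (ℕₚ.≤-trans (ℕₚ.*-mono-≤ (ℕₚ.<⇒≤ k<n) (ℕₚ.<⇒≤ k<n)) n²≤Y)

    -- At most one k has k² = n, so the left side is 0 or 1.
    squares≤r : ∀ h n → 1 ℕ.≤ n → n ℕ.≤ Y → ∑ h (λ k → 𝟙 (k ℕ.* k ℕₚ.≟ n)) ≤ r n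
    squares≤r zero    n 1≤n n≤Y = 0≤r n n 1≤n ℕₚ.≤-refl n≤Y
    squares≤r (suc h) n 1≤n n≤Y with suc h ℕ.* suc h ℕₚ.≟ n
    ... | no _ = ≤-trans (≤-eq (ℚₚ.+-identityʳ _)) (squares≤r h n 1≤n n≤Y)
    ... | yes refl = ≤-trans (≤-eq (cong (_+ 1ℚ) (∑-≡0 h (λ k _ k≤h → 𝟙-no (k ℕ.* k ℕₚ.≟ suc h ℕ.* suc h) (λ e → ℕₚ.<⇒≢ (ℕₚ.*-mono-< (s≤s k≤h) (s≤s k≤h)) e)))))
          (1≤r-square (suc h) (suc h) (s≤s z≤n) ℕₚ.≤-refl n≤Y)

  ι-∸ : ∀ {a b} → b ℕ.≤ a → ι (a ℕ.∸ b) ≡ ι a - ι b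
  ι-∸ {a} {b} h = trans (s (ι (a ℕ.∸ b)) (ι b)) (cong (_- ι b) (trans (sym (ι-+ (a ℕ.∸ b) b)) (cong ι (ℕₚ.m∸n+n≡m h))))
    where
    s : ∀ x b → x ≡ (x + b) - b
    s = solve-∀ ℚ-ring

  -- The sum of (y - n) r(n) over n ≤ y, cut at d = D, where y = K D.
  module Lower (M : ℚ) (0≤M : 0ℚ ≤ M) (osc : Osc M χ) (K D : ℕ) (1≤D : 1 ℕ.≤ D) (1≤K : 1 ℕ.≤ K) where
    y = K ℕ.* D
    open DivisorSum y

    D≤y : D ℕ.≤ y
    D≤y = ℕₚ.m≤n*m D K {{ℕ.>-nonZero 1≤K}}

    T : ℚ
    T = ∑ y (λ n → r n * ι (y ℕ.∸ n))

    -- The weight y - n makes this coefficient of χ(d) equal to y²/(2 d) - y/2 up to an error d/2: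
    -- the first part yields L(1, χ), and the second is constant in d, hence subdued by the
    -- oscillation of χ. The classical weight n^(-1/2) would leave the rationals.
    G : ℕ → ℚ
    G d = ∑ (quo y d) (λ k → ι (y ℕ.∸ d ℕ.* k))

    T≡ : T ≡ ∑ y (λ d → χ d * G d)
    T≡ = trans (∑-cong' y (λ n → trans (sym (∑-*ʳ y (ι (y ℕ.∸ n)) _)) (∑-cong' y (λ d → s (𝟙 (d ∣? n)) (χ d) (ι (y ℕ.∸ n))))))
      (trans (∑-swap y y _) (∑-cong y (λ d 1≤d _ → trans (∑-*ˡ y (χ d) _) (cong (χ d *_) (∑-multiples y d (λ n → ι (y ℕ.∸ n)) 1≤d)))))
      where
      s : ∀ a b c → a * b * c ≡ b * (a * c)
      s = solve-∀ ℚ-ring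

    2G : ∀ d q → 1 ℕ.≤ d → q ℕ.≤ quo y d → 2ℚ * ∑ q (λ k → ι (y ℕ.∸ d ℕ.* k)) ≡ 2ℚ * (ι q * ι y) - ι d * (ι q * (ι q + 1ℚ))
    2G d zero    _ _ = s (ι y) (ι d)
      where
      s : ∀ y d → 2ℚ * 0ℚ ≡ 2ℚ * (0ℚ * y) - d * (0ℚ * (0ℚ + 1ℚ))
      s = solve-∀ ℚ-ring
    2G d (suc q) 1≤d h = trans (ℚₚ.*-distribˡ-+ 2ℚ (∑ q (λ k → ι (y ℕ.∸ d ℕ.* k))) (ι (y ℕ.∸ d ℕ.* suc q))) (trans (cong₂ (λ a b → a + 2ℚ * b) (2G d q 1≤d (ℕₚ.<⇒≤ h)) (trans (ι-∸ (quo-≤ y 1≤d h)) (cong (λ z → ι y - z) (ι-* d (suc q))))) (s (ι y) (ι d) (ι q)))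
      where
      s : ∀ y d q → 2ℚ * (q * y) - d * (q * (q + 1ℚ)) + 2ℚ * (y - d * (1ℚ + q)) ≡ 2ℚ * ((1ℚ + q) * y) - d * ((1ℚ + q) * ((1ℚ + q) + 1ℚ))
      s = solve-∀ ℚ-ring

    e : ℕ → ℚ
    e d = 2ℚ * G d - (ι y * ι y * inv d - ι y)

    -- With ρ = y - d ⌊y/d⌋ one has d e(d) = ρ (d - ρ), where 0 ≤ ρ ≤ d.
    ∣e∣ : ∀ d → 1 ℕ.≤ d → ∣ e d ∣ ≤ ι d
    ∣e∣ d 1≤d = ∣∣≤ (*-cancelˡ-ι 1≤d (subst (_≤ ι d * ι d) (sym de) (*-mono 0≤ρ (0≤ι d) ρ≤d (lin 0≤ρ (s₁ ρ (ι d))))))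
                    (*-cancelˡ-ι 1≤d (subst (_≤ ι d * ι d) (trans (cong -_ (sym de)) (ℚₚ.neg-distribʳ-* (ι d) (e d))) (lin (0≤* 0≤ρ (lin ρ≤d (s₂ ρ (ι d))) ⊕ 0≤* (0≤ι d) (0≤ι d)) (s₃ (ρ * (ι d - ρ)) (ι d * ι d)))))
      where
      q = quo y d
      ρ = ι y - ι d * ι q
      0≤ρ : 0ℚ ≤ ρ
      0≤ρ = lin (≤-trans (≤-eq (sym (ι-* d q))) (ι-mono (quo-≤ y 1≤d ℕₚ.≤-refl))) (s (ι y) (ι d * ι q))
        where
        s : ∀ a b → a - b + b ≡ 0ℚ + a
        s = solve-∀ ℚ-ring
      ρ≤d : ρ ≤ ι d
      ρ≤d = lin (≤-trans (ι-mono (ℕₚ.<⇒≤ (<-quo y 1≤d))) (≤-eq (ι-* d (suc q)))) (s (ι y) (ι d) (ι q))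
        where
        s : ∀ y d q → d + y ≡ y - d * q + d * (1ℚ + q)
        s = solve-∀ ℚ-ring
      s₁ : ∀ ρ d → d + 0ℚ ≡ d - ρ + ρ
      s₁ = solve-∀ ℚ-ring
      s₂ : ∀ ρ d → d - ρ + ρ ≡ 0ℚ + d
      s₂ = solve-∀ ℚ-ring
      s₃ : ∀ a b → b + (0ℚ + 0ℚ) ≡ - a + (a + b)
      s₃ = solve-∀ ℚ-ring
      de : ι d * e d ≡ ρ * (ι d - ρ)
      de = trans (cong (λ z → ι d * (z - (ι y * ι y * inv d - ι y))) (2G d q 1≤d ℕₚ.≤-refl)) (trans (s (ι d) (ι q) (ι y) (inv d)) (trans (cong (λ z → 2ℚ * (ι q * ι y) * ι d - ι d * ι d * (ι q * (ι q + 1ℚ)) - (z * (ι y * ι y) - ι d * ι y)) (ι*inv 1≤d)) (s' (ι d) (ι q) (ι y))))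
        where
        s : ∀ d q y i → d * (2ℚ * (q * y) - d * (q * (q + 1ℚ)) - (y * y * i - y)) ≡ 2ℚ * (q * y) * d - d * d * (q * (q + 1ℚ)) - (d * i * (y * y) - d * y)
        s = solve-∀ ℚ-ring
        s' : ∀ d q y → 2ℚ * (q * y) * d - d * d * (q * (q + 1ℚ)) - (1ℚ * (y * y) - d * y) ≡ (y - d * q) * (d - (y - d * q))
        s' = solve-∀ ℚ-ring

    head : 2ℚ * ∑ D (λ d → χ d * G d) ≡ ι y * ι y * A χ D - ι y * ∑ D χ + ∑ D (λ d → χ d * e d)
    head = trans (sym (∑-*ˡ D 2ℚ _)) (trans (∑-cong' D (λ d → s (χ d) (G d) (ι y) (inv d))) (trans (∑-+ D _ _) (cong (_+ ∑ D (λ d → χ d * e d)) (trans (∑-- D _ _) (cong₂ _-_ (∑-*ˡ D (ι y * ι y) _) (∑-*ˡ D (ι y) χ))))))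
      where
      s : ∀ c g y i → 2ℚ * (c * g) ≡ y * y * (c * i) - y * c + c * (2ℚ * g - (y * y * i - y))
      s = solve-∀ ℚ-ring

    error : ∑ D (λ d → χ d * e d) ≤ ι D * ι D
    error = ≤-trans (p≤∣p∣ _) (≤-trans (∑-abs-mono D (λ d 1≤d d≤D → ≤-trans (∣*∣≤ {χ d} (∣value∣≤1 (χ-values d)) (∣e∣ d 1≤d)) (≤-trans (≤-eq (ℚₚ.*-identityˡ (ι d))) (ι-mono d≤D)))) (≤-eq (∑-const D (ι D))))

    -- Beyond D only k ≤ K occur, as y = K D. For fixed k the weight y - d k, cut off at 0,
    -- decreases in d, so partial summation bounds the sum over d by 2 M y.
    tail : ∑ (y ℕ.∸ D) (λ i → χ (D ℕ.+ i) * G (D ℕ.+ i)) ≤ ι K * (2ℚ * M * ι y)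
    tail = ≤-trans (≤-eq (trans (∑-cong N (λ i 1≤i _ → trans (cong (χ (D ℕ.+ i) *_) (G≡ i 1≤i)) (sym (∑-*ˡ K (χ (D ℕ.+ i)) _)))) (∑-swap N K _)))
      (≤-trans (∑-mono K (λ k 1≤k _ → ≤-trans (p≤∣p∣ _) (≤-trans (abel-mono N (λ i → χ (D ℕ.+ i)) (λ i → ι (y ℕ.∸ (D ℕ.+ i) ℕ.* k)) bd
          (λ n _ → ι-mono (ℕₚ.∸-monoʳ-≤ y (ℕₚ.*-monoˡ-≤ k (ℕₚ.+-monoʳ-≤ D (ℕₚ.n≤1+n n))))) (λ n → 0≤ι (y ℕ.∸ (D ℕ.+ suc n) ℕ.* k)))
          (0≤* (0≤ι 2) 0≤M ⊙ ι-mono (ℕₚ.m∸n≤m y ((D ℕ.+ 1) ℕ.* k))))))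
        (≤-eq (∑-const K (2ℚ * M * ι y))))
      where
      N = y ℕ.∸ D
      -- Truncated subtraction makes the terms with k > ⌊y/d⌋ vanish, so the range of k can be taken
      -- independent of d.
      G≡ : ∀ i → 1 ℕ.≤ i → G (D ℕ.+ i) ≡ ∑ K (λ k → ι (y ℕ.∸ (D ℕ.+ i) ℕ.* k))
      G≡ i 1≤i = sym (∑-extend q≤K (λ k q<k _ → cong ι (ℕₚ.m≤n⇒m∸n≡0 (ℕₚ.<⇒≤ (ℕₚ.<-≤-trans (<-quo y 1≤d) (ℕₚ.*-monoʳ-≤ (D ℕ.+ i) q<k))))))
        where
        1≤d : 1 ℕ.≤ D ℕ.+ i
        1≤d = ℕₚ.≤-trans 1≤D (ℕₚ.m≤m+n D i)
        q≤K : quo y (D ℕ.+ i) ℕ.≤ K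
        q≤K = ℕₚ.*-cancelʳ-≤ _ _ D {{ℕ.>-nonZero 1≤D}} (ℕₚ.≤-trans (ℕₚ.*-monoʳ-≤ (quo y (D ℕ.+ i)) (ℕₚ.m≤m+n D i)) (ℕₚ.≤-trans (ℕₚ.≤-reflexive (ℕₚ.*-comm (quo y (D ℕ.+ i)) (D ℕ.+ i))) (quo-≤ y 1≤d ℕₚ.≤-refl)))
      bd : ∀ n → ∣ ∑ n (λ i → χ (D ℕ.+ i)) ∣ ≤ 2ℚ * M
      bd n = subst₂ (λ a b → ∣ a ∣ ≤ b) (trans (cong (_- ∑ D χ) (∑-split D n χ)) (s (∑ D χ) _)) (s' M)
        (∣-∣≤ {∑ (D ℕ.+ n) χ} (Osc⇒bounded osc (D ℕ.+ n)) (Osc⇒bounded osc D))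
        where
        s : ∀ a b → (a + b) - a ≡ b
        s = solve-∀ ℚ-ring
        s' : ∀ M → M + M ≡ 2ℚ * M
        s' = solve-∀ ℚ-ring

    -- Of the 6 M y K, 4 come from the doubled tail, and 2 from replacing `A χ D` by `A χ X`, where
    -- y² · 2 M/D = 2 M y K.
    upper : ∀ {X} → D ℕ.≤ X → 2ℚ * T ≤ ι y * ι y * A χ X + (6ℚ * (M * (ι y * ι K)) + (ι y * M + ι D * ι D))
    upper {X} D≤X = ≤-trans (≤-eq (trans (cong (2ℚ *_) (trans T≡ (trans (cong (λ z → ∑ z (λ d → χ d * G d)) (sym (ℕₚ.m+[n∸m]≡n D≤y))) (∑-split D (y ℕ.∸ D) _)))) (trans (ℚₚ.*-distribˡ-+ 2ℚ (∑ D (λ d → χ d * G d)) Tl) (cong (_+ 2ℚ * Tl) head))))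
      (lin (error ⊕ 0≤ι 2 ⊙ tail ⊕ 0≤ι y ⊙ ≤-trans (-p≤∣p∣ (∑ D χ)) (Osc⇒bounded osc D) ⊕ 0≤* (0≤ι y) (0≤ι y) ⊙ ≤-trans (-p≤∣p∣ (A χ X - A χ D)) (≤-trans (A-tail {u = χ} osc D≤X) (0≤* (0≤ι 2) 0≤M ⊙ inv-anti 1≤D (ℕₚ.n≤1+n D))))
        (trans (s (ι y) (A χ X) (A χ D) M (ι K) (ι D) (∑ D χ) (∑ D (λ d → χ d * e d)) Tl) (cong (λ z → ι y * ι y * A χ D - ι y * ∑ D χ + ∑ D (λ d → χ d * e d) + 2ℚ * Tl + (ι D * ι D + (2ℚ * (ι K * (2ℚ * M * ι y)) + (ι y * M + z)))) yK)))
      where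
      Tl = ∑ (y ℕ.∸ D) (λ i → χ (D ℕ.+ i) * G (D ℕ.+ i))
      s : ∀ y L a M K D c E t → y * y * L + (6ℚ * (M * (y * K)) + (y * M + D * D)) + (E + (2ℚ * t + (y * - c + y * y * - (L - a)))) ≡
          y * y * a - y * c + E + 2ℚ * t + (D * D + (2ℚ * (K * (2ℚ * M * y)) + (y * M + 2ℚ * M * (y * K))))
      s = solve-∀ ℚ-ring
      s₂ : ∀ M y k d i → 2ℚ * M * (y * k) * (d * i) ≡ y * (k * d) * (2ℚ * M * i)
      s₂ = solve-∀ ℚ-ring
      yK : 2ℚ * M * (ι y * ι K) ≡ ι y * ι y * (2ℚ * M * inv D)
      yK = trans (sym (ℚₚ.*-identityʳ _)) (trans (cong (2ℚ * M * (ι y * ι K) *_) (sym (ι*inv 1≤D))) (trans (s₂ M (ι y) (ι K) (ι D) (inv D)) (cong (λ z → ι y * z * (2ℚ * M * inv D)) (sym (ι-* K D)))))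

    -- Only the squares k² with k ≤ h are kept; each has weight at least y - h².
    lower : ∀ h → h ℕ.* h ℕ.≤ y → ι h * (ι y - ι (h ℕ.* h)) ≤ T
    lower h h²≤y = ≤-trans (≤-trans (≤-eq (sym (∑-const h (ι y - ι (h ℕ.* h))))) (∑-mono h (λ k 1≤k k≤h → ≤-trans (≤-eq (sym (ι-∸ h²≤y))) (ι-mono (ℕₚ.∸-monoʳ-≤ y (ℕₚ.*-mono-≤ k≤h k≤h))))))
      (≤-trans (≤-eq (sym swap)) (∑-mono y (λ n 1≤n n≤y → *-monoˡ (0≤ι (y ℕ.∸ n)) (squares≤r h n 1≤n n≤y))))
      where
      swap : ∑ y (λ n → ∑ h (λ k → 𝟙 (k ℕ.* k ℕₚ.≟ n)) * ι (y ℕ.∸ n)) ≡ ∑ h (λ k → ι (y ℕ.∸ k ℕ.* k))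
      swap = trans (∑-cong' y (λ n → sym (∑-*ʳ h (ι (y ℕ.∸ n)) _))) (trans (∑-swap y h _) (∑-cong h (λ k 1≤k k≤h → ∑-𝟙≟ y (λ n → ι (y ℕ.∸ n)) (k ℕ.* k) (ℕₚ.*-mono-≤ 1≤k 1≤k) (ℕₚ.≤-trans (ℕₚ.*-mono-≤ k≤h k≤h) h²≤y))))

  -- D and K balance the errors D² and M y K, and h² = y/4 with y = 64 v⁶. Twice the lower bound is
  -- 384 v⁹; the errors 1536 M v⁸ + 64 M v⁶ + 256 v⁸ are at most 256 v⁸ (7 M + 1) ≤ 256 v⁹. So y²
  -- `A χ X`, which is 4096 v¹² `A χ X`, is at least 128 v⁹.
  L-lower-bound : ∀ M v X → 0ℚ ≤ M → Osc M χ → 1 ℕ.≤ v → 7ℚ * M + 1ℚ ≤ ι v → 16 ℕ.* (v ℕ.* v ℕ.* (v ℕ.* v)) ℕ.≤ X →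
    1ℚ ≤ ι (32 ℕ.* (v ℕ.* (v ℕ.* v))) * A χ X
  L-lower-bound M v X 0≤M osc 1≤v big D≤X = *-cancelˡ-ι {128 ℕ.* v⁹} (ℕₚ.*-mono-≤ {1} {128} (s≤s z≤n) 1≤v⁹)
    (lin (0≤ι 2 ⊙ lower h h²≤y ⊕ upper D≤X ⊕ 0≤* (0≤ι 256) 0≤v⁸ ⊙ big ⊕ 0≤* (0≤* (0≤ι 64) 0≤M) 0≤y-v⁸) eq)
    where
    v² = v ℕ.* v
    v³ = v ℕ.* v²
    D = 16 ℕ.* (v² ℕ.* v²)
    K = 4 ℕ.* v²
    h = 4 ℕ.* v³
    v⁹ = v³ ℕ.* (v³ ℕ.* v³)
    1≤v² : 1 ℕ.≤ v²
    1≤v² = ℕₚ.*-mono-≤ 1≤v 1≤v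
    1≤v³ : 1 ℕ.≤ v³
    1≤v³ = ℕₚ.*-mono-≤ 1≤v 1≤v²
    1≤v⁹ : 1 ℕ.≤ v⁹
    1≤v⁹ = ℕₚ.*-mono-≤ 1≤v³ (ℕₚ.*-mono-≤ 1≤v³ 1≤v³)
    open Lower M 0≤M osc K D (ℕₚ.*-mono-≤ {1} {16} (s≤s z≤n) (ℕₚ.*-mono-≤ 1≤v² 1≤v²)) (ℕₚ.*-mono-≤ {1} {4} (s≤s z≤n) 1≤v²)
    h²≤y : h ℕ.* h ℕ.≤ y
    h²≤y = ℕₚ.≤-trans (ℕₚ.m≤n*m (h ℕ.* h) 4) (ℕₚ.≤-reflexive (s v))
      where
      s : ∀ v → 4 ℕ.* (4 ℕ.* (v ℕ.* (v ℕ.* v)) ℕ.* (4 ℕ.* (v ℕ.* (v ℕ.* v)))) ≡ 4 ℕ.* (v ℕ.* v) ℕ.* (16 ℕ.* (v ℕ.* v ℕ.* (v ℕ.* v)))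
      s = ℕ-Solver.solve-∀
    V = ι v
    0≤v⁸ : 0ℚ ≤ V * V * (V * V) * (V * V * (V * V))
    0≤v⁸ = 0≤* (0≤* (0≤* (0≤ι v) (0≤ι v)) (0≤* (0≤ι v) (0≤ι v))) (0≤* (0≤* (0≤ι v) (0≤ι v)) (0≤* (0≤ι v) (0≤ι v)))
    0≤y-v⁸ : 0ℚ ≤ V * V * (V * V) * (V * V) * (4ℚ * (V * V) - 1ℚ)
    0≤y-v⁸ = 0≤* (0≤* (0≤* (0≤* (0≤ι v) (0≤ι v)) (0≤* (0≤ι v) (0≤ι v))) (0≤* (0≤ι v) (0≤ι v)))
      (lin (≤-trans (ι-mono 1≤v²) (≤-eq (ι-* v v)) ⊕ 0≤* (0≤ι 3) (0≤* (0≤ι v) (0≤ι v))) (s (V * V)))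
      where
      s : ∀ a → 4ℚ * a - 1ℚ + (ι 1 + 0ℚ) ≡ 0ℚ + (a + 3ℚ * a)
      s = solve-∀ ℚ-ring
    ιv² = ι-* v v
    ιv³ : ι v³ ≡ V * (V * V)
    ιv³ = trans (ι-* v v²) (cong (V *_) ιv²)
    ιD : ι D ≡ 16ℚ * (V * V * (V * V))
    ιD = trans (ι-* 16 (v² ℕ.* v²)) (cong (16ℚ *_) (trans (ι-* v² v²) (cong₂ _*_ ιv² ιv²)))
    ιK : ι K ≡ 4ℚ * (V * V)
    ιK = trans (ι-* 4 v²) (cong (4ℚ *_) ιv²)
    ιh : ι h ≡ 4ℚ * (V * (V * V))
    ιh = trans (ι-* 4 v³) (cong (4ℚ *_) ιv³)
    ιy : ι y ≡ 4ℚ * (V * V) * (16ℚ * (V * V * (V * V)))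
    ιy = trans (ι-* K D) (cong₂ _*_ ιK ιD)
    ι128 : ι (128 ℕ.* v⁹) ≡ ι 128 * (V * (V * V) * (V * (V * V) * (V * (V * V))))
    ι128 = trans (ι-* 128 v⁹) (cong (ι 128 *_) (trans (ι-* v³ (v³ ℕ.* v³)) (cong₂ _*_ ιv³ (trans (ι-* v³ v³) (cong₂ _*_ ιv³ ιv³)))))
    ι32 : ι (32 ℕ.* v³) ≡ 32ℚ * (V * (V * V))
    ι32 = trans (ι-* 32 v³) (cong (32ℚ *_) ιv³)
    eq : ι (128 ℕ.* v⁹) * (ι (32 ℕ.* v³) * A χ X) + (2ℚ * (ι h * (ι y - ι (h ℕ.* h))) + (2ℚ * T + (ι 256 * (V * V * (V * V) * (V * V * (V * V))) * (7ℚ * M + 1ℚ) + 0ℚ)))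
       ≡ ι (128 ℕ.* v⁹) * 1ℚ + (2ℚ * T + (ι y * ι y * A χ X + (6ℚ * (M * (ι y * ι K)) + (ι y * M + ι D * ι D)) + (ι 256 * (V * V * (V * V) * (V * V * (V * V))) * V + ι 64 * M * (V * V * (V * V) * (V * V) * (4ℚ * (V * V) - 1ℚ)))))
    eq = trans (cong₂ (λ a b → a + (b + (2ℚ * T + (ι 256 * (V * V * (V * V) * (V * V * (V * V))) * (7ℚ * M + 1ℚ) + 0ℚ))))
           (cong₂ (λ a b → a * (b * A χ X)) ι128 ι32)
           (cong₂ (λ a b → 2ℚ * (a * b)) ιh (cong₂ _-_ ιy (trans (ι-* h h) (cong₂ _*_ ιh ιh)))))
         (trans (s V M (A χ X) T)
         (cong₂ (λ a b → a * 1ℚ + (2ℚ * T + (b + (ι 256 * (V * V * (V * V) * (V * V * (V * V))) * V + ι 64 * M * (V * V * (V * V) * (V * V) * (4ℚ * (V * V) - 1ℚ))))))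
           (sym ι128) (cong₂ (λ a b → a + b) (cong (λ a → a * a * A χ X) (sym ιy))
             (cong₂ (λ a b → 6ℚ * (M * a) + b) (cong₂ _*_ (sym ιy) (sym ιK)) (cong₂ (λ a b → a * M + b * b) (sym ιy) (sym ιD))))))
      where
      s : ∀ v M L T → ι 128 * (v * (v * v) * (v * (v * v) * (v * (v * v)))) * (32ℚ * (v * (v * v)) * L) + (2ℚ * (4ℚ * (v * (v * v)) * (4ℚ * (v * v) * (16ℚ * (v * v * (v * v))) - 4ℚ * (v * (v * v)) * (4ℚ * (v * (v * v))))) + (2ℚ * T + (ι 256 * (v * v * (v * v) * (v * v * (v * v))) * (7ℚ * M + 1ℚ) + 0ℚ)))
        ≡ ι 128 * (v * (v * v) * (v * (v * v) * (v * (v * v)))) * 1ℚ + (2ℚ * T + (4ℚ * (v * v) * (16ℚ * (v * v * (v * v))) * (4ℚ * (v * v) * (16ℚ * (v * v * (v * v)))) * L + (6ℚ * (M * (4ℚ * (v * v) * (16ℚ * (v * v * (v * v))) * (4ℚ * (v * v)))) + (4ℚ * (v * v) * (16ℚ * (v * v * (v * v))) * M + 16ℚ * (v * v * (v * v)) * (16ℚ * (v * v * (v * v))))) + (ι 256 * (v * v * (v * v) * (v * v * (v * v))) * v + ι 64 * M * (v * v * (v * v) * (v * v) * (4ℚ * (v * v) - 1ℚ)))))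
      s = solve-∀ ℚ-ring

-- Dirichlet's theorem

module Limits (m : ℕ) {{m≢0 : ℕ.NonZero m}} where
  open Residues m
  open ApproximateCharacter m using (0≤φ; 1≤φ) public

  -- `Cσ` bounds σ - log x; `K₁` and `K₂` serve the bound of |P| and the convolution equation, the
  -- last two summands of `K` serve `P-large` and `P-mean`. Their sum allows a single ε.
  Cσ K₁ K₂ K : ℚ
  Cσ = ι m * (3ℚ * ι m) + 4ℚ
  K₁ = ι 28 + ι 170 * φ
  K₂ = φ * (5ℚ * Cσ + ι 170 * φ)
  K  = K₁ + (K₂ + (12ℚ * φ + φ * Cσ))

  0≤Cσ : 0ℚ ≤ Cσ
  0≤Cσ = 0≤+ (0≤* (0≤ι m) (0≤* (0≤ι 3) (0≤ι m))) (0≤ι 4)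

  0≤K₁ : 0ℚ ≤ K₁
  0≤K₁ = 0≤+ (0≤ι 28) (0≤* (0≤ι 170) 0≤φ)

  0≤K₂ : 0ℚ ≤ K₂
  0≤K₂ = 0≤* 0≤φ (0≤+ (0≤* (0≤ι 5) 0≤Cσ) (0≤* (0≤ι 170) 0≤φ))

  0≤12φ : 0ℚ ≤ 12ℚ * φ
  0≤12φ = 0≤* (0≤ι 12) 0≤φ

  0≤φCσ : 0ℚ ≤ φ * Cσ
  0≤φCσ = 0≤* 0≤φ 0≤Cσ

  K₁≤K : K₁ ≤ K
  K₁≤K = lin (0≤K₂ ⊕ 0≤12φ ⊕ 0≤φCσ) (r K₁ K₂ (12ℚ * φ) (φ * Cσ))
    where
    r : ∀ a b c d → a + (b + (c + d)) + (0ℚ + (0ℚ + 0ℚ)) ≡ a + (b + (c + d))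
    r = solve-∀ ℚ-ring

  K₂≤K : K₂ ≤ K
  K₂≤K = lin (0≤K₁ ⊕ 0≤12φ ⊕ 0≤φCσ) (r K₁ K₂ (12ℚ * φ) (φ * Cσ))
    where
    r : ∀ a b c d → a + (b + (c + d)) + (0ℚ + (0ℚ + 0ℚ)) ≡ b + (a + (c + d))
    r = solve-∀ ℚ-ring

  12φ≤K : 12ℚ * φ ≤ K
  12φ≤K = lin (0≤K₁ ⊕ 0≤K₂ ⊕ 0≤φCσ) (r K₁ K₂ (12ℚ * φ) (φ * Cσ))
    where
    r : ∀ a b c d → a + (b + (c + d)) + (0ℚ + (0ℚ + 0ℚ)) ≡ c + (a + (b + d))
    r = solve-∀ ℚ-ring

  φCσ≤K : φ * Cσ ≤ K
  φCσ≤K = lin (0≤K₁ ⊕ 0≤K₂ ⊕ 0≤12φ) (r K₁ K₂ (12ℚ * φ) (φ * Cσ))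
    where
    r : ∀ a b c d → a + (b + (c + d)) + (0ℚ + (0ℚ + 0ℚ)) ≡ d + (a + (b + c))
    r = solve-∀ ℚ-ring

  module UpTo {X : ℕ} (1≤X : 1 ℕ.≤ X) (log : LogUpTo X) (m≤X : m ℕ.≤ X) where
    open Classes 1≤X log m

    ∣σ-t∣ : ∀ j → 2 ℕ.^ j ℕ.≤ X → ∣ σ j - ι j ∣ ≤ Cσ
    ∣σ-t∣ j h = ∣∣≤ (lin (σ-upper j h ⊕ 0≤* (0≤ι m) (0≤* (0≤ι 3) (0≤ι m))) (r₁ (σ j) (ι j) cm)) (lin (σ-lower j h m≤X ⊕ 0≤1) (r₂ (σ j) (ι j) cm))
      where
      r₁ : ∀ s t c → c + 4ℚ + (s + 0ℚ) ≡ s - t + (t + 4ℚ + c)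
      r₁ = solve-∀ ℚ-ring
      r₂ : ∀ s t c → c + 4ℚ + (t + 0ℚ) ≡ - (s - t) + (s + (c + 3ℚ) + 1ℚ)
      r₂ = solve-∀ ℚ-ring

    0≤σ : ∀ j → 0ℚ ≤ σ j
    0≤σ j = 0≤∑ (2 ℕ.^ j) (λ d _ _ → 0≤* (0≤Λ/ d) (0≤𝟙 (unit? d)))

    Q : ℕ → ℕ → ℚ
    Q j g = ι j - φ * S j g

    module Pair (j : ℕ) (1≤j : 1 ℕ.≤ j) (big : suc (2 ℕ.^ (j ℕ.* j)) ℕ.≤ X) where
      j' = j ℕ.* j
      t = ι j
      t' = ι j'

      t'≡ : t' ≡ t * t
      t'≡ = ι-* j j

      x'≤X : 2 ℕ.^ j' ℕ.≤ X
      x'≤X = ℕₚ.<⇒≤ big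

      x≤X : 2 ℕ.^ j ℕ.≤ X
      x≤X = ℕₚ.≤-trans (ℕₚ.^-monoʳ-≤ 2 (ℕₚ.m≤m*n j j {{ℕ.>-nonZero 1≤j}})) x'≤X

      1≤t : 1ℚ ≤ t
      1≤t = subst (_≤ t) (ℚₚ.+-identityʳ 1ℚ) (ι-mono 1≤j)

      t≤t² : t ≤ t * t
      t≤t² = subst (_≤ t * t) (ℚₚ.*-identityʳ t) (0≤ι j ⊙ 1≤t)

      1≤t² : 1ℚ ≤ t * t
      1≤t² = ≤-trans 1≤t t≤t²

      -- 20 (t + 2)(t + 1) + 10 (t² + 4) = 30 t² + 60 t + 80, and t ≥ 1.
      err≤ : selberg-error j j' ≤ ι 170 * (t * t)
      err≤ = lin (0≤ι 60 ⊙ t≤t² ⊕ 0≤ι 80 ⊙ 1≤t²) (trans (r t) (cong (λ z → (t + 2ℚ) * (t + 1ℚ) * 20ℚ + (z + 4ℚ) * 10ℚ + (ι 60 * (t * t) + ι 80 * (t * t))) (sym t'≡)))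
        where
        r : ∀ t → ι 170 * (t * t) + (ι 60 * t + ι 80 * 1ℚ) ≡ (t + 2ℚ) * (t + 1ℚ) * 20ℚ + (t * t + 4ℚ) * 10ℚ + (ι 60 * (t * t) + ι 80 * (t * t))
        r = solve-∀ ℚ-ring

      E-mean : ∀ g → Unit g → ∣ φ * E j j' g - ∑ᵤ (E j j') ∣ ≤ φ * (ι 170 * (t * t))
      E-mean g ug = subst (λ z → ∣ z ∣ ≤ φ * (ι 170 * (t * t))) eq (≤-trans (∑-abs-mono m (λ h _ _ →
          subst (_≤ 𝟙 (unit? h) * (ι 170 * (t * t))) (sym (trans (ℚₚ.∣p*q∣≡∣p∣*∣q∣ (𝟙 (unit? h)) (D h)) (cong (_* ∣ D h ∣) (∣∣≥0 (0≤𝟙 (unit? h))))))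
          (𝟙*-mono (unit? h) (λ uh → ≤-trans (E-diff j j' x≤X big ug uh) err≤)))) (≤-eq (∑ᵤ-const _)))
        where
        D : ℕ → ℚ
        D h = E j j' g - E j j' h
        eq : ∑ᵤ D ≡ φ * E j j' g - ∑ᵤ (E j j')
        eq = trans (∑-cong' m (λ h → r (𝟙 (unit? h)) (E j j' g) (E j j' h))) (trans (∑-- m _ _) (cong (_- ∑ᵤ (E j j')) (∑ᵤ-const (E j j' g))))
          where
          r : ∀ u a b → u * (a - b) ≡ u * a - u * b
          r = solve-∀ ℚ-ring

      0≤conv : ∀ g → 0ℚ ≤ conv j j' g
      0≤conv g = 0≤∑ (2 ℕ.^ j') (λ d _ _ → 0≤* (0≤Λ/ d) (0≤∑ (2 ℕ.^ j) (λ n _ _ → 0≤* (0≤𝟙 (d ℕ.* n ≋? g)) (0≤Λ/ n))))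

      -- The convolution in E is dropped, being non-negative. The result is twice the expected size
      -- t², and this factor 2 is exactly what P ≥ -1 requires up to a small error.
      S-upper : ∀ g → Unit g → φ * S j' g ≤ 2ℚ * (t * t) + K₁ * t
      S-upper g ug = *-cancelˡ-ι 1≤j (lin (≤-trans (p≤∣p∣ _) (E-mean g ug) ⊕ (0≤φ ⊙ 0≤conv g) ⊕ mean ⊕ 0≤ι 8 ⊙ t≤t² ⊕ 0≤ι 16 ⊙ 1≤t²)
          (trans (cong (λ z → t * (2ℚ * (t * t) + K₁ * t) + (φ * E j j' g - z + (φ * 0ℚ + (t * σ j' + σ j' * σ j + (ι 8 * t + ι 16 * 1ℚ))))) (∑ᵤ-E j j'))
            (trans (r t φ (S j' g) (conv j j' g) (t * σ j' + σ j' * σ j)) (cong (λ z → t * (φ * S j' g) + (φ * (ι 170 * (t * t)) + (φ * conv j j' g + ((z + 4ℚ) * (2ℚ * t + 4ℚ) + (ι 8 * (t * t) + ι 16 * (t * t)))))) (sym t'≡)))))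
        where
        mean : t * σ j' + σ j' * σ j ≤ (t' + 4ℚ) * (2ℚ * t + 4ℚ)
        mean = ≤-trans (≤-eq (r₀ t (σ j') (σ j))) (*-mono (0≤σ j') (0≤+ (0≤* (0≤ι 2) (0≤ι j)) (0≤ι 4)) (σ-upper j' x'≤X) (lin (σ-upper j x≤X) (r₁ t (σ j))))
          where
          r₀ : ∀ t a b → t * a + a * b ≡ a * (t + b)
          r₀ = solve-∀ ℚ-ring
          r₁ : ∀ t b → 2ℚ * t + 4ℚ + b ≡ t + b + (t + 4ℚ)
          r₁ = solve-∀ ℚ-ring
        r : ∀ t f s c z → t * (2ℚ * (t * t) + (ι 28 + ι 170 * f) * t) + (f * (t * s + c) - z + (f * 0ℚ + (z + (ι 8 * t + ι 16 * 1ℚ)))) ≡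
            t * (f * s) + (f * (ι 170 * (t * t)) + (f * c + ((t * t + 4ℚ) * (2ℚ * t + 4ℚ) + (ι 8 * (t * t) + ι 16 * (t * t)))))
        r = solve-∀ ℚ-ring

      ∣Q∣ : ∀ g → Unit g → ∣ Q j' g ∣ ≤ t' + K₁ * t
      ∣Q∣ g ug = ∣∣≤ (lin (0≤* 0≤φ (0≤S j' g) ⊕ 0≤* 0≤K₁ (0≤ι j)) (r₁ t' (φ * S j' g) (K₁ * t)))
          (lin (S-upper g ug) (trans (cong (λ z → z + K₁ * t + φ * S j' g) t'≡) (trans (r₂ (t * t) (φ * S j' g) (K₁ * t)) (cong (λ z → - (z - φ * S j' g) + (2ℚ * (t * t) + K₁ * t)) (sym t'≡)))))
        where
        r₁ : ∀ t s k → t + k + (0ℚ + 0ℚ) ≡ t - s + (s + k)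
        r₁ = solve-∀ ℚ-ring
        r₂ : ∀ t s k → t + k + s ≡ - (t - s) + (2ℚ * t + k)
        r₂ = solve-∀ ℚ-ring

      -- After expansion the parts linear in S are full sums over the units, and the difference
      -- equals φ ((φ E(g) - ∑ E) + σ(j) (σ(j') - t')). Both brackets are known to be small.
      Q-convolution : ∀ g → Unit g → ∣ ∑ᵤ (λ h → Q j h * Q j' (hinv h ℕ.* g)) - φ * (t * Q j' g) ∣ ≤ K₂ * (t * t)
      Q-convolution g ug = subst (λ a → ∣ a ∣ ≤ K₂ * (t * t)) (sym eq) (≤-trans (∣*∣≤ {φ} (≤-eq (∣∣≥0 0≤φ)) (∣+∣≤ {φ * E j j' g - ∑ᵤ (E j j')} (E-mean g ug) (∣*∣≤ {σ j} (≤-trans (≤-eq (∣∣≥0 (0≤σ j))) (σ-upper j x≤X)) (∣σ-t∣ j' x'≤X))))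
          (lin (0≤* 0≤φ 0≤Cσ ⊙ t≤t² ⊕ 0≤* 0≤φ (0≤* (0≤ι 4) 0≤Cσ) ⊙ 1≤t²) (r₅ φ Cσ t)))
        where
        r₅ : ∀ f c t → f * (5ℚ * c + ι 170 * f) * (t * t) + (f * c * t + f * (4ℚ * c) * 1ℚ) ≡ f * (f * (ι 170 * (t * t)) + (t + 4ℚ) * c) + (f * c * (t * t) + f * (4ℚ * c) * (t * t))
        r₅ = solve-∀ ℚ-ring
        expand : ∀ u a b f s s' → u * ((a - f * s) * (b - f * s')) ≡ u * (a * b) - f * a * (u * s') - f * b * (u * s) + f * f * (u * (s * s'))
        expand = solve-∀ ℚ-ring
        total : ∑ᵤ (λ h → Q j h * Q j' (hinv h ℕ.* g)) ≡ φ * (t * t') - φ * t * σ j' - φ * t' * σ j + φ * φ * conv j j' g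
        total = trans (∑-cong' m (λ h → expand (𝟙 (unit? h)) t t' φ (S j h) (S j' (hinv h ℕ.* g)))) (trans (∑-+ m _ _) (cong₂ _+_
          (trans (∑-- m _ _) (cong₂ _-_ (trans (∑-- m _ _) (cong₂ _-_ (∑ᵤ-const (t * t')) (trans (∑-*ˡ m (φ * t) _) (cong (φ * t *_) (∑ᵤ-S-hinv j' g ug)))))
            (trans (∑-*ˡ m (φ * t') _) (cong (φ * t' *_) (∑ᵤ-S j)))))
          (trans (∑-*ˡ m (φ * φ) _) (cong (φ * φ *_) (sym (conv-∑ᵤ j j' g ug))))))
        r₆ : ∀ t t' f s s' c q → f * (t * t') - f * t * s' - f * t' * s + f * f * c - f * (t * (t' - f * q)) ≡ f * ((f * (t * q + c) - (t * s' + s' * s)) + s * (s' - t'))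
        r₆ = solve-∀ ℚ-ring
        eq : ∑ᵤ (λ h → Q j h * Q j' (hinv h ℕ.* g)) - φ * (t * Q j' g) ≡ φ * ((φ * E j j' g - ∑ᵤ (E j j')) + σ j * (σ j' - t'))
        eq = trans (cong (_- φ * (t * Q j' g)) total) (trans (r₆ t t' φ (σ j) (σ j') (conv j j' g) (S j' g)) (cong (λ z → φ * ((φ * E j j' g - z) + σ j * (σ j' - t'))) (sym (∑ᵤ-E j j'))))

    P : ℕ → ℕ → ℚ
    P j g = inv j * Q j g

    P-resp : ∀ j {a b} → a ≋ b → P j a ≡ P j b
    P-resp j e = cong (λ z → inv j * (ι j - φ * z)) (S-cong j e)

    ∣inv*∣ : ∀ j {x y} → ∣ x ∣ ≤ y → ∣ inv j * x ∣ ≤ inv j * y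
    ∣inv*∣ j h = ∣*∣≤ {inv j} (≤-eq (∣∣≥0 (0≤inv j))) h

    inv-bound : ∀ {a b T j} → 0ℚ ≤ a → a ≤ b → 1 ℕ.≤ T → T ℕ.≤ j → a * inv j ≤ b * inv T
    inv-bound {T = T} 0≤a a≤b 1≤T T≤j = *-mono 0≤a (0≤inv T) a≤b (inv-anti 1≤T T≤j)

    ∣P∣ : ∀ {T} j (1≤j : 1 ℕ.≤ j) → suc (2 ℕ.^ (j ℕ.* j)) ℕ.≤ X → 1 ℕ.≤ T → T ℕ.≤ j → ∀ g → Unit g → ∣ P (j ℕ.* j) g ∣ ≤ 1ℚ + K * inv T
    ∣P∣ {T} j 1≤j big 1≤T T≤j g ug = ≤-trans (∣inv*∣ (j ℕ.* j) (Pair.∣Q∣ j 1≤j big g ug)) (≤-trans (≤-eq eq) (≤-refl {1ℚ} ⊕ inv-bound 0≤K₁ K₁≤K 1≤T T≤j))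
      where
      eq : inv (j ℕ.* j) * (ι (j ℕ.* j) + K₁ * ι j) ≡ 1ℚ + K₁ * inv j
      eq = trans (ℚₚ.*-distribˡ-+ (inv (j ℕ.* j)) (ι (j ℕ.* j)) (K₁ * ι j)) (cong₂ _+_ (inv*ι (ℕₚ.*-mono-≤ 1≤j 1≤j)) (trans (cong (_* (K₁ * ι j)) (inv-* j j)) (trans (r (inv j) K₁ (ι j)) (trans (cong (K₁ * inv j *_) (inv*ι 1≤j)) (ℚₚ.*-identityʳ (K₁ * inv j))))))
        where
        r : ∀ i k t → i * i * (k * t) ≡ k * i * (i * t)
        r = solve-∀ ℚ-ring

    P-eigen : ∀ {T} j (1≤j : 1 ℕ.≤ j) → suc (2 ℕ.^ (j ℕ.* j)) ℕ.≤ X → 1 ℕ.≤ T → T ℕ.≤ j → ∀ g → Unit g →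
      ∣ ∑ᵤ (λ h → P j h * P (j ℕ.* j) (hinv h ℕ.* g)) - φ * P (j ℕ.* j) g ∣ ≤ K * inv T
    P-eigen {T} j 1≤j big 1≤T T≤j g ug = subst (λ z → ∣ z ∣ ≤ K * inv T) (sym eq) (≤-trans (∣*∣≤ {inv j * inv j'} (≤-eq (∣∣≥0 (0≤* (0≤inv j) (0≤inv j')))) (Pair.Q-convolution j 1≤j big g ug))
        (≤-trans (≤-eq eq₂) (inv-bound 0≤K₂ K₂≤K 1≤T T≤j)))
      where
      j' = j ℕ.* j
      eq : ∑ᵤ (λ h → P j h * P j' (hinv h ℕ.* g)) - φ * P j' g ≡ inv j * inv j' * (∑ᵤ (λ h → Q j h * Q j' (hinv h ℕ.* g)) - φ * (ι j * Q j' g))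
      eq = trans (cong₂ _-_ (trans (∑ᵤ-cong (λ h _ → r₁ (inv j) (inv j') (Q j h) (Q j' (hinv h ℕ.* g)))) (∑ᵤ-*ˡ (inv j * inv j') _))
             (trans (r₂ φ (inv j') (Q j' g)) (cong (_* (inv j' * (φ * Q j' g))) (sym (inv*ι 1≤j))))) (r₃ (inv j) (inv j') (∑ᵤ (λ h → Q j h * Q j' (hinv h ℕ.* g))) φ (ι j) (Q j' g))
        where
        r₁ : ∀ a b p q → a * p * (b * q) ≡ a * b * (p * q)
        r₁ = solve-∀ ℚ-ring
        r₂ : ∀ f i q → f * (i * q) ≡ 1ℚ * (i * (f * q))
        r₂ = solve-∀ ℚ-ring
        r₃ : ∀ a b s f t q → a * b * s - a * t * (b * (f * q)) ≡ a * b * (s - f * (t * q))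
        r₃ = solve-∀ ℚ-ring
      eq₂ : inv j * inv j' * (K₂ * (ι j * ι j)) ≡ K₂ * inv j
      eq₂ = trans (cong (λ z → inv j * inv j' * (K₂ * z)) (sym (ι-* j j))) (trans (r (inv j) (inv j') K₂ (ι j')) (trans (cong (K₂ * inv j *_) (inv*ι (ℕₚ.*-mono-≤ 1≤j 1≤j))) (ℚₚ.*-identityʳ _)))
        where
        r : ∀ a b k t → a * b * (k * t) ≡ k * a * (b * t)
        r = solve-∀ ℚ-ring

    P-large : ∀ {T} j c → 1 ℕ.≤ T → T ℕ.≤ j → (∀ p → Prime p → ¬ p ≋ c) → 1ℚ - K * inv T ≤ P j c
    P-large {T} j c 1≤T T≤j np = lin (0≤inv j ⊙ (0≤φ ⊙ S-small j c np) ⊕ inv-bound 0≤12φ 12φ≤K 1≤T T≤j)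
      (trans (cong (λ z → z + (inv j * (φ * S j c) + 12ℚ * φ * inv j)) (trans (r₁ (inv j) (ι j) (φ * S j c)) (cong (_- inv j * (φ * S j c)) (inv*ι (ℕₚ.≤-trans 1≤T T≤j))))) (r₂ (inv j * (φ * S j c)) φ (inv j) (K * inv T)))
      where
      r₁ : ∀ i t s → i * (t - s) ≡ i * t - i * s
      r₁ = solve-∀ ℚ-ring
      r₂ : ∀ s f i k → 1ℚ - s + (s + 12ℚ * f * i) ≡ 1ℚ - k + (i * (f * 12ℚ) + k)
      r₂ = solve-∀ ℚ-ring

    P-mean : ∀ {T} j → 2 ℕ.^ j ℕ.≤ X → 1 ℕ.≤ T → T ℕ.≤ j → ∣ ∑ᵤ (P j) ∣ ≤ K * inv T
    P-mean {T} j h 1≤T T≤j = subst (λ z → ∣ z ∣ ≤ K * inv T) (sym eq) (≤-trans (∣*∣≤ {inv j * φ} (≤-eq (∣∣≥0 (0≤* (0≤inv j) 0≤φ))) (subst (_≤ Cσ) (trans (sym (ℚₚ.∣-p∣≡∣p∣ (σ j - ι j))) (cong ∣_∣ (r₀ (σ j) (ι j)))) (∣σ-t∣ j h)))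
        (≤-trans (≤-eq (r₁ (inv j) φ Cσ)) (inv-bound 0≤φCσ φCσ≤K 1≤T T≤j)))
      where
      r₀ : ∀ s t → - (s - t) ≡ t - s
      r₀ = solve-∀ ℚ-ring
      r₁ : ∀ i f c → i * f * c ≡ f * c * i
      r₁ = solve-∀ ℚ-ring
      eq : ∑ᵤ (P j) ≡ inv j * φ * (ι j - σ j)
      eq = trans (∑ᵤ-*ˡ (inv j) (Q j)) (trans (cong (inv j *_) (trans (∑-cong' m (λ h → r₂ (𝟙 (unit? h)) (ι j) φ (S j h))) (trans (∑-- m _ _) (cong₂ _-_ (∑ᵤ-const (ι j)) (trans (∑-*ˡ m φ _) (cong (φ *_) (∑ᵤ-S j))))))) (r₃ (inv j) φ (ι j) (σ j)))
        where
        r₂ : ∀ u t f s → u * (t - f * s) ≡ u * t - f * (u * s)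
        r₂ = solve-∀ ℚ-ring
        r₃ : ∀ i f t s → i * (f * t - f * s) ≡ i * f * (t - s)
        r₃ = solve-∀ ℚ-ring

    -- Summed over primes, χ is close to -1, which is incompatible with L(1, χ) being bounded below.
    contradiction-with-character : ∀ j v (χ : ℕ → ℚ) → 1 ℕ.≤ j → suc (2 ℕ.^ j) ℕ.≤ X → 1 ℕ.≤ v → 16 ℕ.* (v ℕ.* v ℕ.* (v ℕ.* v)) ℕ.≤ X → 7ℚ * ι m + 1ℚ ≤ ι v →
      suc (40 ℕ.* m ℕ.* (32 ℕ.* (v ℕ.* (v ℕ.* v)))) ℕ.≤ j →
      (∀ a b → χ (a ℕ.* b) ≡ χ a * χ b) → χ 1 ≡ 1ℚ → (∀ n → χ n ≡ 0ℚ ⊎ IsSign (χ n)) → (∀ {a b} → a ≋ b → χ a ≡ χ b) → Osc (ι m) χ →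
      (∀ n → Unit n → χ n ≡ sg (P j n)) → (∀ n → ¬ Unit n → χ n ≡ 0ℚ) → ∑ᵤ (λ h → sg (P j h)) ≡ 0ℚ → (∀ h → Unit h → ½ ≤ ∣ P j h ∣) → ⊥
    contradiction-with-character j v χ 1≤j big 1≤v v≤X v-big j-big χ-* χ-1 χ-values χ-resp osc χ-sg χ-0 ∑sg≡0 half =
      ℕₚ.<⇒≱ j-big (ι-cancel-≤ (≤-trans final (≤-eq (trans (cong (_* ι w) (sym (ι-* 40 m))) (sym (ι-* (40 ℕ.* m) w))))))
      where
      w = 32 ℕ.* (v ℕ.* (v ℕ.* v))
      x = 2 ℕ.^ j
      L = A χ X
      1≤wL : 1ℚ ≤ ι w * L
      1≤wL = RealCharacter.L-lower-bound χ χ-* χ-1 χ-values (ι m) v X (0≤ι m) osc 1≤v v-big v≤X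
      Sχ = ∑ x (λ d → Λ/ d * χ d)
      A-dil : ∀ d → A (dil d χ) X ≡ χ d * L
      A-dil d = trans (∑-cong' X (λ k → trans (cong (_* inv k) (χ-* d k)) (ℚₚ.*-assoc (χ d) (χ k) (inv k)))) (∑-*ˡ X (χ d) _)
      SL : ∣ Sχ * L ∣ ≤ ι m * 20ℚ
      SL = subst (λ z → ∣ z ∣ ≤ ι m * 20ℚ) (trans (∑-cong' x (λ d → trans (cong (Λ/ d *_) (A-dil d)) (sym (ℚₚ.*-assoc (Λ/ d) (χ d) L)))) (∑-*ʳ x L _)) (twisted-Λ j χ big (0≤ι m) osc)
      Sχ≡ : Sχ ≡ ∑ᵤ (λ h → sg (P j h) * S j h)
      Sχ≡ = trans (∑-cong' x (λ d → cong (Λ/ d *_) (χ-cls d))) (trans (∑-cong' x (λ d → sym (∑ᵤ-*ˡ (Λ/ d) _))) (trans (sym (∑ᵤ-∑ x _)) (∑ᵤ-cong (λ h uh →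
          trans (∑-cong' x (λ d → trans (r (Λ/ d) (cls h d) (χ h)) (cong (_* (Λ/ d * cls h d)) (χ-sg h uh)))) (∑-*ˡ x (sg (P j h)) _)))))
        where
        r : ∀ a b c → a * (b * c) ≡ c * (a * b)
        r = solve-∀ ℚ-ring
        χ-cls : ∀ d → χ d ≡ ∑ᵤ (λ h → cls h d * χ h)
        χ-cls d = sym (trans (∑ᵤ-cls d χ χ-resp) (kill (unit? d)))
          where
          kill : (u : Dec (Unit d)) → 𝟙 u * χ d ≡ χ d
          kill (yes _) = ℚₚ.*-identityˡ (χ d)
          kill (no ¬u) = trans (ℚₚ.*-zeroˡ (χ d)) (sym (χ-0 d ¬u))
      -- φ S(h) = j (1 - P(h)); as the signs sum to 0, only the part with P remains.
      φSχ : φ * Sχ ≡ - (ι j * ∑ᵤ (λ h → ∣ P j h ∣))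
      φSχ = trans (cong (φ *_) Sχ≡) (trans (sym (∑ᵤ-*ˡ φ _)) (trans (∑ᵤ-cong (λ h _ → pointwise h)) (trans (∑-cong' m (λ h → r₂ (𝟙 (unit? h)) (ι j) (sg (P j h)) ∣ P j h ∣)) (trans (∑-- m _ _)
          (trans (cong₂ _-_ (trans (∑-*ˡ m (ι j) _) (trans (cong (ι j *_) ∑sg≡0) (ℚₚ.*-zeroʳ (ι j)))) (∑-*ˡ m (ι j) _)) (ℚₚ.+-identityˡ _))))))
        where
        r₁ : ∀ f s q t → f * (s * q) ≡ t * s - s * (t - f * q)
        r₁ = solve-∀ ℚ-ring
        r₂ : ∀ u t s p → u * (t * s - t * p) ≡ t * (u * s) - t * (u * p)
        r₂ = solve-∀ ℚ-ring
        Q≡ : ∀ h → Q j h ≡ ι j * P j h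
        Q≡ h = sym (trans (sym (ℚₚ.*-assoc (ι j) (inv j) (Q j h))) (trans (cong (_* Q j h) (ι*inv 1≤j)) (ℚₚ.*-identityˡ (Q j h))))
        pointwise : ∀ h → φ * (sg (P j h) * S j h) ≡ ι j * sg (P j h) - ι j * ∣ P j h ∣
        pointwise h = trans (r₁ φ (sg (P j h)) (S j h) (ι j)) (cong (λ z → ι j * sg (P j h) - z) (trans (cong (sg (P j h) *_) (Q≡ h)) (trans (r₃ (sg (P j h)) (ι j) (P j h)) (cong (ι j *_) (sg*∣∣ (P j h))))))
          where
          r₃ : ∀ s t p → s * (t * p) ≡ t * (s * p)
          r₃ = solve-∀ ℚ-ring
      -- -Sχ is at least j/2, while -Sχ · L ≤ 20 m and w L ≥ 1.
      final : ι j ≤ ι 40 * ι m * ι w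
      final = ℚₚ.*-cancelˡ-≤-pos φ {{positive (ℚₚ.<-≤-trans (ℚₚ.positive⁻¹ 1ℚ) 1≤φ)}}
        (lin (0≤ι 2 ⊙ (0≤ι j ⊙ lower) ⊕ 0≤ι 2 ⊙ (0≤φn ⊙ 1≤wL) ⊕ 0≤* (0≤* (0≤ι 2) 0≤φ) (0≤ι w) ⊙ nL)
          (trans (cong (λ z → φ * (ι 40 * ι m * ι w) + (2ℚ * (ι j * (φ * ½)) + (2ℚ * (z * 1ℚ) + 2ℚ * φ * ι w * - (Sχ * L)))) φn)
            (r φ (ι j) (ι m) (ι w) Σ∣P∣ Sχ L)))
        where
        Σ∣P∣ = ∑ᵤ (λ h → ∣ P j h ∣)
        φn : φ * - Sχ ≡ ι j * Σ∣P∣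
        φn = trans (sym (ℚₚ.neg-distribʳ-* φ Sχ)) (trans (cong -_ φSχ) (r₀ (ι j * Σ∣P∣)))
          where
          r₀ : ∀ a → - - a ≡ a
          r₀ = solve-∀ ℚ-ring
        lower : φ * ½ ≤ Σ∣P∣
        lower = ≤-trans (≤-eq (sym (∑ᵤ-const ½))) (∑ᵤ-mono half)
        0≤φn : 0ℚ ≤ φ * - Sχ
        0≤φn = subst (0ℚ ≤_) (sym φn) (0≤* (0≤ι j) (≤-trans (0≤* 0≤φ (ℚₚ.nonNegative⁻¹ ½)) lower))
        nL : - (Sχ * L) ≤ ι m * 20ℚ
        nL = ≤-trans (-p≤∣p∣ (Sχ * L)) SL
        r : ∀ f t m w p s l → f * (ι 40 * m * w) + (2ℚ * (t * (f * ½)) + (2ℚ * (t * p * 1ℚ) + 2ℚ * f * w * - (s * l))) ≡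
            f * t + (2ℚ * (t * p) + (2ℚ * (f * - s * (w * l)) + 2ℚ * f * w * (m * 20ℚ)))
        r = solve-∀ ℚ-ring

  dirichlet : ∀ c → Unit c → (∀ p → Prime p → ¬ p ≋ c) → ⊥
  dirichlet c uc no-prime = contradiction-with-character j₂ v AC.χ 1≤j₂ big₂ 1≤v v≤X v-big j-big AC.χ-* AC.χ-1 AC.χ-values AC.χ-resp
      (AC.Osc-χ mean) (λ n u → AC.χ-unit u) (λ n ¬u → AC.χ-non-unit ¬u) (AC.∑χ≡0 mean) AC.P'-half
    where
    v w T₀ T j₁ j₂ X : ℕ
    v  = suc (7 ℕ.* m)
    w  = 40 ℕ.* m ℕ.* (32 ℕ.* (v ℕ.* (v ℕ.* v)))
    T₀ = proj₁ (archimedean (K * (32ℚ * (φ * φ))))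
    -- Larger than `w` for the final contradiction and than `T₀` to make ε small. The bounds of |P|
    -- at `j₁` and `j₂` come from the pairs (T, T²) and (T², T⁴).
    T  = suc (w ℕ.+ T₀)
    j₁ = T ℕ.* T
    j₂ = j₁ ℕ.* j₁
    X  = suc (2 ℕ.^ j₂) ℕ.+ (m ℕ.+ 16 ℕ.* (v ℕ.* v ℕ.* (v ℕ.* v)))
    1≤v : 1 ℕ.≤ v
    1≤v = s≤s z≤n
    1≤T : 1 ℕ.≤ T
    1≤T = s≤s z≤n
    1≤j₁ : 1 ℕ.≤ j₁
    1≤j₁ = ℕₚ.*-mono-≤ 1≤T 1≤T
    1≤j₂ : 1 ℕ.≤ j₂
    1≤j₂ = ℕₚ.*-mono-≤ 1≤j₁ 1≤j₁
    T≤j₁ : T ℕ.≤ j₁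
    T≤j₁ = ℕₚ.m≤m*n T T
    j₁≤j₂ : j₁ ℕ.≤ j₂
    j₁≤j₂ = ℕₚ.m≤m*n j₁ j₁ {{ℕ.>-nonZero 1≤j₁}}
    T≤j₂ = ℕₚ.≤-trans T≤j₁ j₁≤j₂
    big₂ : suc (2 ℕ.^ j₂) ℕ.≤ X
    big₂ = ℕₚ.m≤m+n (suc (2 ℕ.^ j₂)) _
    big₁ : suc (2 ℕ.^ j₁) ℕ.≤ X
    big₁ = ℕₚ.≤-trans (s≤s (ℕₚ.^-monoʳ-≤ 2 j₁≤j₂)) big₂
    1≤X : 1 ℕ.≤ X
    1≤X = ℕₚ.≤-trans (s≤s z≤n) big₂
    m≤X : m ℕ.≤ X
    m≤X = ℕₚ.≤-trans (ℕₚ.m≤m+n m _) (ℕₚ.m≤n+m _ (suc (2 ℕ.^ j₂)))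
    v≤X : 16 ℕ.* (v ℕ.* v ℕ.* (v ℕ.* v)) ℕ.≤ X
    v≤X = ℕₚ.≤-trans (ℕₚ.m≤n+m _ m) (ℕₚ.m≤n+m _ (suc (2 ℕ.^ j₂)))
    v-big : 7ℚ * ι m + 1ℚ ≤ ι v
    v-big = ≤-eq (trans (cong (_+ 1ℚ) (sym (ι-* 7 m))) (ℚₚ.+-comm (ι (7 ℕ.* m)) 1ℚ))
    j-big : suc w ℕ.≤ j₂
    j-big = ℕₚ.≤-trans (s≤s (ℕₚ.m≤m+n w T₀)) T≤j₂
    ε = K * inv T
    0≤K : 0ℚ ≤ K
    0≤K = ≤-trans 0≤K₁ K₁≤K
    small : ε * (32ℚ * (φ * φ)) ≤ 1ℚ
    small = ≤-trans (≤-eq (r K (inv T) (32ℚ * (φ * φ)))) (≤-trans (0≤inv T ⊙ ≤-trans (proj₂ (archimedean (K * (32ℚ * (φ * φ))))) (ι-mono (ℕₚ.m≤n⇒m≤1+n (ℕₚ.m≤n+m T₀ w)))) (≤-eq (inv*ι 1≤T)))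
      where
      r : ∀ k i f → k * i * f ≡ i * (k * f)
      r = solve-∀ ℚ-ring
    open UpTo 1≤X (logUpTo X 1≤X) m≤X
    mean : ∣ ∑ᵤ (P j₂) ∣ ≤ ε
    mean = P-mean j₂ (ℕₚ.<⇒≤ big₂) 1≤T T≤j₂
    module AC = ApproximateCharacter.Signs m (P j₁) (P j₂) ε c uc (P-resp j₁) (P-resp j₂) (0≤* 0≤K (0≤inv T)) small
      (∣P∣ T 1≤T big₁ 1≤T ℕₚ.≤-refl) (∣P∣ j₁ 1≤j₁ big₂ 1≤T T≤j₁) (P-eigen j₁ 1≤j₁ big₂ 1≤T T≤j₁) (P-large j₁ c 1≤T T≤j₁ no-prime) (P-large j₂ c 1≤T T≤j₂ no-prime)

-- Progressions and covering moduli

≋⇒multiple : ∀ m {{_ : ℕ.NonZero m}} {n b} → b ℕ.≤ n → n DM.% m ≡ b DM.% m → ∃[ h ] n ≡ m ℕ.* h ℕ.+ b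
≋⇒multiple m {n} {b} b≤n e = n DM./ m ℕ.∸ b DM./ m , trans (sym (ℕₚ.m∸n+n≡m b≤n)) (cong (ℕ._+ b) eq)
  where
  open ≡-Reasoning
  eq : n ℕ.∸ b ≡ m ℕ.* (n DM./ m ℕ.∸ b DM./ m)
  eq = begin
    n ℕ.∸ b
      ≡⟨ cong₂ ℕ._∸_ (DM.m≡m%n+[m/n]*n n m) (DM.m≡m%n+[m/n]*n b m) ⟩
    (n DM.% m ℕ.+ n DM./ m ℕ.* m) ℕ.∸ (b DM.% m ℕ.+ b DM./ m ℕ.* m)
      ≡⟨ cong (λ z → (z ℕ.+ n DM./ m ℕ.* m) ℕ.∸ (b DM.% m ℕ.+ b DM./ m ℕ.* m)) e ⟩
    (b DM.% m ℕ.+ n DM./ m ℕ.* m) ℕ.∸ (b DM.% m ℕ.+ b DM./ m ℕ.* m)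
      ≡⟨ ℕₚ.[m+n]∸[m+o]≡n∸o (b DM.% m) _ _ ⟩
    n DM./ m ℕ.* m ℕ.∸ b DM./ m ℕ.* m
      ≡⟨ sym (ℕₚ.*-distribʳ-∸ m (n DM./ m) (b DM./ m)) ⟩
    (n DM./ m ℕ.∸ b DM./ m) ℕ.* m
      ≡⟨ ℕₚ.*-comm _ m ⟩
    m ℕ.* (n DM./ m ℕ.∸ b DM./ m) ∎

coprime-^ : ∀ {a b} k → 1 ℕ.≤ b → Coprime a b → Coprime (a ℕ.^ k) b
coprime-^ zero    1≤b c = Cop.1-coprimeTo _
coprime-^ {a} {b} (suc k) 1≤b c = Residues.unit-* b {{ℕ.>-nonZero 1≤b}} {a} c (coprime-^ k 1≤b c)

-- The prime is made large by passing to the class of c % m + m b modulo m ^ (b + 1).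
dirichlet-large : ∀ m {{_ : ℕ.NonZero m}} c b → 2 ℕ.≤ m → 1 ℕ.≤ b → Coprime c m → (∀ p → Prime p → b ℕ.≤ p → p DM.% m ≢ c DM.% m) → ⊥
dirichlet-large m c b 2≤m 1≤b cop none = Limits.dirichlet m' c' (λ {i} → cop' {i}) (λ p pp e → none p pp (large p e) (same p e))
  where
  m' = m ℕ.^ suc b
  instance
    m'≢0 : ℕ.NonZero m'
    m'≢0 = ℕₚ.m^n≢0 m (suc b)
  c' = c DM.% m ℕ.+ b ℕ.* m
  module R = Residues m
  c'≋c : c' R.≋ c
  c'≋c = trans (DM.[m+kn]%n≡m%n (c DM.% m) b m) (DM.m%n%n≡m%n c m)
  b≤c' : b ℕ.≤ c'
  b≤c' = ℕₚ.≤-trans (ℕₚ.m≤m*n b m) (ℕₚ.m≤n+m _ (c DM.% m))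
  -- Since b < m^b, c' is its own residue modulo m^(b + 1), so that every number in its class is at
  -- least c' ≥ b.
  c'<m' : c' ℕ.< m'
  c'<m' = ℕₚ.<-≤-trans (ℕₚ.+-monoˡ-< (b ℕ.* m) (DM.m%n<n c m)) (ℕₚ.≤-trans (ℕₚ.≤-reflexive (ℕₚ.*-comm (suc b) m)) (ℕₚ.*-monoʳ-≤ m (<-pow b 2≤m)))
  cop' : Coprime c' m'
  cop' = Cop.sym (coprime-^ (suc b) (ℕₚ.≤-trans 1≤b b≤c') (Cop.sym (R.unit-resp-≋ (sym c'≋c) cop)))
  large : ∀ p → p DM.% m' ≡ c' DM.% m' → b ℕ.≤ p
  large p e = ℕₚ.≤-trans b≤c' (subst (ℕ._≤ p) (trans e (DM.m<n⇒m%n≡m c'<m')) (DM.m%n≤m p m'))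
  same : ∀ p → p DM.% m' ≡ c' DM.% m' → p R.≋ c
  same p e = trans (cong (DM._% m) (trans (DM.m≡m%n+[m/n]*n p m') (cong₂ ℕ._+_ (trans e (DM.m<n⇒m%n≡m c'<m')) (r (p DM./ m') m (m ℕ.^ b))))) (trans (DM.[m+kn]%n≡m%n c' (p DM./ m' ℕ.* m ℕ.^ b) m) c'≋c)
    where
    r : ∀ q m x → q ℕ.* (m ℕ.* x) ≡ q ℕ.* x ℕ.* m
    r = ℕ-Solver.solve-∀

∣a-z∣-≥ : ∀ {a z} → z ℕ.≤ a → ℤ.∣ ℤ.+ a ℤ.- ℤ.+ z ∣ ≡ a ℕ.∸ z
∣a-z∣-≥ {a} {z} h = trans (cong ℤ.∣_∣ (ℤₚ.m-n≡m⊖n a z)) (cong ℤ.∣_∣ (ℤₚ.⊖-≥ h))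

∣a-z∣-≤ : ∀ {a z} → a ℕ.≤ z → ℤ.∣ ℤ.+ a ℤ.- ℤ.+ z ∣ ≡ z ℕ.∸ a
∣a-z∣-≤ {a} {z} h = trans (cong ℤ.∣_∣ (ℤₚ.m-n≡m⊖n a z)) (ℤₚ.∣⊖∣-≤ h)

-- Modulo d the number c is a - z, which moves divisibility of an integer difference to natural
-- numbers.
∣-difference : ∀ {d a z c e} → c ℕ.+ z ≡ e ℕ.+ a → d ∣ e → (d ∣ c → d ∣ ℤ.∣ ℤ.+ a ℤ.- ℤ.+ z ∣) × (d ∣ ℤ.∣ ℤ.+ a ℤ.- ℤ.+ z ∣ → d ∣ c)
∣-difference {d} {a} {z} {c} {e} eq d∣e with ℕₚ.≤-total z a
... | inj₁ z≤a = (λ h → subst (d ∣_) (sym (∣a-z∣-≥ z≤a)) (∣ₚ.∣m+n∣m⇒∣n (subst (d ∣_) c≡ h) d∣e))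
               , (λ h → subst (d ∣_) (sym c≡) (∣ₚ.∣m∣n⇒∣m+n d∣e (subst (d ∣_) (∣a-z∣-≥ z≤a) h)))
  where
  c≡ : c ≡ e ℕ.+ (a ℕ.∸ z)
  c≡ = ℕₚ.+-cancelʳ-≡ z c (e ℕ.+ (a ℕ.∸ z)) (trans eq (trans (cong (e ℕ.+_) (sym (ℕₚ.m∸n+n≡m z≤a))) (sym (ℕₚ.+-assoc e (a ℕ.∸ z) z))))
... | inj₂ a≤z = (λ h → subst (d ∣_) (sym (∣a-z∣-≤ a≤z)) (∣ₚ.∣m+n∣m⇒∣n (subst (d ∣_) (sym c≡) d∣e) h))
               , (λ h → ∣ₚ.∣m+n∣m⇒∣n (subst (d ∣_) (trans (sym c≡) (ℕₚ.+-comm c (z ℕ.∸ a))) d∣e) (subst (d ∣_) (∣a-z∣-≤ a≤z) h))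
  where
  c≡ : c ℕ.+ (z ℕ.∸ a) ≡ e
  c≡ = ℕₚ.+-cancelʳ-≡ a _ e (trans (ℕₚ.+-assoc c (z ℕ.∸ a) a) (trans (cong (c ℕ.+_) (ℕₚ.m∸n+n≡m a≤z)) eq))

odd-suc : ∀ {n} → Odd n → Odd (suc n) → ⊥
odd-suc {n} (i , e) (j , f) = ℕₚ.even≢odd j i (trans (sym (ℕₚ.suc-injective f)) e)

progression⇒covering : ∀ a → InUnionOfAPs a → CoveringModulus a
progression⇒covering a (m , b , (1≤m , 1≤b , good) , h , a≡) = m , 1<m , covers
  where
  instance
    m≢0 : ℕ.NonZero m
    m≢0 = ℕ.>-nonZero 1≤m
  -- Step length 1 would make two consecutive numbers odd.
  1<m : 2 ℕ.≤ m
  1<m = ℕₚ.≤∧≢⇒< 1≤m λ { refl → odd-suc (proj₁ (proj₂ (good 0))) (proj₁ (proj₂ (good 1))) }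
  covers : ∀ k → 1 ℕ.≤ k → 1 ℕ.< gcdℤ (ℤ.+ a ℤ.- ℤ.+ (2 ℕ.^ k)) m
  covers k 1≤k with 1 ℕₚ.<? gcdℤ (ℤ.+ a ℤ.- ℤ.+ (2 ℕ.^ k)) m
  ... | yes p = p
  ... | no ¬p = ⊥-elim (dirichlet-large m c b 1<m 1≤b cop none)
    where
    z = 2 ℕ.^ k
    -- A natural number congruent to a - z modulo m.
    c = a ℕ.+ z ℕ.* ℕ.pred m
    c+z : c ℕ.+ z ≡ z ℕ.* m ℕ.+ a
    c+z = trans (r a z (ℕ.pred m)) (cong (λ y → z ℕ.* y ℕ.+ a) (ℕₚ.suc-pred m))
      where
      r : ∀ a z y → a ℕ.+ z ℕ.* y ℕ.+ z ≡ z ℕ.* suc y ℕ.+ a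
      r = ℕ-Solver.solve-∀
    g = gcdℤ (ℤ.+ a ℤ.- ℤ.+ z) m
    g≡1 : g ≡ 1
    g≡1 = ℕₚ.≤-antisym (ℕₚ.≮⇒≥ ¬p) (ℕₚ.n≢0⇒n>0 (GCD.gcd[m,n]≢0 ℤ.∣ ℤ.+ a ℤ.- ℤ.+ z ∣ m (inj₂ (ℕ.≢-nonZero⁻¹ m))))
    cop : Coprime c m
    cop {d} (d∣c , d∣m) = ∣ₚ.∣1⇒≡1 (subst (d ∣_) g≡1 (GCD.gcd-greatest (proj₁ (∣-difference c+z (∣ₚ.∣n⇒∣m*n z d∣m)) d∣c) d∣m))
    -- Such a p gives p + z congruent to b and not below b, hence a representable member of the
    -- progression.
    none : ∀ p → Prime p → b ℕ.≤ p → p DM.% m ≢ c DM.% m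
    none p pp b≤p e with ≋⇒multiple m {p ℕ.+ z} {b} (ℕₚ.≤-trans b≤p (ℕₚ.m≤m+n p z)) same
      where
      open ≡-Reasoning
      same : (p ℕ.+ z) DM.% m ≡ b DM.% m
      same = begin
        (p ℕ.+ z) DM.% m               ≡⟨ DM.%-distribˡ-+ p z m ⟩
        (p DM.% m ℕ.+ z DM.% m) DM.% m ≡⟨ cong (λ y → (y ℕ.+ z DM.% m) DM.% m) e ⟩
        (c DM.% m ℕ.+ z DM.% m) DM.% m ≡⟨ sym (DM.%-distribˡ-+ c z m) ⟩
        (c ℕ.+ z) DM.% m               ≡⟨ cong (DM._% m) (trans c+z (ℕₚ.+-comm (z ℕ.* m) a)) ⟩
        (a ℕ.+ z ℕ.* m) DM.% m         ≡⟨ DM.[m+kn]%n≡m%n a z m ⟩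
        a DM.% m                       ≡⟨ cong (DM._% m) (trans a≡ (trans (ℕₚ.+-comm (m ℕ.* h) b) (cong (b ℕ.+_) (ℕₚ.*-comm m h)))) ⟩
        (b ℕ.+ h ℕ.* m) DM.% m         ≡⟨ DM.[m+kn]%n≡m%n b h m ⟩
        b DM.% m                       ∎
    ... | h' , n≡ = proj₂ (proj₂ (proj₂ (proj₂ (good h')))) (p , k , pp , 1≤k , sym n≡)

prime[3] : Prime 3
prime[3] = from-yes (prime? 3)

3∤2^ : ∀ k → ¬ 3 ∣ 2 ℕ.^ k
3∤2^ k h with prime∣^⇒≡ k prime[3] prime[2] h
... | ()

∣-small : ∀ {d n} → d ∣ n → n ℕ.< d → n ≡ 0
∣-small {d} {zero}  _ _ = refl
∣-small {d} {suc n} h n<d = contradiction (∣ₚ.∣⇒≤ h) (ℕₚ.<⇒≱ n<d)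

-- The factor 3 of the new modulus excludes p = a; the factor 2^t, with t large, excludes the other primes p dividing m.
covering⇒progression : ∀ a → InU a → CoveringModulus a → InUnionOfAPs a
covering⇒progression a (1≤a , (i , a≡) , a∉) (m , 1<m , covers) = M , a , (1≤M , 1≤a , good) , 0 , cong (ℕ._+ a) (sym (ℕₚ.*-zeroʳ M))
  where
  t = a ℕ.+ m
  M = 3 ℕ.* (m ℕ.* 2 ℕ.^ suc t)
  1≤m : 1 ℕ.≤ m
  1≤m = ℕₚ.<⇒≤ 1<m
  1≤M : 1 ℕ.≤ M
  1≤M = ℕₚ.*-mono-≤ {1} {3} (s≤s z≤n) (ℕₚ.*-mono-≤ 1≤m (ℕₚ.m^n>0 2 (suc t)))
  m<2^t : m ℕ.< 2 ℕ.^ t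
  m<2^t = ℕₚ.≤-<-trans (ℕₚ.m≤n+m m a) (n<2^n t)
  a<2^t : a ℕ.< 2 ℕ.^ t
  a<2^t = ℕₚ.≤-<-trans (ℕₚ.m≤m+n a m) (n<2^n t)
  2^t<2^ : 2 ℕ.^ t ℕ.< 2 ℕ.^ suc t
  2^t<2^ = ℕₚ.^-monoʳ-< 2 (s≤s (s≤s z≤n)) (ℕₚ.n<1+n t)
  2^∣M : 2 ℕ.^ suc t ∣ M
  2^∣M = ∣ₚ.∣n⇒∣m*n 3 (∣ₚ.∣n⇒∣m*n m ∣ₚ.∣-refl)
  M-odd : ∀ h → Odd (M ℕ.* h ℕ.+ a)
  M-odd h = 3 ℕ.* (m ℕ.* 2 ℕ.^ t) ℕ.* h ℕ.+ i , trans (cong (M ℕ.* h ℕ.+_) a≡) (r m (2 ℕ.^ t) h i)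
    where
    r : ∀ m x h i → 3 ℕ.* (m ℕ.* (2 ℕ.* x)) ℕ.* h ℕ.+ suc (2 ℕ.* i) ≡ suc (2 ℕ.* (3 ℕ.* (m ℕ.* x) ℕ.* h ℕ.+ i))
    r = ℕ-Solver.solve-∀
  1≤n : ∀ h → 1 ℕ.≤ M ℕ.* h ℕ.+ a
  1≤n h = ℕₚ.≤-trans 1≤a (ℕₚ.m≤n+m a (M ℕ.* h))
  not-representable : ∀ h → ¬ Representable (M ℕ.* h ℕ.+ a)
  not-representable h (p , k , pp , 1≤k , e) = by-h h e
    where
    g = gcdℤ (ℤ.+ a ℤ.- ℤ.+ (2 ℕ.^ k)) m
    g∣m : g ∣ m
    g∣m = GCD.gcd[m,n]∣n ℤ.∣ ℤ.+ a ℤ.- ℤ.+ (2 ℕ.^ k) ∣ m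
    g∣p : g ∣ p
    g∣p = proj₂ (∣-difference (sym e) (∣ₚ.∣m⇒∣m*n h (∣ₚ.∣n⇒∣m*n 3 (∣ₚ.∣m⇒∣m*n (2 ℕ.^ suc t) g∣m)))) (GCD.gcd[m,n]∣m ℤ.∣ ℤ.+ a ℤ.- ℤ.+ (2 ℕ.^ k) ∣ m)
    -- The gcd exceeds 1 and divides the prime p, so it is p, and it divides m.
    p≤m : p ℕ.≤ m
    p≤m with prime⇒irreducible pp g∣p
    ... | inj₁ g≡1 = contradiction (covers k 1≤k) (ℕₚ.<-irrefl (sym g≡1))
    ... | inj₂ g≡p = ∣⇒≤' 1≤m (subst (_∣ m) g≡p g∣m)
    by-h : ∀ h → M ℕ.* h ℕ.+ a ≡ p ℕ.+ 2 ℕ.^ k → ⊥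
    by-h zero e = a∉ (p , k , pp , 1≤k , trans (cong (ℕ._+ a) (sym (ℕₚ.*-zeroʳ M))) e)
    by-h (suc h) e with k ℕₚ.≤? t
    -- Size: p + 2^k < 2^(t + 1) ≤ M.
    ... | yes k≤t = ℕₚ.<⇒≱ (ℕₚ.+-mono-<-≤ (ℕₚ.≤-<-trans p≤m m<2^t) (ℕₚ.^-monoʳ-≤ 2 k≤t)) (ℕₚ.≤-trans (ℕₚ.≤-reflexive (sym (2^-suc t)))
          (ℕₚ.≤-trans (ℕₚ.≤-trans (∣⇒≤' 1≤M 2^∣M) (ℕₚ.≤-trans (ℕₚ.m≤m*n M (suc h)) (ℕₚ.m≤m+n _ a))) (ℕₚ.≤-reflexive e)))
    -- 2^(t + 1) divides M (h + 1) and 2^k, hence p - a; as p and a are smaller than it, p = a. Then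
    -- M (h + 1) = 2^k would be divisible by 3.
    ... | no k≰t = 3∤2^ k (subst (3 ∣_) (ℕₚ.+-cancelʳ-≡ a _ _ (trans e (trans (cong (ℕ._+ 2 ℕ.^ k) p≡a) (ℕₚ.+-comm a (2 ℕ.^ k))))) (∣ₚ.∣m⇒∣m*n (suc h) (∣ₚ.m∣m*n (m ℕ.* 2 ℕ.^ suc t))))
      where
      2^∣2^k : 2 ℕ.^ suc t ∣ 2 ℕ.^ k
      2^∣2^k with ℕₚ.m≤n⇒∃[o]m+o≡n (ℕₚ.≰⇒> k≰t)
      ... | o , refl = subst (2 ℕ.^ suc t ∣_) (sym (ℕₚ.^-distribˡ-+-* 2 (suc t) o)) (∣ₚ.m∣m*n (2 ℕ.^ o))
      2^∣Mh : 2 ℕ.^ suc t ∣ M ℕ.* suc h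
      2^∣Mh = ∣ₚ.∣m⇒∣m*n (suc h) 2^∣M
      p≡a : p ≡ a
      p≡a with ℕₚ.≤-total a p
      ... | inj₁ a≤p = ℕₚ.≤-antisym (ℕₚ.m∸n≡0⇒m≤n (∣-small (∣ₚ.∣m+n∣m⇒∣n (subst (2 ℕ.^ suc t ∣_) eq 2^∣Mh) 2^∣2^k) (ℕₚ.≤-<-trans (ℕₚ.m∸n≤m p a) (ℕₚ.≤-<-trans p≤m (ℕₚ.<-trans m<2^t 2^t<2^))))) a≤p
        where
        eq : M ℕ.* suc h ≡ 2 ℕ.^ k ℕ.+ (p ℕ.∸ a)
        eq = ℕₚ.+-cancelʳ-≡ a _ _ (trans e (trans (ℕₚ.+-comm p (2 ℕ.^ k)) (trans (cong (2 ℕ.^ k ℕ.+_) (sym (ℕₚ.m∸n+n≡m a≤p))) (sym (ℕₚ.+-assoc (2 ℕ.^ k) (p ℕ.∸ a) a)))))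
      ... | inj₂ p≤a = ℕₚ.≤-antisym p≤a (ℕₚ.m∸n≡0⇒m≤n (∣-small (∣ₚ.∣m+n∣m⇒∣n (subst (2 ℕ.^ suc t ∣_) (sym eq) 2^∣2^k) 2^∣Mh) (ℕₚ.≤-<-trans (ℕₚ.m∸n≤m a p) (ℕₚ.<-trans a<2^t 2^t<2^))))
        where
        eq : M ℕ.* suc h ℕ.+ (a ℕ.∸ p) ≡ 2 ℕ.^ k
        eq = ℕₚ.+-cancelʳ-≡ p _ _ (trans (ℕₚ.+-assoc (M ℕ.* suc h) (a ℕ.∸ p) p) (trans (cong (M ℕ.* suc h ℕ.+_) (ℕₚ.m∸n+n≡m p≤a)) (trans e (ℕₚ.+-comm p (2 ℕ.^ k)))))
  good : ∀ h → 1 ℕ.≤ M ℕ.* h ℕ.+ a × Odd (M ℕ.* h ℕ.+ a) × InU (M ℕ.* h ℕ.+ a)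
  good h = 1≤n h , M-odd h , 1≤n h , M-odd h , not-representable h

theorem4 : (a : ℕ) → InU a → (InUnionOfAPs a → CoveringModulus a) × (CoveringModulus a → InUnionOfAPs a)
theorem4 a a∈U = progression⇒covering a , covering⇒progression a a∈U
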